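{- Let $G$ be a nontrivial cactus on $n$ vertices with $k$ cycles, Randi\'c index $R$ and diameter $d$. Then \[R-d\geq -(k-1)\left(2-\sqrt 2\right)\qquad\text{and}\qquad R-\frac{d}{2}\geq \frac{n}{4}-(k-1)\left(\frac{7}{4}-\sqrt 2\right),\] with equality if the BC-tree of $G$ is a path and $G$ is longitudinally symmetric.
   Context: A cactus is a connected graph in which any two cycles share at most one vertex; it is nontrivial if it has no bridges (edges whose removal disconnects the graph). An articulation point is a vertex whose removal disconnects the graph; a block is a maximal connected subgraph with no articulation point of its own. The BC-tree has a vertex for each block and each articulation point, with an articulation point joined to each block containing it. A cactus whose BC-tree is a path is longitudinally symmetric if every cycle $c$ has an even number $s_c$ of vertices and any two articulation points of $G$ lying on $c$ are at distance $s_c/2$ from each other. The Randi\'c index is $R(G)=\sum_{uv\in E(G)}\frac{1}{\sqrt{d_ud_v}}$, where $d_v$ is the degree of $v$; the diameter is the maximum distance between two vertices.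
   Formalization: The cactus is assumed to have at least one cycle (k ≥ 1): the one-vertex graph has no bridges, k = 0 and R = d = 0, and violates both inequalities; it is the only case excluded. -}

module Defs where

open import Data.Bool using (Bool; true; false; T; if_then_else_; _∧_)
open import Data.Empty using (⊥)
open import Data.Fin using (Fin; toℕ)
open import Data.Fin.Subset as Subset using (Subset)
open import Data.Integer as ℤ using (+_; -[1+_])
import Data.Integer.Properties as ℤ
open import Data.Nat as ℕ using (ℕ; zero; suc)
open import Data.Nat.Divisibility using (_∣_)
import Data.Nat.Properties as ℕ
open import Data.Nat.Tactic.RingSolver using (solve-∀)
open import Data.Product using (Σ; ∃; ∃₂; ∃-syntax; _×_; _,_; proj₁; proj₂)
open import Data.Rational as ℚ using (ℚ; mkℚ; 0ℚ; 1ℚ; ½)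
import Data.Rational.Properties as ℚ
open import Data.Rational.Solver using (module +-*-Solver)
open import Data.Rational.Unnormalised as ℚᵘ using (mkℚᵘ)
import Data.Rational.Unnormalised.Properties as ℚᵘ
open import Data.Sum using (_⊎_; inj₁; inj₂)
open import Data.Unit using (⊤; tt)
open import Data.Vec using (tabulate)
open import Data.Vec.Functional using (foldr)
open import Function using (_⇔_; _∘_)
open import Function.Definitions using (Injective; StrictlySurjective)
open import Level using (0ℓ)
open import Relation.Binary using (Rel)
open import Relation.Binary.PropositionalEquality
open import Relation.Nullary using (¬_; yes; no; contradiction)
open import Relation.Unary using (Pred)

-- Reals are Cauchy sequences of rationals; equality of reals is _≈_, not _≡_.

IsCauchy : (ℕ → ℚ) → Set
IsCauchy x = ∀ ε → 0ℚ ℚ.< ε →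
  ∃[ N ] (∀ m n → N ℕ.≤ m → N ℕ.≤ n → ℚ.∣ x m ℚ.- x n ∣ ℚ.≤ ε)

record ℝ : Set where
  constructor mkℝ
  field
    seq    : ℕ → ℚ
    cauchy : IsCauchy seq

open ℝ public

infix 4 _≈_ _≤_

_≈_ : Rel ℝ 0ℓ
x ≈ y = ∀ ε → 0ℚ ℚ.< ε →
  ∃[ N ] (∀ n → N ℕ.≤ n → ℚ.∣ seq x n ℚ.- seq y n ∣ ℚ.≤ ε)

_≤_ : Rel ℝ 0ℓ
x ≤ y = ∀ ε → 0ℚ ℚ.< ε →
  ∃[ N ] (∀ n → N ℕ.≤ n → seq x n ℚ.≤ seq y n ℚ.+ ε)

Positive : Pred ℝ 0ℓ
Positive x = ∃[ q ] (0ℚ ℚ.< q × ∃[ N ] (∀ n → N ℕ.≤ n → q ℚ.≤ seq x n))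

half-pos : ∀ {ε} → 0ℚ ℚ.< ε → 0ℚ ℚ.< ½ ℚ.* ε
half-pos {ε} ε>0 = subst (ℚ._< ½ ℚ.* ε) (ℚ.*-zeroʳ ½) (ℚ.*-monoʳ-<-pos ½ ε>0)

*-pos : ∀ {p q} → 0ℚ ℚ.< p → 0ℚ ℚ.< q → 0ℚ ℚ.< p ℚ.* q
*-pos {p} {q} p>0 q>0 =
  subst (ℚ._< p ℚ.* q) (ℚ.*-zeroʳ p) (ℚ.*-monoʳ-<-pos p {{ℚ.positive p>0}} q>0)

halves : ∀ ε → ½ ℚ.* ε ℚ.+ ½ ℚ.* ε ≡ ε
halves ε = trans (sym (ℚ.*-distribʳ-+ ε ½ ½)) (ℚ.*-identityˡ ε)

∣p-q∣≡∣q-p∣ : ∀ p q → ℚ.∣ p ℚ.- q ∣ ≡ ℚ.∣ q ℚ.- p ∣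
∣p-q∣≡∣q-p∣ p q = trans (sym (ℚ.∣-p∣≡∣p∣ (p ℚ.- q))) (cong ℚ.∣_∣ (lem p q))
  where
  open +-*-Solver
  lem : ∀ p q → ℚ.- (p ℚ.- q) ≡ q ℚ.- p
  lem = solve 2 (λ p q → :- (p :- q) := q :- p) refl

*-mono-≤ : ∀ {a b c d} → 0ℚ ℚ.≤ c → 0ℚ ℚ.≤ b → a ℚ.≤ b → c ℚ.≤ d →
           a ℚ.* c ℚ.≤ b ℚ.* d
*-mono-≤ {a} {b} {c} {d} c≥0 b≥0 a≤b c≤d = ℚ.≤-trans
  (ℚ.*-monoʳ-≤-nonNeg c {{ℚ.nonNegative c≥0}} a≤b)
  (ℚ.*-monoˡ-≤-nonNeg b {{ℚ.nonNegative b≥0}} c≤d)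

p≤∣p∣ : ∀ p → p ℚ.≤ ℚ.∣ p ∣
p≤∣p∣ p with ℚ.≤-total 0ℚ p
... | inj₁ 0≤p = ℚ.≤-reflexive (sym (ℚ.0≤p⇒∣p∣≡p 0≤p))
... | inj₂ p≤0 = ℚ.≤-trans p≤0 (ℚ.0≤∣p∣ p)

∣p∣≤ : ∀ {p ε} → p ℚ.≤ ε → ℚ.- p ℚ.≤ ε → ℚ.∣ p ∣ ℚ.≤ ε
∣p∣≤ {p} {ε} p≤ε -p≤ε with ℚ.∣p∣≡p∨∣p∣≡-p p
... | inj₁ eq = subst (ℚ._≤ ε) (sym eq) p≤ε
... | inj₂ eq = subst (ℚ._≤ ε) (sym eq) -p≤ε

fromℚ : ℚ → ℝ
fromℚ q = mkℝ (λ _ → q) λ ε ε>0 → 0 , λ _ _ _ _ →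
  subst (λ z → ℚ.∣ z ∣ ℚ.≤ ε) (sym (ℚ.+-inverseʳ q)) (ℚ.<⇒≤ ε>0)

fromℕ : ℕ → ℝ
fromℕ n = fromℚ (+ n ℚ./ 1)

0ℝ 1ℝ : ℝ
0ℝ = fromℕ 0
1ℝ = fromℕ 1

infix  8 -_
infixl 7 _*_
infixl 6 _+_ _-_

_+_ : ℝ → ℝ → ℝ
x + y = mkℝ (λ n → seq x n ℚ.+ seq y n) λ ε ε>0 →
  let (M , p) = cauchy x (½ ℚ.* ε) (half-pos ε>0)
      (N , q) = cauchy y (½ ℚ.* ε) (half-pos ε>0)
  in M ℕ.⊔ N , λ m n ≤m ≤n → begin
    ℚ.∣ (seq x m ℚ.+ seq y m) ℚ.- (seq x n ℚ.+ seq y n) ∣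
      ≡⟨ cong ℚ.∣_∣ (lem (seq x m) (seq y m) (seq x n) (seq y n)) ⟩
    ℚ.∣ (seq x m ℚ.- seq x n) ℚ.+ (seq y m ℚ.- seq y n) ∣
      ≤⟨ ℚ.∣p+q∣≤∣p∣+∣q∣ (seq x m ℚ.- seq x n) (seq y m ℚ.- seq y n) ⟩
    ℚ.∣ seq x m ℚ.- seq x n ∣ ℚ.+ ℚ.∣ seq y m ℚ.- seq y n ∣
      ≤⟨ ℚ.+-mono-≤ (p m n (ℕ.m⊔n≤o⇒m≤o M N ≤m) (ℕ.m⊔n≤o⇒m≤o M N ≤n))
                    (q m n (ℕ.m⊔n≤o⇒n≤o M N ≤m) (ℕ.m⊔n≤o⇒n≤o M N ≤n)) ⟩
    ½ ℚ.* ε ℚ.+ ½ ℚ.* ε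
      ≡⟨ halves ε ⟩
    ε ∎
  where
  open ℚ.≤-Reasoning
  lem : ∀ a b c d → (a ℚ.+ b) ℚ.- (c ℚ.+ d) ≡ (a ℚ.- c) ℚ.+ (b ℚ.- d)
  lem = solve 4 (λ a b c d → (a :+ b) :- (c :+ d) := (a :- c) :+ (b :- d)) refl
    where open +-*-Solver

-_ : ℝ → ℝ
- x = mkℝ (λ n → ℚ.- seq x n) λ ε ε>0 →
  let (N , p) = cauchy x ε ε>0
  in N , λ m n ≤m ≤n →
    subst (ℚ._≤ ε)
      (trans (∣p-q∣≡∣q-p∣ (seq x m) (seq x n)) (cong ℚ.∣_∣ (lem (seq x m) (seq x n))))
      (p m n ≤m ≤n)
  where
  open +-*-Solver
  lem : ∀ a b → b ℚ.- a ≡ ℚ.- a ℚ.- (ℚ.- b)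
  lem = solve 2 (λ a b → b :- a := :- a :- (:- b)) refl

_-_ : ℝ → ℝ → ℝ
x - y = x + (- y)

inv : ℚ → ℚ
inv p with p ℚ.≟ 0ℚ
... | yes _  = 0ℚ
... | no p≢0 = ℚ.1/_ p {{ℚ.≢-nonZero p≢0}}

inv-inverseʳ : ∀ {p} → 0ℚ ℚ.< p → p ℚ.* inv p ≡ 1ℚ
inv-inverseʳ {p} p>0 with p ℚ.≟ 0ℚ
... | yes p≡0 = contradiction (sym p≡0) (ℚ.<⇒≢ p>0)
... | no p≢0  = ℚ.*-inverseʳ p {{ℚ.≢-nonZero p≢0}}

inv-pos : ∀ {p} → 0ℚ ℚ.< p → 0ℚ ℚ.< inv p
inv-pos {p} p>0 with p ℚ.≟ 0ℚ
... | yes p≡0 = contradiction (sym p≡0) (ℚ.<⇒≢ p>0)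
... | no p≢0  = ℚ.positive⁻¹ (ℚ.1/_ p {{ℚ.≢-nonZero p≢0}})
                  {{ℚ.1/pos⇒pos p {{ℚ.positive p>0}}}}

inv-anti : ∀ {p q} → 0ℚ ℚ.< p → p ℚ.≤ q → inv q ℚ.≤ inv p
inv-anti {p} {q} p>0 p≤q = begin
  inv q                      ≡⟨ ℚ.*-identityʳ (inv q) ⟨
  inv q ℚ.* 1ℚ               ≡⟨ cong (inv q ℚ.*_) (inv-inverseʳ p>0) ⟨
  inv q ℚ.* (p ℚ.* inv p)    ≤⟨ ℚ.*-monoˡ-≤-nonNeg (inv q) {{ℚ.nonNegative (ℚ.<⇒≤ (inv-pos q>0))}}
                                 (ℚ.*-monoʳ-≤-nonNeg (inv p) {{ℚ.nonNegative (ℚ.<⇒≤ (inv-pos p>0))}} p≤q) ⟩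
  inv q ℚ.* (q ℚ.* inv p)    ≡⟨ lem (inv q) q (inv p) ⟩
  (q ℚ.* inv q) ℚ.* inv p    ≡⟨ cong (ℚ._* inv p) (inv-inverseʳ q>0) ⟩
  1ℚ ℚ.* inv p               ≡⟨ ℚ.*-identityˡ (inv p) ⟩
  inv p                      ∎
  where
  open ℚ.≤-Reasoning
  q>0 : 0ℚ ℚ.< q
  q>0 = ℚ.<-≤-trans p>0 p≤q
  lem : ∀ a b c → a ℚ.* (b ℚ.* c) ≡ (b ℚ.* a) ℚ.* c
  lem = solve 3 (λ a b c → a :* (b :* c) := (b :* a) :* c) refl
    where open +-*-Solver

bounded : ∀ x → ∃₂ λ B N → 0ℚ ℚ.< B × (∀ n → N ℕ.≤ n → ℚ.∣ seq x n ∣ ℚ.≤ B)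
bounded x = B , N , B>0 , λ n N≤n → begin
    ℚ.∣ seq x n ∣                                ≡⟨ cong ℚ.∣_∣ (lem (seq x n) (seq x N)) ⟩
    ℚ.∣ seq x N ℚ.+ (seq x n ℚ.- seq x N) ∣      ≤⟨ ℚ.∣p+q∣≤∣p∣+∣q∣ (seq x N) (seq x n ℚ.- seq x N) ⟩
    ℚ.∣ seq x N ∣ ℚ.+ ℚ.∣ seq x n ℚ.- seq x N ∣  ≤⟨ ℚ.+-monoʳ-≤ ℚ.∣ seq x N ∣ (p n N N≤n ℕ.≤-refl) ⟩
    B                                            ∎
  where
  open ℚ.≤-Reasoning
  c : ∃[ N ] (∀ m n → N ℕ.≤ m → N ℕ.≤ n → ℚ.∣ seq x m ℚ.- seq x n ∣ ℚ.≤ 1ℚ)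
  c = cauchy x 1ℚ (ℚ.positive⁻¹ 1ℚ)
  N : ℕ
  N = proj₁ c
  p = proj₂ c
  B : ℚ
  B = ℚ.∣ seq x N ∣ ℚ.+ 1ℚ
  B>0 : 0ℚ ℚ.< B
  B>0 = ℚ.+-mono-≤-< (ℚ.0≤∣p∣ (seq x N)) (ℚ.positive⁻¹ 1ℚ)
  lem : ∀ a b → a ≡ b ℚ.+ (a ℚ.- b)
  lem = solve 2 (λ a b → a := b :+ (a :- b)) refl
    where open +-*-Solver

_*_ : ℝ → ℝ → ℝ
x * y = mkℝ (λ n → seq x n ℚ.* seq y n) λ ε ε>0 →
  let (A , K , A>0 , a) = bounded x
      (B , L , B>0 , b) = bounded y
      δ = λ C → (½ ℚ.* ε) ℚ.* inv C
      δ>0 : ∀ {C} → 0ℚ ℚ.< C → 0ℚ ℚ.< δ C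
      δ>0 C>0 = *-pos (half-pos ε>0) (inv-pos C>0)
      (M , p) = cauchy x (δ B) (δ>0 B>0)
      (N , q) = cauchy y (δ A) (δ>0 A>0)
      cancel : ∀ {C} → 0ℚ ℚ.< C → C ℚ.* δ C ≡ ½ ℚ.* ε
      cancel {C} C>0 = trans (lem′ C (½ ℚ.* ε) (inv C))
        (trans (cong ((½ ℚ.* ε) ℚ.*_) (inv-inverseʳ C>0)) (ℚ.*-identityʳ (½ ℚ.* ε)))
  in (K ℕ.⊔ L) ℕ.⊔ (M ℕ.⊔ N) , λ m n ≤m ≤n →
    let ≤₁ : ∀ {i} → (K ℕ.⊔ L) ℕ.⊔ (M ℕ.⊔ N) ℕ.≤ i → K ℕ.⊔ L ℕ.≤ i
        ≤₁ = ℕ.m⊔n≤o⇒m≤o (K ℕ.⊔ L) (M ℕ.⊔ N)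
        ≤₂ : ∀ {i} → (K ℕ.⊔ L) ℕ.⊔ (M ℕ.⊔ N) ℕ.≤ i → M ℕ.⊔ N ℕ.≤ i
        ≤₂ = ℕ.m⊔n≤o⇒n≤o (K ℕ.⊔ L) (M ℕ.⊔ N)
        xm = seq x m ; xn = seq x n ; ym = seq y m ; yn = seq y n
    in begin
    ℚ.∣ xm ℚ.* ym ℚ.- xn ℚ.* yn ∣
      ≡⟨ cong ℚ.∣_∣ (lem xm ym xn yn) ⟩
    ℚ.∣ xm ℚ.* (ym ℚ.- yn) ℚ.+ yn ℚ.* (xm ℚ.- xn) ∣
      ≤⟨ ℚ.∣p+q∣≤∣p∣+∣q∣ (xm ℚ.* (ym ℚ.- yn)) (yn ℚ.* (xm ℚ.- xn)) ⟩
    ℚ.∣ xm ℚ.* (ym ℚ.- yn) ∣ ℚ.+ ℚ.∣ yn ℚ.* (xm ℚ.- xn) ∣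
      ≡⟨ cong₂ ℚ._+_ (ℚ.∣p*q∣≡∣p∣*∣q∣ xm (ym ℚ.- yn)) (ℚ.∣p*q∣≡∣p∣*∣q∣ yn (xm ℚ.- xn)) ⟩
    ℚ.∣ xm ∣ ℚ.* ℚ.∣ ym ℚ.- yn ∣ ℚ.+ ℚ.∣ yn ∣ ℚ.* ℚ.∣ xm ℚ.- xn ∣
      ≤⟨ ℚ.+-mono-≤
           (*-mono-≤ (ℚ.0≤∣p∣ (ym ℚ.- yn)) (ℚ.<⇒≤ A>0)
             (a m (ℕ.m⊔n≤o⇒m≤o K L (≤₁ ≤m)))
             (q m n (ℕ.m⊔n≤o⇒n≤o M N (≤₂ ≤m)) (ℕ.m⊔n≤o⇒n≤o M N (≤₂ ≤n))))
           (*-mono-≤ (ℚ.0≤∣p∣ (xm ℚ.- xn)) (ℚ.<⇒≤ B>0)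
             (b n (ℕ.m⊔n≤o⇒n≤o K L (≤₁ ≤n)))
             (p m n (ℕ.m⊔n≤o⇒m≤o M N (≤₂ ≤m)) (ℕ.m⊔n≤o⇒m≤o M N (≤₂ ≤n)))) ⟩
    A ℚ.* δ A ℚ.+ B ℚ.* δ B
      ≡⟨ cong₂ ℚ._+_ (cancel A>0) (cancel B>0) ⟩
    ½ ℚ.* ε ℚ.+ ½ ℚ.* ε
      ≡⟨ halves ε ⟩
    ε ∎
  where
  open ℚ.≤-Reasoning
  lem : ∀ a b c d → a ℚ.* b ℚ.- c ℚ.* d ≡ a ℚ.* (b ℚ.- d) ℚ.+ d ℚ.* (a ℚ.- c)
  lem = solve 4 (λ a b c d → a :* b :- c :* d := a :* (b :- d) :+ d :* (a :- c)) refl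
    where open +-*-Solver
  lem′ : ∀ a b c → a ℚ.* (b ℚ.* c) ≡ b ℚ.* (a ℚ.* c)
  lem′ = solve 3 (λ a b c → a :* (b :* c) := b :* (a :* c)) refl
    where open +-*-Solver

-- inv 0 = 0 can only be met at finitely many indices, since x is positive.
recip : (x : ℝ) → Positive x → ℝ
recip x (b , b>0 , N , b≤) = mkℝ (inv ∘ seq x) λ ε ε>0 →
  let (M , p) = cauchy x (ε ℚ.* (b ℚ.* b)) (*-pos ε>0 (*-pos b>0 b>0))
  in M ℕ.⊔ N , λ m n ≤m ≤n →
    let u = seq x m ; v = seq x n
        b≤u = b≤ m (ℕ.m⊔n≤o⇒n≤o M N ≤m)
        b≤v = b≤ n (ℕ.m⊔n≤o⇒n≤o M N ≤n)
        u>0 = ℚ.<-≤-trans b>0 b≤u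
        v>0 = ℚ.<-≤-trans b>0 b≤v
        ∣inv∣ : ∀ {w} → 0ℚ ℚ.< w → ℚ.∣ inv w ∣ ≡ inv w
        ∣inv∣ w>0 = ℚ.0≤p⇒∣p∣≡p (ℚ.<⇒≤ (inv-pos w>0))
        inv≥0 : ∀ {w} → 0ℚ ℚ.< w → 0ℚ ℚ.≤ inv w
        inv≥0 w>0 = ℚ.<⇒≤ (inv-pos w>0)
    in begin
    ℚ.∣ inv u ℚ.- inv v ∣
      ≡⟨ cong ℚ.∣_∣ (difference u v (inv u) (inv v) (inv-inverseʳ u>0) (inv-inverseʳ v>0)) ⟩
    ℚ.∣ (v ℚ.- u) ℚ.* (inv u ℚ.* inv v) ∣
      ≡⟨ ℚ.∣p*q∣≡∣p∣*∣q∣ (v ℚ.- u) (inv u ℚ.* inv v) ⟩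
    ℚ.∣ v ℚ.- u ∣ ℚ.* ℚ.∣ inv u ℚ.* inv v ∣
      ≡⟨ cong₂ ℚ._*_ (∣p-q∣≡∣q-p∣ v u)
           (trans (ℚ.∣p*q∣≡∣p∣*∣q∣ (inv u) (inv v)) (cong₂ ℚ._*_ (∣inv∣ u>0) (∣inv∣ v>0))) ⟩
    ℚ.∣ u ℚ.- v ∣ ℚ.* (inv u ℚ.* inv v)
      ≤⟨ *-mono-≤ (ℚ.<⇒≤ (*-pos (inv-pos u>0) (inv-pos v>0)))
           (ℚ.<⇒≤ (*-pos ε>0 (*-pos b>0 b>0)))
           (p m n (ℕ.m⊔n≤o⇒m≤o M N ≤m) (ℕ.m⊔n≤o⇒m≤o M N ≤n))
           (*-mono-≤ (inv≥0 v>0) (inv≥0 b>0) (inv-anti b>0 b≤u) (inv-anti b>0 b≤v)) ⟩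
    (ε ℚ.* (b ℚ.* b)) ℚ.* (inv b ℚ.* inv b)
      ≡⟨ regroup ε b (inv b) ⟩
    ε ℚ.* ((b ℚ.* inv b) ℚ.* (b ℚ.* inv b))
      ≡⟨ cong (λ z → ε ℚ.* (z ℚ.* z)) (inv-inverseʳ b>0) ⟩
    ε ℚ.* 1ℚ
      ≡⟨ ℚ.*-identityʳ ε ⟩
    ε ∎
  where
  open ℚ.≤-Reasoning
  regroup : ∀ e b c → (e ℚ.* (b ℚ.* b)) ℚ.* (c ℚ.* c) ≡ e ℚ.* ((b ℚ.* c) ℚ.* (b ℚ.* c))
  regroup = solve 3 (λ e b c → (e :* (b :* b)) :* (c :* c) := e :* ((b :* c) :* (b :* c))) refl
    where open +-*-Solver
  expand : ∀ u v c d → (v ℚ.* d) ℚ.* c ℚ.- (u ℚ.* c) ℚ.* d ≡ (v ℚ.- u) ℚ.* (c ℚ.* d)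
  expand = solve 4 (λ u v c d → (v :* d) :* c :- (u :* c) :* d := (v :- u) :* (c :* d)) refl
    where open +-*-Solver
  difference : ∀ u v c d → u ℚ.* c ≡ 1ℚ → v ℚ.* d ≡ 1ℚ → c ℚ.- d ≡ (v ℚ.- u) ℚ.* (c ℚ.* d)
  difference u v c d uc vd = trans
    (sym (cong₂ ℚ._-_ (trans (cong (ℚ._* c) vd) (ℚ.*-identityˡ c))
                      (trans (cong (ℚ._* d) uc) (ℚ.*-identityˡ d))))
    (expand u v c d)

⌊√_⌋ : ℕ → ℕ
⌊√ zero ⌋  = 0
⌊√ suc m ⌋ = if suc ⌊√ m ⌋ ℕ.* suc ⌊√ m ⌋ ℕ.≤ᵇ suc m then suc ⌊√ m ⌋ else ⌊√ m ⌋

⌊√⌋-lower : ∀ m → ⌊√ m ⌋ ℕ.* ⌊√ m ⌋ ℕ.≤ m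
⌊√⌋-lower zero    = ℕ.z≤n
⌊√⌋-lower (suc m) with suc ⌊√ m ⌋ ℕ.* suc ⌊√ m ⌋ ℕ.≤ᵇ suc m in eq
... | true  = ℕ.≤ᵇ⇒≤ _ _ (subst T (sym eq) tt)
... | false = ℕ.m≤n⇒m≤1+n (⌊√⌋-lower m)

⌊√⌋-upper : ∀ m → m ℕ.< suc ⌊√ m ⌋ ℕ.* suc ⌊√ m ⌋
⌊√⌋-upper zero    = ℕ.s≤s ℕ.z≤n
⌊√⌋-upper (suc m) with suc ⌊√ m ⌋ ℕ.* suc ⌊√ m ⌋ ℕ.≤ᵇ suc m in eq
... | true  = ℕ.≤-<-trans (⌊√⌋-upper m)
                (ℕ.*-mono-< (ℕ.n<1+n (suc ⌊√ m ⌋)) (ℕ.n<1+n (suc ⌊√ m ⌋)))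
... | false = ℕ.≰⇒> λ le → subst T eq (ℕ.≤⇒≤ᵇ le)

-- The n-th approximation is the largest multiple of 1/(n+1) not above √m.
√-seq : ℕ → ℕ → ℚ
√-seq m n = + ⌊√ m ℕ.* (suc n ℕ.* suc n) ⌋ ℚ./ suc n

/-mono : ∀ a b i j → a ℕ.* suc j ℕ.≤ b ℕ.* suc i → + a ℚ./ suc i ℚ.≤ + b ℚ./ suc j
/-mono a b i j h = ℚ.toℚᵘ-cancel-≤ (begin
  ℚ.toℚᵘ (+ a ℚ./ suc i)  ≃⟨ ℚ.toℚᵘ-fromℚᵘ (mkℚᵘ (+ a) i) ⟩
  mkℚᵘ (+ a) i            ≤⟨ ℚᵘ.*≤* (subst₂ ℤ._≤_ (ℤ.pos-* a (suc j)) (ℤ.pos-* b (suc i)) (ℤ.+≤+ h)) ⟩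
  mkℚᵘ (+ b) j            ≃⟨ ℚ.toℚᵘ-fromℚᵘ (mkℚᵘ (+ b) j) ⟨
  ℚ.toℚᵘ (+ b ℚ./ suc j)  ∎)
  where open ℚᵘ.≤-Reasoning

suc-/ : ∀ b j → + suc b ℚ./ suc j ≡ + b ℚ./ suc j ℚ.+ + 1 ℚ./ suc j
suc-/ b j = ℚ.toℚᵘ-injective (begin-equality
  ℚ.toℚᵘ (+ suc b ℚ./ suc j)                           ≃⟨ ℚ.toℚᵘ-fromℚᵘ (mkℚᵘ (+ suc b) j) ⟩
  mkℚᵘ (+ suc b) j                                     ≃⟨ ℚᵘ.*≡* (trans (sym (ℤ.pos-* (suc b) (suc j ℕ.* suc j))) (trans (cong +_ (lem b (suc j))) (ℤ.pos-* (b ℕ.* suc j ℕ.+ 1 ℕ.* suc j) (suc j)))) ⟩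
  mkℚᵘ (+ (b ℕ.* suc j ℕ.+ 1 ℕ.* suc j)) (j ℕ.+ j ℕ.* suc j)
                                                       ≡⟨ cong (λ z → mkℚᵘ z (j ℕ.+ j ℕ.* suc j)) (trans (ℤ.pos-+ (b ℕ.* suc j) (1 ℕ.* suc j)) (cong₂ ℤ._+_ (ℤ.pos-* b (suc j)) (ℤ.pos-* 1 (suc j)))) ⟩
  mkℚᵘ (+ b) j ℚᵘ.+ mkℚᵘ (+ 1) j                       ≃⟨ ℚᵘ.+-cong (ℚ.toℚᵘ-fromℚᵘ (mkℚᵘ (+ b) j)) (ℚ.toℚᵘ-fromℚᵘ (mkℚᵘ (+ 1) j)) ⟨
  ℚ.toℚᵘ (+ b ℚ./ suc j) ℚᵘ.+ ℚ.toℚᵘ (+ 1 ℚ./ suc j)   ≃⟨ ℚ.toℚᵘ-homo-+ (+ b ℚ./ suc j) (+ 1 ℚ./ suc j) ⟨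
  ℚ.toℚᵘ (+ b ℚ./ suc j ℚ.+ + 1 ℚ./ suc j)             ∎)
  where
  open ℚᵘ.≤-Reasoning
  lem : ∀ b s → suc b ℕ.* (s ℕ.* s) ≡ (b ℕ.* s ℕ.+ 1 ℕ.* s) ℕ.* s
  lem = solve-∀

archimedean : ∀ ε → 0ℚ ℚ.< ε → ∃[ N ] (∀ n → N ℕ.≤ n → + 1 ℚ./ suc n ℚ.≤ ε)
archimedean ε@(mkℚ (+ zero) d c) ε>0 = contradiction (ℚ.positive ε>0) λ ()
archimedean ε@(mkℚ -[1+ _ ] d c) ε>0 = contradiction (ℚ.positive ε>0) λ ()
archimedean ε@(mkℚ (+ suc a) d c) ε>0 = d , λ n d≤n →
  subst (+ 1 ℚ./ suc n ℚ.≤_) (ℚ.fromℚᵘ-toℚᵘ ε)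
    (/-mono 1 (suc a) n d (ℕ.*-mono-≤ (ℕ.s≤s (ℕ.z≤n {a})) (ℕ.s≤s d≤n)))

square-cancel-< : ∀ {a b} → a ℕ.* a ℕ.< b ℕ.* b → a ℕ.≤ b
square-cancel-< {a} {b} h with a ℕ.≤? b
... | yes a≤b = a≤b
... | no  a≰b = contradiction h (ℕ.≤⇒≯ (ℕ.*-mono-≤ (ℕ.≰⇒≥ a≰b) (ℕ.≰⇒≥ a≰b)))

√-step : ∀ m i j → √-seq m i ℚ.≤ √-seq m j ℚ.+ + 1 ℚ./ suc j
√-step m i j = subst (√-seq m i ℚ.≤_) (suc-/ b j)
  (/-mono a (suc b) i j (square-cancel-< sq))
  where
  s t a b : ℕ
  s = suc i
  t = suc j
  a = ⌊√ m ℕ.* (s ℕ.* s) ⌋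
  b = ⌊√ m ℕ.* (t ℕ.* t) ⌋
  swap : ∀ a t → (a ℕ.* t) ℕ.* (a ℕ.* t) ≡ (a ℕ.* a) ℕ.* (t ℕ.* t)
  swap = solve-∀
  mid : ∀ m s t → (m ℕ.* (s ℕ.* s)) ℕ.* (t ℕ.* t) ≡ (m ℕ.* (t ℕ.* t)) ℕ.* (s ℕ.* s)
  mid = solve-∀
  open ℕ.≤-Reasoning
  sq : (a ℕ.* t) ℕ.* (a ℕ.* t) ℕ.< (suc b ℕ.* s) ℕ.* (suc b ℕ.* s)
  sq = begin-strict
    (a ℕ.* t) ℕ.* (a ℕ.* t)            ≡⟨ swap a t ⟩
    (a ℕ.* a) ℕ.* (t ℕ.* t)            ≤⟨ ℕ.*-monoˡ-≤ (t ℕ.* t) (⌊√⌋-lower (m ℕ.* (s ℕ.* s))) ⟩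
    (m ℕ.* (s ℕ.* s)) ℕ.* (t ℕ.* t)    ≡⟨ mid m s t ⟩
    (m ℕ.* (t ℕ.* t)) ℕ.* (s ℕ.* s)    <⟨ ℕ.*-monoˡ-< (s ℕ.* s) (⌊√⌋-upper (m ℕ.* (t ℕ.* t))) ⟩
    (suc b ℕ.* suc b) ℕ.* (s ℕ.* s)    ≡⟨ swap (suc b) s ⟨
    (suc b ℕ.* s) ℕ.* (suc b ℕ.* s)    ∎

√ : ℕ → ℝ
√ m = mkℝ (√-seq m) λ ε ε>0 →
  let (N , small) = archimedean ε ε>0
      diff : ∀ i j → N ℕ.≤ j → √-seq m i ℚ.- √-seq m j ℚ.≤ ε
      diff i j N≤j = begin
        √-seq m i ℚ.- √-seq m j
          ≤⟨ ℚ.+-monoˡ-≤ (ℚ.- √-seq m j) (√-step m i j) ⟩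
        (√-seq m j ℚ.+ + 1 ℚ./ suc j) ℚ.- √-seq m j
          ≡⟨ lem (√-seq m j) (+ 1 ℚ./ suc j) ⟩
        + 1 ℚ./ suc j
          ≤⟨ small j N≤j ⟩
        ε ∎
  in N , λ i j N≤i N≤j → ∣p∣≤ (diff i j N≤j)
       (subst (ℚ._≤ ε) (neg (√-seq m j) (√-seq m i)) (diff j i N≤i))
  where
  open ℚ.≤-Reasoning
  lem : ∀ a e → (a ℚ.+ e) ℚ.- a ≡ e
  lem = solve 2 (λ a e → (a :+ e) :- a := e) refl
    where open +-*-Solver
  neg : ∀ a b → a ℚ.- b ≡ ℚ.- (b ℚ.- a)
  neg = solve 2 (λ a b → a :- b := :- (b :- a)) refl
    where open +-*-Solver

√-positive : ∀ m → Positive (√ (suc m))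
√-positive m = 1ℚ , ℚ.positive⁻¹ 1ℚ , 0 , λ n _ →
  /-mono 1 ⌊√ suc m ℕ.* (suc n ℕ.* suc n) ⌋ 0 n
    (subst₂ ℕ._≤_ (sym (ℕ.*-identityˡ (suc n))) (sym (ℕ.*-identityʳ _)) (1≤ n))
  where
  1≤ : ∀ n → suc n ℕ.≤ ⌊√ suc m ℕ.* (suc n ℕ.* suc n) ⌋
  1≤ n = ℕ.s≤s⁻¹ (ℕ.≰⇒> λ r<s →
    ℕ.<-irrefl refl
      (ℕ.<-≤-trans
        (ℕ.≤-<-trans (ℕ.m≤n*m (suc n ℕ.* suc n) (suc m))
                     (⌊√⌋-upper (suc m ℕ.* (suc n ℕ.* suc n))))
        (ℕ.*-mono-≤ r<s r<s)))

-- The value at 0 is a convention; it is never used for the ends of an edge.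
1/√ : ℕ → ℝ
1/√ zero    = 0ℝ
1/√ (suc m) = recip (√ (suc m)) (√-positive m)

∑ : ∀ {n} → (Fin n → ℝ) → ℝ
∑ = foldr _+_ 0ℝ

record Graph (n : ℕ) : Set where
  field
    adj        : Fin n → Fin n → Bool
    adj-sym    : ∀ u v → adj u v ≡ adj v u
    adj-irrefl : ∀ v → adj v v ≡ false

  Adj : Rel (Fin n) 0ℓ
  Adj u v = T (adj u v)

  degree : Fin n → ℕ
  degree v = Subset.∣ tabulate (adj v) ∣

open Graph public

-- The order on Fin n picks one orientation of each edge.
randić : ∀ {n} → Graph n → ℝ
randić G = ∑ λ u → ∑ λ v →
  if adj G u v ∧ (toℕ u ℕ.<ᵇ toℕ v) then 1/√ (degree G u ℕ.* degree G v) else 0ℝ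

data Walk {n} (E : Rel (Fin n) 0ℓ) : Fin n → Fin n → ℕ → Set where
  []  : ∀ {u} → Walk E u u 0
  _∷_ : ∀ {u v w m} → E u v → Walk E v w m → Walk E u w (suc m)

IsDistance : ∀ {n} → Graph n → Fin n → Fin n → ℕ → Set
IsDistance G u v m = Walk (Adj G) u v m × (∀ l → Walk (Adj G) u v l → m ℕ.≤ l)

IsDiameter : ∀ {n} → Graph n → ℕ → Set
IsDiameter G d = (∃₂ λ u v → IsDistance G u v d)
               × (∀ u v m → IsDistance G u v m → m ℕ.≤ d)

-- Connectivity of the graph with vertex set V and edge relation E.  Deleting
-- the only vertex of a graph does not disconnect it, so Disconnected is not
-- the negation of Connected on the empty graph.

Connected : ∀ {n} → Pred (Fin n) 0ℓ → Rel (Fin n) 0ℓ → Set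
Connected V E = ∃ V × (∀ u v → V u → V v → ∃ (Walk E u v))

Disconnected : ∀ {n} → Pred (Fin n) 0ℓ → Rel (Fin n) 0ℓ → Set
Disconnected V E = ∃₂ λ u v → V u × V v × ¬ ∃ (Walk E u v)

IsArticulation : ∀ {n} → Pred (Fin n) 0ℓ → Rel (Fin n) 0ℓ → Fin n → Set
IsArticulation V E a =
  V a × Disconnected (λ x → V x × x ≢ a) (λ x y → E x y × x ≢ a × y ≢ a)

AllVertices : ∀ {n} → Pred (Fin n) 0ℓ
AllVertices v = ⊤

IsConnected : ∀ {n} → Graph n → Set
IsConnected G = Connected AllVertices (Adj G)

IsBridge : ∀ {n} → Graph n → Fin n → Fin n → Set
IsBridge G u v = Adj G u v × Disconnected AllVertices
  (λ x y → Adj G x y × ¬ ((x ≡ u × y ≡ v) ⊎ (x ≡ v × y ≡ u)))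

ArticulationPoint : ∀ {n} → Graph n → Fin n → Set
ArticulationPoint G = IsArticulation AllVertices (Adj G)

-- Positions i and j of a closed sequence of length s with j just after i.
Next : ∀ {s} → Rel (Fin s) 0ℓ
Next {s} i j = (suc (toℕ i) ≡ toℕ j) ⊎ (suc (toℕ i) ≡ s × toℕ j ≡ 0)

record Cycle {n} (G : Graph n) : Set where
  field
    len       : ℕ
    3≤len     : 3 ℕ.≤ len
    at        : Fin len → Fin n
    injective : Injective _≡_ _≡_ at
    step      : ∀ i j → Next i j → Adj G (at i) (at j)

open Cycle public

_∈ᶜ_ : ∀ {n} {G : Graph n} → Fin n → Cycle G → Set
v ∈ᶜ c = ∃[ i ] at c i ≡ v

CycleEdge : ∀ {n} {G : Graph n} → Cycle G → Rel (Fin n) 0ℓ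
CycleEdge c u v = ∃₂ λ i j →
  (Next i j ⊎ Next j i) × at c i ≡ u × at c j ≡ v

-- Cycles are counted as subgraphs: the starting point and the direction of
-- traversal are immaterial.
_≈ᶜ_ : ∀ {n} {G : Graph n} → Rel (Cycle G) 0ℓ
c ≈ᶜ c′ = ∀ u v → CycleEdge c u v ⇔ CycleEdge c′ u v

HasCycleCount : ∀ {n} → Graph n → ℕ → Set
HasCycleCount G k = Σ (Fin k → Cycle G) λ c →
  Injective _≡_ _≈ᶜ_ c × StrictlySurjective _≈ᶜ_ c

IsCactus : ∀ {n} → Graph n → Set
IsCactus G = IsConnected G
  × (∀ (c c′ : Cycle G) → ¬ (c ≈ᶜ c′) →
     ∀ u v → u ∈ᶜ c → u ∈ᶜ c′ → v ∈ᶜ c → v ∈ᶜ c′ → u ≡ v)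

IsNontrivial : ∀ {n} → Graph n → Set
IsNontrivial G = ∀ u v → ¬ IsBridge G u v

record Subgraph {n} (G : Graph n) : Set where
  field
    verts     : Subset n
    edge      : Fin n → Fin n → Bool
    edge-sym  : ∀ u v → edge u v ≡ edge v u
    edge⇒vert : ∀ u v → T (edge u v) → u Subset.∈ verts
    edge⇒adj  : ∀ u v → T (edge u v) → Adj G u v

  Vert : Pred (Fin n) 0ℓ
  Vert v = v Subset.∈ verts

  Edge : Rel (Fin n) 0ℓ
  Edge u v = T (edge u v)

open Subgraph public

_⊑_ : ∀ {n} {G : Graph n} → Rel (Subgraph G) 0ℓ
H ⊑ K = (∀ v → Vert H v → Vert K v) × (∀ u v → Edge H u v → Edge K u v)

IsInseparable : ∀ {n} {G : Graph n} → Subgraph G → Set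
IsInseparable H =
  Connected (Vert H) (Edge H) × (∀ v → ¬ IsArticulation (Vert H) (Edge H) v)

IsBlock : ∀ {n} {G : Graph n} → Subgraph G → Set
IsBlock H = IsInseparable H × (∀ K → IsInseparable K → H ⊑ K → K ⊑ H)

data BCNode {n} (G : Graph n) : Set where
  block : (H : Subgraph G) → IsBlock H → BCNode G
  artic : (v : Fin n) → ArticulationPoint G v → BCNode G

_≈ᴮ_ : ∀ {n} {G : Graph n} → Rel (BCNode G) 0ℓ
block H _ ≈ᴮ block K _ = H ⊑ K × K ⊑ H
artic u _ ≈ᴮ artic v _ = u ≡ v
block _ _ ≈ᴮ artic _ _ = ⊥
artic _ _ ≈ᴮ block _ _ = ⊥

BCAdj : ∀ {n} {G : Graph n} → Rel (BCNode G) 0ℓ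
BCAdj (block H _) (artic v _) = Vert H v
BCAdj (artic v _) (block H _) = Vert H v
BCAdj (block _ _) (block _ _) = ⊥
BCAdj (artic _ _) (artic _ _) = ⊥

-- The nodes can be listed without repetition as x₀, …, xₘ so that xᵢ and xⱼ
-- are adjacent exactly when i and j differ by one.
BCTreeIsPath : ∀ {n} → Graph n → Set
BCTreeIsPath G = ∃[ m ] Σ (Fin (suc m) → BCNode G) λ x →
    Injective _≡_ _≈ᴮ_ x
  × StrictlySurjective _≈ᴮ_ x
  × (∀ i j → BCAdj (x i) (x j) ⇔ (suc (toℕ i) ≡ toℕ j ⊎ suc (toℕ j) ≡ toℕ i))

IsLongitudinallySymmetric : ∀ {n} → Graph n → Set
IsLongitudinallySymmetric G = ∀ (c : Cycle G) →
    2 ∣ len c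
  × (∀ u v → ArticulationPoint G u → ArticulationPoint G v →
     u ∈ᶜ c → v ∈ᶜ c → u ≢ v → IsDistance G u v (len c ℕ./ 2))

{-# OPTIONS --safe #-}
module Submission where

-- Without bridges every edge lies on exactly one cycle.  Let m be the sum of the
-- lengths of the cycles; then deg v is twice the number of cycles at v, and the
-- degrees add up to 2m.  Measure distances from an end of a diametral path and
-- choose for every other vertex a parent one step closer.  On each cycle exactly
-- one vertex has its parent edge off the cycle, so m = n + k - 1; and a vertex has
-- at most two edges that do not descend.  At least two edges join consecutive
-- levels, a single one being a bridge, and therefore 2d + Σ (deg v - 4)⁺ ≤ m.
--
-- Put x v = √2 / √(deg v) ≤ 1.  Expanding (1 - x u) (1 - x v) ≥ 0 bounds the weight
-- x u * x v / 2 of an edge from below by a sum over its ends, whence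
-- 2R ≥ Σ √(2 deg v) - m.  Here √(2t) is at least the chord through t = 2 and t = 4,
-- cut off at the value 2√2 for t ≥ 4, and both inequalities become linear.
--
-- If the BC-tree is a path and G is longitudinally symmetric, then all degrees are
-- 2 or 4 and every edge has an end of degree 2, so the estimates above are
-- equalities.  A walk between the two ends of the path projects onto every cycle,
-- joining antipodal vertices there, so its length is at least m/2 and 2d = m.

-- The structural tool is the attachment point: once the edges of a cycle `c` are deleted, each
-- vertex is still connected to exactly one vertex of `c`, its projection onto `c`.
--
-- The chord has slope √2 - 1 and value 4 - 2√2 at t = 0. Let κ = k - 1 and T = Σ (deg v - 4)⁺.
-- Since m = n + κ, these constants make √2 cancel from the coefficient of n: 2R = n + κ (2√2 - 3) -
-- T (√2 - 1) + nonnegative losses. The negative term in T, due to cutting off the chord, is the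
-- obstacle; it is repaid by the excess in 2d + T ≤ m, for which 2d ≤ m alone would be too weak.
-- With σ = m - 2d - T, substituting n = 2d + T + σ - κ gives the coefficient -(2 - √2) of κ in the
-- first bound; in the second, subtracting n/4 changes 2 into 7/4. Each bound thus becomes an
-- identity for the difference of its sides, with only nonnegative terms on the right, and equality
-- amounts to all of them vanishing.

-- Counting by sums of indicators.

module FiniteSums where

  open import Data.Bool using (Bool; true; false; T?)
  open import Data.Fin as Fin using (Fin; zero; suc)
  import Data.Fin.Properties as Fin
  import Data.Fin.Subset as Subset
  open import Data.Nat
  open import Data.Nat.Properties
  open import Data.Product using (_,_)
  open import Data.Vec using (tabulate)
  open import Function using (_∘_)
  open import Relation.Binary.PropositionalEquality
  open import Relation.Nullary using (¬_; Dec; yes; no; contradiction)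
  open import Relation.Nullary.Decidable using (¬?)
  open import Relation.Unary using (Pred; Decidable)
  open import Algebra.Properties.Semiring.Sum +-*-semiring public
    using (sum; sum-cong-≗; ∑-distrib-+; ∑-comm; *-distribˡ-sum)

  private variable
    n : ℕ
    P Q : Set

  -- Numbers of vertices, edges and cycles are sums of these indicators, so that a double count is
  -- an exchange of two sums, `∑-comm`.
  𝟙 : Dec P → ℕ
  𝟙 (yes _) = 1
  𝟙 (no _)  = 0

  𝟙-yes : (P? : Dec P) → P → 𝟙 P? ≡ 1
  𝟙-yes (yes _) p = refl
  𝟙-yes (no ¬p) p = contradiction p ¬p

  𝟙-no : (P? : Dec P) → ¬ P → 𝟙 P? ≡ 0
  𝟙-no (yes p) ¬p = contradiction p ¬p
  𝟙-no (no _)  ¬p = refl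

  𝟙-mono : (P? : Dec P) (Q? : Dec Q) → (P → Q) → 𝟙 P? ≤ 𝟙 Q?
  𝟙-mono (yes p) Q? f = ≤-reflexive (sym (𝟙-yes Q? (f p)))
  𝟙-mono (no _)  Q? f = z≤n

  𝟙-cong : (P? : Dec P) (Q? : Dec Q) → (P → Q) → (Q → P) → 𝟙 P? ≡ 𝟙 Q?
  𝟙-cong P? Q? f g = ≤-antisym (𝟙-mono P? Q? f) (𝟙-mono Q? P? g)

  𝟙≤1 : (P? : Dec P) → 𝟙 P? ≤ 1
  𝟙≤1 (yes _) = ≤-refl
  𝟙≤1 (no _)  = z≤n

  𝟙-excluded-middle : (P? : Dec P) → 𝟙 P? + 𝟙 (¬? P?) ≡ 1
  𝟙-excluded-middle (yes _) = refl
  𝟙-excluded-middle (no _)  = refl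

  sum-mono : {f g : Fin n → ℕ} → (∀ i → f i ≤ g i) → sum f ≤ sum g
  sum-mono {zero}  f≤g = z≤n
  sum-mono {suc n} f≤g = +-mono-≤ (f≤g zero) (sum-mono (f≤g ∘ suc))

  sum-const : ∀ n c → sum {n} (λ _ → c) ≡ n * c
  sum-const zero    c = refl
  sum-const (suc n) c = cong (c +_) (sum-const n c)

  term≤sum : (f : Fin n → ℕ) (i : Fin n) → f i ≤ sum f
  term≤sum f zero    = m≤m+n _ _
  term≤sum f (suc i) = ≤-trans (term≤sum (f ∘ suc) i) (m≤n+m _ _)

  two-terms≤sum : (f : Fin n → ℕ) {i j : Fin n} → i ≢ j → f i + f j ≤ sum f
  two-terms≤sum f {zero}  {zero}  i≢j = contradiction refl i≢j
  two-terms≤sum f {zero}  {suc j} i≢j = +-monoʳ-≤ (f zero) (term≤sum (f ∘ suc) j)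
  two-terms≤sum f {suc i} {zero}  i≢j =
    subst (_≤ sum f) (+-comm (f zero) _) (+-monoʳ-≤ (f zero) (term≤sum (f ∘ suc) i))
  two-terms≤sum f {suc i} {suc j} i≢j =
    ≤-trans (two-terms≤sum (f ∘ suc) (i≢j ∘ cong suc)) (m≤n+m _ _)

  sum-zero : (f : Fin n → ℕ) → (∀ i → f i ≡ 0) → sum f ≡ 0
  sum-zero {n} f f≡0 = trans (sum-cong-≗ f≡0) (trans (sum-const n 0) (*-zeroʳ n))

  sum≡1 : {P : Pred (Fin n) _} (P? : Decidable P) (i : Fin n) → P i →
          (∀ j → P j → i ≡ j) → sum (λ j → 𝟙 (P? j)) ≡ 1
  sum≡1 P? zero p unique = cong₂ _+_ (𝟙-yes (P? zero) p)
    (sum-zero _ λ j → 𝟙-no (P? (suc j)) λ q → Fin.0≢1+n (unique (suc j) q))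
  sum≡1 P? (suc i) p unique = cong₂ _+_
    (𝟙-no (P? zero) (λ q → Fin.0≢1+n (sym (unique zero q))))
    (sum≡1 (P? ∘ suc) i p (λ j q → Fin.suc-injective (unique (suc j) q)))

  sum≤1 : {P : Pred (Fin n) _} (P? : Decidable P) →
          (∀ i j → P i → P j → i ≡ j) → sum (λ j → 𝟙 (P? j)) ≤ 1
  sum≤1 P? unique with Fin.any? P?
  ... | yes (i , p) = ≤-reflexive (sum≡1 P? i p (λ j → unique i j p))
  ... | no ¬∃       = subst (_≤ 1) (sym (sum-zero _ λ i → 𝟙-no (P? i) λ p → ¬∃ (i , p))) z≤n

  ∣tabulate∣ : (f : Fin n → Bool) → Subset.∣ tabulate f ∣ ≡ sum (λ i → 𝟙 (T? (f i)))
  ∣tabulate∣ {zero}  f = refl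
  ∣tabulate∣ {suc n} f with f zero
  ... | true  = cong suc (∣tabulate∣ (f ∘ suc))
  ... | false = ∣tabulate∣ (f ∘ suc)

-- Walks, simple walks and distances.

module Walks where

  open import Data.Bool using (T; T?)
  open import Data.Fin as Fin using (Fin; zero; suc; toℕ; _≟_)
  import Data.Fin.Properties as Fin
  open import Data.Nat hiding (_≟_)
  open import Data.Nat.Properties hiding (_≟_)
  open import Data.Product using (Σ; _×_; _,_; ∃)
  open import Data.Sum using (_⊎_; inj₁; inj₂)
  open import Data.Unit using (⊤; tt)
  open import Function using (_∘_)
  open import Function.Definitions using (Injective)
  open import Level using (0ℓ)
  open import Relation.Binary using (Rel; Symmetric) renaming (Decidable to Decidable₂)
  open import Relation.Binary.PropositionalEquality
  open import Relation.Nullary using (¬_; Dec; yes; no; contradiction)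
  open import Relation.Nullary.Decidable using (_×-dec_; map′)
  open import Relation.Unary using (Pred; Decidable)
  open import Defs hiding (_≈_; _≤_; _+_; _*_; _-_; -_)

  private variable
    n m l : ℕ
    E F : Rel (Fin n) 0ℓ
    u v w : Fin n

  _++_ : Walk E u v m → Walk E v w l → Walk E u w (m + l)
  []      ++ q = q
  (e ∷ p) ++ q = e ∷ (p ++ q)

  map-walk : (∀ {x y} → E x y → F x y) → Walk E u v m → Walk F u v m
  map-walk f []      = []
  map-walk f (e ∷ p) = f e ∷ map-walk f p

  reverse : Symmetric E → Walk E u v m → Walk E v u m
  reverse sym-E []                          = []
  reverse sym-E (_∷_ {m = m} e p) =
    subst (Walk _ _ _) (+-comm m 1) (reverse sym-E p ++ (sym-E e ∷ []))

  Joined : Rel (Fin n) 0ℓ → Rel (Fin n) 0ℓ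
  Joined E u v = ∃ (Walk E u v)

  join : Joined E u v → Joined E v w → Joined E u w
  join (_ , p) (_ , q) = _ , p ++ q

  join-sym : Symmetric E → Joined E u v → Joined E v u
  join-sym sym-E (_ , p) = _ , reverse sym-E p

  edge-join : E u v → Joined E u v
  edge-join e = _ , e ∷ []

  map-join : (∀ {x y} → E x y → F x y) → Joined E u v → Joined F u v
  map-join f (_ , p) = _ , map-walk f p

  vertex : {E : Rel (Fin n) 0ℓ} {u v : Fin n} → Walk E u v m → Fin (suc m) → Fin n
  vertex {u = u} []      _       = u
  vertex {u = u} (e ∷ p) zero    = u
  vertex         (e ∷ p) (suc i) = vertex p i

  vertex-first : (p : Walk E u v m) → vertex p zero ≡ u
  vertex-first []      = refl
  vertex-first (e ∷ p) = refl

  vertex-last : (p : Walk E u v m) (i : Fin (suc m)) → toℕ i ≡ m → vertex p i ≡ v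
  vertex-last []      i       _  = refl
  vertex-last (e ∷ p) (suc i) eq = vertex-last p i (suc-injective eq)

  vertex-step : (p : Walk E u v m) (i j : Fin (suc m)) → suc (toℕ i) ≡ toℕ j →
                E (vertex p i) (vertex p j)
  vertex-step []      zero    (suc ()) eq
  vertex-step {E = E} (e ∷ p) zero (suc zero) eq = subst (E _) (sym (vertex-first p)) e
  vertex-step (e ∷ p) (suc i) (suc j) eq = vertex-step p i j (suc-injective eq)

  Simple : Walk E u v m → Set
  Simple []              = ⊤
  Simple (_∷_ {u} e p) = (∀ i → vertex p i ≢ u) × Simple p

  Simple⇒injective : (p : Walk E u v m) → Simple p → Injective _≡_ _≡_ (vertex p)
  Simple⇒injective []      s       {zero}  {zero}  eq = refl
  Simple⇒injective (e ∷ p) s       {zero}  {zero}  eq = refl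
  Simple⇒injective (e ∷ p) (f , s) {zero}  {suc j} eq = contradiction (sym eq) (f j)
  Simple⇒injective (e ∷ p) (f , s) {suc i} {zero}  eq = contradiction eq (f i)
  Simple⇒injective (e ∷ p) (f , s) {suc i} {suc j} eq = cong suc (Simple⇒injective p s eq)

  SimpleWalk : Rel (Fin n) 0ℓ → Fin n → Fin n → Set
  SimpleWalk E u v = ∃ λ m → Σ (Walk E u v m) Simple

  suffix : (p : Walk E u v m) → Simple p → ∀ i → SimpleWalk E (vertex p i) v
  suffix []      s       i       = _ , [] , s
  suffix (e ∷ p) s       zero    = _ , e ∷ p , s
  suffix (e ∷ p) (f , s) (suc i) = suffix p s i

  -- If the starting vertex occurs again on the simple walk built from the remainder, that walk is
  -- cut to its suffix from this occurrence.
  loop-erase : Walk E u v m → SimpleWalk E u v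
  loop-erase []                        = _ , [] , tt
  loop-erase {E = E} {u = u} {v = v} (e ∷ p) with loop-erase p
  ... | l , q , s with Fin.any? (λ i → vertex q i ≟ u)
  ...   | yes (i , eq) = subst (λ x → SimpleWalk E x v) eq (suffix q s i)
  ...   | no ¬∃        = _ , e ∷ q , (λ i eq → ¬∃ (i , eq)) , s

  -- Literally the pair of orientations excluded in `IsBridge`.
  SamePair : Fin n → Fin n → Rel (Fin n) 0ℓ
  SamePair u v x y = (x ≡ u × y ≡ v) ⊎ (x ≡ v × y ≡ u)

  SamePair-sym : {u v : Fin n} → Symmetric (SamePair u v)
  SamePair-sym (inj₁ (a , b)) = inj₂ (b , a)
  SamePair-sym (inj₂ (a , b)) = inj₁ (b , a)

  Adj-sym : (G : Graph n) → Symmetric (Adj G)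
  Adj-sym G {u} {v} = subst T (adj-sym G u v)

  Adj-irrefl : {v : Fin n} (G : Graph n) → ¬ Adj G v v
  Adj-irrefl {v = v} G = subst T (adj-irrefl G v)

  Adj⇒≢ : {u v : Fin n} (G : Graph n) → Adj G u v → u ≢ v
  Adj⇒≢ G a refl = Adj-irrefl G a

  -- A simple `E`-walk from `v` to `u` closes up with `uv`. It has at least two edges: length 0
  -- would make `uv` a loop, and length 1 would put `uv` into `E`. The last component records where
  -- every edge of the new cycle comes from, which is what tells this cycle apart from a given one.
  closing-edge : {E : Rel (Fin n) 0ℓ} {u v : Fin n} (G : Graph n) → (∀ {x y} → E x y → Adj G x y) → Symmetric E →
    Adj G u v → ¬ E u v → Joined E v u →
    Σ (Cycle G) λ c → CycleEdge c u v × (∀ {x y} → CycleEdge c x y → SamePair u v x y ⊎ E x y)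
  closing-edge {E = E} {u} {v} G E⇒Adj sym-E uv ¬Euv (_ , p) with loop-erase p
  ... | zero , [] , _           = contradiction uv (Adj-irrefl G)
  ... | suc zero , e ∷ [] , _   = contradiction (sym-E e) ¬Euv
  ... | m@(suc (suc _)) , q , s = c , (last , zero , inj₁ (inj₂ (cong suc toℕ-last , refl)) , at-last , at-first)
                                , λ { (i , j , inj₁ ij , refl , refl) → edges i j ij
                                    ; (i , j , inj₂ ji , refl , refl) → flip (edges j i ji) }
    where
    last : Fin (suc m)
    last = Fin.fromℕ m
    toℕ-last : toℕ last ≡ m
    toℕ-last = Fin.toℕ-fromℕ m
    at-last : vertex q last ≡ u
    at-last = vertex-last q last toℕ-last
    at-first : vertex q zero ≡ v
    at-first = vertex-first q
    edges : ∀ i j → Next i j → SamePair u v (vertex q i) (vertex q j) ⊎ E (vertex q i) (vertex q j)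
    edges i j    (inj₁ eq)       = inj₂ (vertex-step q i j eq)
    edges i zero (inj₂ (eq , _)) = inj₁ (inj₁ (vertex-last q i (suc-injective eq) , at-first))
    flip : ∀ {x y} → SamePair u v x y ⊎ E x y → SamePair u v y x ⊎ E y x
    flip (inj₁ a) = inj₁ (SamePair-sym a)
    flip (inj₂ b) = inj₂ (sym-E b)
    adjacent : ∀ {x y} → SamePair u v x y ⊎ E x y → Adj G x y
    adjacent (inj₁ (inj₁ (refl , refl))) = uv
    adjacent (inj₁ (inj₂ (refl , refl))) = Adj-sym G uv
    adjacent (inj₂ e)                    = E⇒Adj e
    c : Cycle G
    c = record
      { len = suc m
      ; 3≤len = s≤s (s≤s (s≤s z≤n))
      ; at = vertex q
      ; injective = Simple⇒injective q s
      ; step = λ i j ij → adjacent (edges i j ij)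
      }

  walk? : {E : Rel (Fin n) 0ℓ} → Decidable₂ E → ∀ m u v → Dec (Walk E u v m)
  walk? E? zero    u v with u ≟ v
  ... | yes refl = yes []
  ... | no u≢v   = no λ { [] → u≢v refl }
  walk? E? (suc m) u v = map′ (λ (_ , e , p) → e ∷ p) (λ { (e ∷ p) → _ , e , p })
    (Fin.any? λ w → E? u w ×-dec walk? E? m w v)

  least : {P : Pred ℕ 0ℓ} → Decidable P → ∀ l → P l → ∃ λ m → P m × (∀ l → P l → m ≤ l)
  least P? l p with P? 0
  ... | yes p₀ = 0 , p₀ , λ _ _ → z≤n
  least P? zero    p | no ¬p₀ = contradiction p ¬p₀
  least P? (suc l) p | no ¬p₀ with least (P? ∘ suc) l p
  ... | m , q , min = suc m , q , λ { zero p₀ → contradiction p₀ ¬p₀ ; (suc l) p → s≤s (min l p) }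

  abstract
    -- Adjacency is Boolean and the vertex set finite, so walks of a given length are decidable and
    -- the least length is found by search.
    distance : {u v : Fin n} (G : Graph n) → Joined (Adj G) u v → ∃ (IsDistance G u v)
    distance G (l , p) = least (λ m → walk? (λ x y → T? (adj G x y)) m _ _) l p

-- Cycles of a cactus, attachment points and degrees.

module CactusGraphs where

  open import Data.Bool using (T?)
  open import Data.Fin as Fin using (Fin; zero; suc; toℕ; _≟_; fromℕ<)
  import Data.Fin.Properties as Fin
  open import Data.Nat hiding (_≟_)
  open import Data.Nat.Properties hiding (_≟_)
  open import Data.Product using (_×_; _,_; ∃; ∃₂; proj₁; proj₂)
  open import Data.Sum using (_⊎_; inj₁; inj₂; swap)
  open import Data.Unit using (tt)
  open import Function using (_∘_; Equivalence)
  open import Level using (0ℓ)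
  open import Relation.Binary using (Rel; Symmetric; tri<; tri≈; tri>) renaming (Decidable to Decidable₂)
  open import Relation.Binary.PropositionalEquality
  open import Relation.Nullary using (¬_; Dec; yes; no; contradiction)
  open import Relation.Nullary.Decidable using (_×-dec_; _⊎-dec_)
  open import Defs hiding (_≈_; _≤_; _+_; _*_; _-_; -_)
  open FiniteSums
  open Walks

  Next? : ∀ {s} → Decidable₂ (Next {s})
  Next? {s} i j = (suc (toℕ i) ℕ≟ toℕ j) ⊎-dec ((suc (toℕ i) ℕ≟ s) ×-dec (toℕ j ℕ≟ 0))
    where open import Data.Nat renaming (_≟_ to _ℕ≟_) using ()

  next : ∀ {s} (i : Fin s) → ∃ (Next i)
  next {suc s} i with suc (toℕ i) <? suc s
  ... | yes lt = fromℕ< lt , inj₁ (sym (Fin.toℕ-fromℕ< lt))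
  ... | no ≮   = zero , inj₂ (≤-antisym (Fin.toℕ<n i) (≮⇒≥ ≮) , refl)

  next-unique : ∀ {s} {i j j′ : Fin s} → Next i j → Next i j′ → j ≡ j′
  next-unique (inj₁ a) (inj₁ b) = Fin.toℕ-injective (trans (sym a) b)
  next-unique {j = j} (inj₁ a) (inj₂ (b , _)) = contradiction (trans (sym a) b) (<⇒≢ (Fin.toℕ<n j))
  next-unique {j′ = j} (inj₂ (b , _)) (inj₁ a) = contradiction (trans (sym a) b) (<⇒≢ (Fin.toℕ<n j))
  next-unique (inj₂ (_ , a)) (inj₂ (_ , b)) = Fin.toℕ-injective (trans a (sym b))

  previous : ∀ {s} (j : Fin s) → ∃ λ i → Next i j
  previous {suc s} zero    = Fin.fromℕ s , inj₂ (cong suc (Fin.toℕ-fromℕ s) , refl)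
  previous {suc s} (suc j) = Fin.inject₁ j , inj₁ (cong suc (Fin.toℕ-inject₁ j))

  previous-unique : ∀ {s} {i i′ j : Fin s} → Next i j → Next i′ j → i ≡ i′
  previous-unique (inj₁ a) (inj₁ b) = Fin.toℕ-injective (suc-injective (trans a (sym b)))
  previous-unique (inj₁ a) (inj₂ (_ , b)) = contradiction (trans a b) 1+n≢0
  previous-unique (inj₂ (_ , b)) (inj₁ a) = contradiction (trans a b) 1+n≢0
  previous-unique (inj₂ (a , _)) (inj₂ (b , _)) = Fin.toℕ-injective (suc-injective (trans a (sym b)))

  -- On a closed sequence of length 1 or 2 successor and predecessor coincide. From length 3 on they
  -- differ, which gives a vertex of a cycle exactly two neighbours along it.
  next≢previous : ∀ {s} {i j k : Fin s} → 3 ≤ s → Next i j → Next j k → i ≢ k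
  next≢previous 3≤s (inj₁ a) (inj₁ b) refl = m≢1+n+m _ {1} (trans (sym b) (cong suc (sym a)))
  next≢previous {i = i} 3≤s (inj₁ a) (inj₂ (b , c)) refl =
    contradiction 3≤s (<⇒≱ (s≤s (≤-reflexive (trans (sym b) (cong suc (trans (sym a) (cong suc c)))))))
  next≢previous 3≤s (inj₂ (a , b)) (inj₁ c) refl =
    contradiction 3≤s (<⇒≱ (s≤s (≤-reflexive (trans (sym a) (cong suc (trans (sym c) (cong suc b)))))))
  next≢previous 3≤s (inj₂ (a , b)) (inj₂ (c , d)) refl =
    contradiction 3≤s (<⇒≱ (s≤s (≤-trans (≤-reflexive (trans (sym a) (cong suc d))) (s≤s z≤n))))

  -- The step hypothesis is confined to the positions from `i` to `j`, so the arc can be taken in a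
  -- relation that holds only there.
  segment : ∀ {n s} {F : Rel (Fin n) 0ℓ} (f : Fin s → Fin n) l i j → toℕ j ≡ l + toℕ i →
    (∀ t t′ → suc (toℕ t) ≡ toℕ t′ → toℕ i ≤ toℕ t → toℕ t′ ≤ toℕ j → F (f t) (f t′)) →
    Walk F (f i) (f j) l
  segment {F = F} f zero i j eq F-step = subst (λ t → Walk F (f i) (f t) 0) (Fin.toℕ-injective (sym eq)) []
  segment {F = F} f (suc l) i j eq F-step =
    F-step i i′ (sym i′-eq) ≤-refl (subst (_≤ toℕ j) (sym i′-eq) i<j)
      ∷ segment f l i′ j
          (trans eq (trans (sym (+-suc l (toℕ i))) (cong (l +_) (sym i′-eq))))
          (λ t t′ tt′ i′≤t → F-step t t′ tt′ (≤-trans (n≤1+n _) (subst (_≤ toℕ t) i′-eq i′≤t)))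
    where
    i<j : toℕ i < toℕ j
    i<j = subst (toℕ i <_) (sym eq) (s≤s (m≤n+m (toℕ i) l))
    i′ = fromℕ< (≤-<-trans i<j (Fin.toℕ<n j))
    i′-eq : toℕ i′ ≡ suc (toℕ i)
    i′-eq = Fin.toℕ-fromℕ< _

  module _ {n} {G : Graph n} where

    CycleEdge-sym : (c : Cycle G) → Symmetric (CycleEdge c)
    CycleEdge-sym c (i , j , ij , a , b) = j , i , swap ij , b , a

    CycleEdge? : (c : Cycle G) → Decidable₂ (CycleEdge c)
    CycleEdge? c u v = Fin.any? λ i → Fin.any? λ j →
      (Next? i j ⊎-dec Next? j i) ×-dec ((at c i ≟ u) ×-dec (at c j ≟ v))

    _∈ᶜ?_ : (v : Fin n) (c : Cycle G) → Dec (v ∈ᶜ c)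
    v ∈ᶜ? c = Fin.any? λ i → at c i ≟ v

    CycleEdge⇒∈ˡ : (c : Cycle G) → ∀ {u v} → CycleEdge c u v → u ∈ᶜ c
    CycleEdge⇒∈ˡ c (i , j , ij , a , b) = i , a

    CycleEdge⇒∈ʳ : (c : Cycle G) → ∀ {u v} → CycleEdge c u v → v ∈ᶜ c
    CycleEdge⇒∈ʳ c (i , j , ij , a , b) = j , b

    CycleEdge⇒Adj : (c : Cycle G) → ∀ {u v} → CycleEdge c u v → Adj G u v
    CycleEdge⇒Adj c (i , j , inj₁ ij , refl , refl) = step c i j ij
    CycleEdge⇒Adj c (i , j , inj₂ ji , refl , refl) = Adj-sym G (step c j i ji)

    next-edge : (c : Cycle G) → ∀ {i j} → Next i j → CycleEdge c (at c i) (at c j)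
    next-edge c ij = _ , _ , inj₁ ij , refl , refl

    -- The components of this relation are the pieces of `G` hanging at the single vertices of `c`.
    Off : Cycle G → Rel (Fin n) 0ℓ
    Off c x y = Adj G x y × ¬ CycleEdge c x y

    Off-sym : (c : Cycle G) → Symmetric (Off c)
    Off-sym c (a , ¬e) = Adj-sym G a , ¬e ∘ CycleEdge-sym c

    -- The edge relation that `IsArticulation` uses for the whole graph with `t` deleted.
    Avoiding : Fin n → Rel (Fin n) 0ℓ
    Avoiding t x y = Adj G x y × x ≢ t × y ≢ t

    Avoiding-sym : ∀ t → Symmetric (Avoiding t)
    Avoiding-sym t (a , x≢ , y≢) = Adj-sym G a , y≢ , x≢

    count-members : (c : Cycle G) → sum (λ v → 𝟙 (v ∈ᶜ? c)) ≡ len c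
    count-members c = begin
      sum (λ v → 𝟙 (v ∈ᶜ? c))                      ≡⟨ sum-cong-≗ member ⟨
      sum (λ v → sum (λ i → 𝟙 (at c i ≟ v)))       ≡⟨ ∑-comm (λ v i → 𝟙 (at c i ≟ v)) ⟩
      sum (λ i → sum (λ v → 𝟙 (at c i ≟ v)))       ≡⟨ sum-cong-≗ (λ i → sum≡1 (at c i ≟_) (at c i) refl (λ _ e → e)) ⟩
      sum {len c} (λ _ → 1)                        ≡⟨ trans (sum-const (len c) 1) (*-identityʳ (len c)) ⟩
      len c                                        ∎
      where
      open ≡-Reasoning
      member : ∀ v → sum (λ i → 𝟙 (at c i ≟ v)) ≡ 𝟙 (v ∈ᶜ? c)
      member v with v ∈ᶜ? c
      ... | yes (i , e) = sum≡1 (λ i → at c i ≟ v) i e (λ j e′ → injective c (trans e (sym e′)))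
      ... | no ∉        = sum-zero _ λ i → 𝟙-no (at c i ≟ v) λ e → ∉ (i , e)

    cycle-degree : (c : Cycle G) → ∀ v → sum (λ w → 𝟙 (CycleEdge? c v w)) ≡ 2 * 𝟙 (v ∈ᶜ? c)
    cycle-degree c v with v ∈ᶜ? c
    ... | no ∉ = sum-zero _ λ w → 𝟙-no (CycleEdge? c v w) (∉ ∘ CycleEdge⇒∈ˡ c)
    ... | yes (i , refl) with next i | previous i
    ...   | (j , ij) | (h , hi) = begin
      sum (λ w → 𝟙 (CycleEdge? c (at c i) w))                   ≡⟨ sum-cong-≗ split ⟩
      sum (λ w → 𝟙 (at c j ≟ w) + 𝟙 (at c h ≟ w))               ≡⟨ ∑-distrib-+ (λ w → 𝟙 (at c j ≟ w)) (λ w → 𝟙 (at c h ≟ w)) ⟩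
      sum (λ w → 𝟙 (at c j ≟ w)) + sum (λ w → 𝟙 (at c h ≟ w))   ≡⟨ cong₂ _+_ (sum≡1 (at c j ≟_) _ refl (λ _ e → e)) (sum≡1 (at c h ≟_) _ refl (λ _ e → e)) ⟩
      2                                                         ∎
      where
      open ≡-Reasoning
      split : ∀ w → 𝟙 (CycleEdge? c (at c i) w) ≡ 𝟙 (at c j ≟ w) + 𝟙 (at c h ≟ w)
      split w with at c j ≟ w | at c h ≟ w
      ... | yes p | yes q = contradiction (injective c (trans q (sym p))) (next≢previous (3≤len c) hi ij)
      ... | yes p | no _  = 𝟙-yes (CycleEdge? c (at c i) w) (i , j , inj₁ ij , refl , p)
      ... | no _  | yes q = 𝟙-yes (CycleEdge? c (at c i) w) (i , h , inj₂ hi , refl , q)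
      ... | no ¬p | no ¬q = 𝟙-no (CycleEdge? c (at c i) w) λ
        { (i′ , j′ , inj₁ ij′ , e , e′) →
            ¬p (trans (cong (at c) (next-unique (subst (λ t → Next t j) (sym (injective c e)) ij) ij′)) e′)
        ; (i′ , h′ , inj₂ hi′ , e , e′) →
            ¬q (trans (cong (at c) (previous-unique (subst (Next h) (sym (injective c e)) hi) hi′)) e′) }

  module CactusCycles {n} {G : Graph n} (cactus : IsCactus G) where

    connected : ∀ u v → Joined (Adj G) u v
    connected u v = proj₂ (proj₁ cactus) u v tt tt

    -- A walk off c between two positions of c closes up, with the arc between
    -- them, to a cycle sharing an edge with c but missing the edge after j.
    no-shortcut : (c : Cycle G) (i j : Fin (len c)) → toℕ i < toℕ j → ¬ Joined (Off c) (at c i) (at c j)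
    no-shortcut c i j i<j walk = Adj⇒≢ G first (proj₂ cactus c c′ c≉c′ (at c i) (at c i′)
            (i , refl) (CycleEdge⇒∈ˡ c′ edge-in) (i′ , refl) (CycleEdge⇒∈ʳ c′ edge-in))
      where
      j⁺ = proj₁ (next j)
      jj⁺ : Next j j⁺
      jj⁺ = proj₂ (next j)
      i′ = fromℕ< (≤-<-trans i<j (Fin.toℕ<n j))
      i′-eq : toℕ i′ ≡ suc (toℕ i)
      i′-eq = Fin.toℕ-fromℕ< _
      -- The arc from `i′` to `j`. The edge before it, from `i` to `i′`, is left out so that it can
      -- serve as the closing edge.
      Mid : Rel (Fin n) 0ℓ
      Mid x y = ∃₂ λ t t′ → suc (toℕ t) ≡ toℕ t′ × toℕ i < toℕ t × toℕ t′ ≤ toℕ j × SamePair (at c t) (at c t′) x y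
      E : Rel (Fin n) 0ℓ
      E x y = Adj G x y × (¬ CycleEdge c x y ⊎ Mid x y)
      E-sym : Symmetric E
      E-sym (a , inj₁ ¬e) = Adj-sym G a , inj₁ (¬e ∘ CycleEdge-sym c)
      E-sym (a , inj₂ (t , t′ , p , q , r , s)) = Adj-sym G a , inj₂ (t , t′ , p , q , r , SamePair-sym s)
      first : Adj G (at c i) (at c i′)
      first = step c i i′ (inj₁ (sym i′-eq))
      ¬E-first : ¬ E (at c i) (at c i′)
      ¬E-first (_ , inj₁ ¬e) = ¬e (next-edge c (inj₁ (sym i′-eq)))
      ¬E-first (_ , inj₂ (t , t′ , tt′ , i<t , _ , inj₁ (e , _))) = <⇒≢ i<t (cong toℕ (injective c e))
      ¬E-first (_ , inj₂ (t , t′ , tt′ , i<t , _ , inj₂ (e , _))) =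
        <⇒≢ (<-trans i<t (≤-reflexive tt′)) (cong toℕ (injective c e))
      arc : Joined E (at c i′) (at c j)
      arc = _ , segment (at c) (toℕ j ∸ toℕ i′) i′ j
        (sym (m∸n+n≡m (subst (_≤ toℕ j) (sym i′-eq) i<j)))
        λ t t′ tt′ i′≤t t′≤j → step c t t′ (inj₁ tt′) ,
          inj₂ (t , t′ , tt′ , subst (_≤ toℕ t) i′-eq i′≤t , t′≤j , inj₁ (refl , refl))
      closed = closing-edge G proj₁ E-sym first ¬E-first
        (join arc (map-join (λ (a , ¬e) → a , inj₁ ¬e) (join-sym (Off-sym c) walk)))
      c′ = proj₁ closed
      edge-in : CycleEdge c′ (at c i) (at c i′)
      edge-in = proj₁ (proj₂ closed)
      c≉c′ : ¬ (c ≈ᶜ c′)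
      c≉c′ c≈c′ with proj₂ (proj₂ closed) (Equivalence.to (c≈c′ (at c j) (at c j⁺)) (next-edge c jj⁺))
      ... | inj₁ (inj₁ (e , _)) = <⇒≢ i<j (cong toℕ (sym (injective c e)))
      -- Here `j` is `i′` and its successor is `i`, so `c` would have length 2.
      ... | inj₁ (inj₂ (e , e′)) = next≢previous (3≤len c) (inj₁ (sym i′-eq))
               (subst (λ t → Next t j⁺) (injective c e) jj⁺) (sym (injective c e′))
      ... | inj₂ (_ , inj₁ ¬e) = ¬e (next-edge c jj⁺)
      ... | inj₂ (_ , inj₂ (t , t′ , tt′ , i<t , t′≤j , inj₁ (e , _))) =
        <⇒≢ (≤-trans (≤-reflexive tt′) t′≤j) (cong toℕ (sym (injective c e)))
      -- The edge after `j` as an arc edge read backwards: the successor of `j` would be `t`, just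
      -- before `j` and after `i`. But it is just after `j`, or it is position 0, which is not after
      -- `i`.
      ... | inj₂ (_ , inj₂ (t , t′ , tt′ , i<t , t′≤j , inj₂ (e , e′))) with jj⁺
      ...   | inj₁ q = <⇒≢ (<-trans (≤-reflexive tt′) (subst (_< toℕ t) (cong toℕ (injective c e))
                          (subst (toℕ j <_) (cong toℕ (injective c e′)) (≤-reflexive q)))) refl
      ...   | inj₂ (_ , q) = n≮0 (subst (toℕ i <_) (trans (cong toℕ (sym (injective c e′))) q) i<t)

    -- This makes the projection of `G` onto `c` well defined. Only the order of the two positions
    -- has to be sorted out before `no-shortcut` applies.
    attachment-unique : (c : Cycle G) → ∀ {x y} → x ∈ᶜ c → y ∈ᶜ c → Joined (Off c) x y → x ≡ y
    attachment-unique c (i , refl) (j , refl) walk with <-cmp (toℕ i) (toℕ j)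
    ... | tri< i<j _ _ = contradiction walk (no-shortcut c i j i<j)
    ... | tri≈ _ eq _  = cong (at c) (Fin.toℕ-injective eq)
    ... | tri> _ _ j<i = contradiction (join-sym (Off-sym c) walk) (no-shortcut c j i j<i)

    -- The component of `t` off `c` can be left only along an edge of `c`, hence only at its one
    -- vertex on `c`, which is `t` itself. A walk avoiding `t` never gets out.
    attachment-blocks : (c : Cycle G) → ∀ {t x y m} → t ∈ᶜ c → Joined (Off c) x t →
      Walk (Avoiding {G = G} t) x y m → Joined (Off c) y t
    attachment-blocks c t∈c x~t [] = x~t
    attachment-blocks c {x = x} t∈c x~t (_∷_ {v = x′} (a , x≢t , _) p) with CycleEdge? c x x′
    ... | yes e = contradiction (attachment-unique c (CycleEdge⇒∈ˡ c e) t∈c x~t) x≢t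
    ... | no ¬e = attachment-blocks c t∈c (join (edge-join (Off-sym c (a , ¬e))) x~t) p

    -- Follow a walk to some vertex of `c` and stop where its first edge of `c` would begin;
    -- everything up to there is off `c`.
    attachment : (c : Cycle G) → ∀ x → ∃ λ t → t ∈ᶜ c × Joined (Off c) x t
    attachment c x = go (proj₂ (connected x (at c start)))
      where
      start = fromℕ< (<-≤-trans z<s (3≤len c))
      go : ∀ {x m} → Walk (Adj G) x (at c start) m → ∃ λ t → t ∈ᶜ c × Joined (Off c) x t
      go [] = _ , (start , refl) , _ , []
      go (_∷_ {x} {x′} a p) with CycleEdge? c x x′
      ... | yes e = x , CycleEdge⇒∈ˡ c e , _ , []
      ... | no ¬e = let (t , t∈c , x′~t) = go p in t , t∈c , join (edge-join (a , ¬e)) x′~t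

  module CountedCycles {n k} {G : Graph n} (cactus : IsCactus G) (nontrivial : IsNontrivial G)
    (counted : HasCycleCount G k) where

    open CactusCycles cactus public

    C : Fin k → Cycle G
    C = proj₁ counted

    C-injective : ∀ {i j} → C i ≈ᶜ C j → i ≡ j
    C-injective = proj₁ (proj₂ counted)

    -- The two ends of a common edge would be two common vertices.
    edge-cycle-unique : ∀ {i j u v} → CycleEdge (C i) u v → CycleEdge (C j) u v → i ≡ j
    edge-cycle-unique {i} {j} {u} {v} e e′ with i ≟ j
    ... | yes i≡j = i≡j
    ... | no i≢j  = contradiction
      (proj₂ cactus (C i) (C j) (i≢j ∘ C-injective) u v
        (CycleEdge⇒∈ˡ (C i) e) (CycleEdge⇒∈ˡ (C j) e′) (CycleEdge⇒∈ʳ (C i) e) (CycleEdge⇒∈ʳ (C j) e′))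
      (Adj⇒≢ G (CycleEdge⇒Adj (C i) e))

    -- A walk from `u` to `v` without the edge `uv` closes with it to a cycle, which is one of the
    -- `C i`. If a search through `C` finds no cycle with the edge, no such walk exists and `uv` is
    -- a bridge.
    edge-cycle : ∀ {u v} → Adj G u v → ∃ λ i → CycleEdge (C i) u v
    edge-cycle {u} {v} uv with Fin.any? (λ i → CycleEdge? (C i) u v)
    ... | yes found = found
    ... | no ¬∃ = contradiction (uv , u , v , tt , tt , no-detour) (nontrivial u v)
      where
      E : Rel (Fin n) 0ℓ
      E x y = Adj G x y × ¬ SamePair u v x y
      E-sym : Symmetric E
      E-sym (a , ¬s) = Adj-sym G a , ¬s ∘ SamePair-sym
      no-detour : ¬ Joined E u v
      no-detour walk with closing-edge G proj₁ E-sym uv (λ (_ , ¬s) → ¬s (inj₁ (refl , refl))) (join-sym E-sym walk)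
      ... | c , uv∈c , _ = let (i , Ci≈c) = proj₂ (proj₂ counted) c in
        ¬∃ (i , Equivalence.from (Ci≈c u v) uv∈c)

    adj-sum : ∀ u v → 𝟙 (T? (adj G u v)) ≡ sum (λ i → 𝟙 (CycleEdge? (C i) u v))
    adj-sum u v with T? (adj G u v)
    ... | yes a = let (i , e) = edge-cycle a in
      sym (sum≡1 (λ i → CycleEdge? (C i) u v) i e λ j → edge-cycle-unique e)
    ... | no ¬a = sym (sum-zero _ λ i → 𝟙-no (CycleEdge? (C i) u v) (¬a ∘ CycleEdge⇒Adj (C i)))

    cyclesAt : Fin n → ℕ
    cyclesAt v = sum (λ i → 𝟙 (v ∈ᶜ? C i))

    size : ℕ
    size = sum (λ i → len (C i))

    degree-sum : ∀ v → degree G v ≡ sum (λ w → 𝟙 (T? (adj G v w)))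
    degree-sum v = ∣tabulate∣ (adj G v)

    degree≡2*cyclesAt : ∀ v → degree G v ≡ 2 * cyclesAt v
    degree≡2*cyclesAt v = begin
      degree G v                                           ≡⟨ degree-sum v ⟩
      sum (λ w → 𝟙 (T? (adj G v w)))                       ≡⟨ sum-cong-≗ (adj-sum v) ⟩
      sum (λ w → sum (λ i → 𝟙 (CycleEdge? (C i) v w)))     ≡⟨ ∑-comm (λ w i → 𝟙 (CycleEdge? (C i) v w)) ⟩
      sum (λ i → sum (λ w → 𝟙 (CycleEdge? (C i) v w)))     ≡⟨ sum-cong-≗ (λ i → cycle-degree (C i) v) ⟩
      sum (λ i → 2 * 𝟙 (v ∈ᶜ? C i))                        ≡⟨ *-distribˡ-sum 2 (λ i → 𝟙 (v ∈ᶜ? C i)) ⟨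
      2 * cyclesAt v                                       ∎
      where open ≡-Reasoning

    sum-cyclesAt : sum cyclesAt ≡ size
    sum-cyclesAt = trans (∑-comm (λ v i → 𝟙 (v ∈ᶜ? C i))) (sum-cong-≗ λ i → count-members (C i))

    handshake : sum (degree G) ≡ 2 * size
    handshake = trans (sum-cong-≗ degree≡2*cyclesAt)
      (trans (sym (*-distribˡ-sum 2 cyclesAt)) (cong (2 *_) sum-cyclesAt))

    -- The argument in `Fin k` excludes the graph with a single vertex. The walk from `v` to its
    -- attachment point on `C i` is empty, and then `v` is on `C i`, or it begins with an edge,
    -- which lies on some cycle.
    1≤cyclesAt : Fin k → ∀ v → 1 ≤ cyclesAt v
    1≤cyclesAt i v = go (attachment (C i) v)
      where
      on-cycle : ∀ {j} → v ∈ᶜ C j → 1 ≤ cyclesAt v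
      on-cycle {j} v∈ = ≤-trans (≤-reflexive (sym (𝟙-yes (v ∈ᶜ? C j) v∈))) (term≤sum (λ j → 𝟙 (v ∈ᶜ? C j)) j)
      go : (∃ λ t → t ∈ᶜ C i × Joined (Off (C i)) v t) → 1 ≤ cyclesAt v
      go (_ , v∈ , _ , [])            = on-cycle v∈
      go (_ , _  , _ , (a , _) ∷ _) = let (j , e) = edge-cycle a in on-cycle (CycleEdge⇒∈ˡ (C j) e)

    -- Degrees are even and positive. The form `4 + t` makes the excess `∸ 4` compute to `t` where
    -- the chord is evaluated.
    degree-2-or-4+ : Fin k → ∀ v → degree G v ≡ 2 ⊎ ∃ λ t → degree G v ≡ 4 + t
    degree-2-or-4+ i v with cyclesAt v | degree≡2*cyclesAt v | 1≤cyclesAt i v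
    ... | 1           | eq | _ = inj₁ eq
    ... | suc (suc c) | eq | _ = inj₂ (2 * c , trans eq (*-distribˡ-+ 2 2 c))

-- Levels of the distance from a vertex, and the inequality for the diameter.

module DistanceLevels where

  open import Data.Bool using (T?)
  open import Data.Empty using (⊥)
  open import Data.Fin as Fin using (Fin; zero; suc; toℕ)
  import Data.Fin.Properties as Fin
  open import Data.Nat
  open import Data.Nat.Properties
  open import Data.Product using (_×_; _,_; ∃; ∃₂; proj₁; proj₂)
  open import Data.Sum using (inj₁)
  open import Data.Unit using (tt)
  open import Function using (_∘_)
  open import Relation.Binary.PropositionalEquality
  open import Relation.Nullary using (¬_; Dec; yes; no; contradiction)
  open import Relation.Nullary.Decidable using (_×-dec_; ¬?)
  open import Defs hiding (_≈_; _≤_; _+_; _*_; _-_; -_)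
  open FiniteSums
  open Walks
  open CactusGraphs

  module Levels {n k} {G : Graph n} (cactus : IsCactus G) (nontrivial : IsNontrivial G)
    (counted : HasCycleCount G k) (r : Fin n) where

    open CountedCycles cactus nontrivial counted

    lev : Fin n → ℕ
    lev v = proj₁ (distance G (connected v r))

    lev-walk : ∀ v → Walk (Adj G) v r (lev v)
    lev-walk v = proj₁ (proj₂ (distance G (connected v r)))

    lev-minimal : ∀ {v l} → Walk (Adj G) v r l → lev v ≤ l
    lev-minimal {v} = proj₂ (proj₂ (distance G (connected v r))) _

    lev-step : ∀ {v w} → Adj G v w → lev v ≤ suc (lev w)
    lev-step a = lev-minimal (a ∷ lev-walk _)

    parent-of : ∀ v → v ≢ r → ∃ λ p → Adj G v p × lev v ≡ suc (lev p)
    parent-of v v≢r with lev v | lev-walk v | lev-step {v} | lev-minimal {v}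
    ... | _ | []    | _         | _   = contradiction refl v≢r
    ... | _ | a ∷ p | step-down | min = _ , a , ≤-antisym (step-down a) (s≤s (lev-minimal p))

    -- The root is its own parent; it is never adjacent to itself.
    abstract
      parent : Fin n → Fin n
      parent v with v Fin.≟ r
      ... | yes _  = r
      ... | no v≢r = proj₁ (parent-of v v≢r)

      parent-adj : ∀ {v} → v ≢ r → Adj G v (parent v)
      parent-adj {v} v≢r with v Fin.≟ r
      ... | yes v≡r = contradiction v≡r v≢r
      ... | no v≢r′ = proj₁ (proj₂ (parent-of v v≢r′))

      parent-lev : ∀ {v} → v ≢ r → lev v ≡ suc (lev (parent v))
      parent-lev {v} v≢r with v Fin.≟ r
      ... | yes v≡r = contradiction v≡r v≢r
      ... | no v≢r′ = proj₂ (proj₂ (parent-of v v≢r′))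

      parent-root : ∀ {v} → v ≡ r → parent v ≡ v
      parent-root {v} v≡r with v Fin.≟ r
      ... | yes _  = sym v≡r
      ... | no v≢r = contradiction v≡r v≢r

    parent-adj⁻¹ : ∀ {v} → Adj G v (parent v) → v ≢ r
    parent-adj⁻¹ a v≡r = Adj⇒≢ G a (sym (parent-root v≡r))

    parent-lower : ∀ {v} → v ≢ r → lev (parent v) < lev v
    parent-lower v≢r = ≤-reflexive (sym (parent-lev v≢r))

    -- Parents have strictly smaller levels, so the path of parents from a vertex other than `v`
    -- that is no deeper than `v` cannot meet `v`. The number `l` bounds its length.
    climb-avoiding : ∀ {v} l w → lev w ≤ l → lev w ≤ lev v → w ≢ v → Joined (Avoiding {G = G} v) w r
    climb-avoiding l w w≤l w≤v w≢v with w Fin.≟ r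
    ... | yes refl = _ , []
    climb-avoiding zero    w w≤l w≤v w≢v | no w≢r = contradiction (≤-trans (parent-lower w≢r) w≤l) n≮0
    climb-avoiding (suc l) w w≤l w≤v w≢v | no w≢r = join
      (edge-join (parent-adj w≢r , w≢v , λ p≡v → <⇒≱ (parent-lower w≢r) (subst (λ x → lev w ≤ lev x) (sym p≡v) w≤v)))
      (climb-avoiding l (parent w) (≤-pred (≤-trans (parent-lower w≢r) w≤l)) (≤-trans (<⇒≤ (parent-lower w≢r)) w≤v)
        (λ p≡v → <⇒≱ (parent-lower w≢r) (subst (λ x → lev w ≤ lev x) (sym p≡v) w≤v)))

    -- Every walk from `r` to a vertex of `C i` passes through this vertex, by `attachment-blocks`.
    root : Fin k → Fin n
    root i = proj₁ (attachment (C i) r)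

    root∈ : ∀ i → root i ∈ᶜ C i
    root∈ i = proj₁ (proj₂ (attachment (C i) r))

    root-joined : ∀ i → Joined (Off (C i)) r (root i)
    root-joined i = proj₂ (proj₂ (attachment (C i) r))

    -- If `w` were no deeper than the root, its path of parents would reach `r` without passing the
    -- root, although every walk between `r` and `C i` passes it.
    root-above : ∀ {i v w} → v ≡ root i → w ∈ᶜ C i → lev w ≤ lev v → w ≢ v → ⊥
    root-above {i} {w = w} refl w∈ w≤v w≢v = w≢v (attachment-unique (C i) w∈ (root∈ i)
      (attachment-blocks (C i) (root∈ i) (root-joined i)
        (proj₂ (join-sym (Avoiding-sym {G = G} (root i)) (climb-avoiding (lev w) w ≤-refl w≤v w≢v)))))

    parent-edge⇒nonroot : ∀ {i v} → CycleEdge (C i) v (parent v) → v ≢ root i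
    parent-edge⇒nonroot {i} e v≡root = root-above v≡root (CycleEdge⇒∈ʳ (C i) e)
      (<⇒≤ (parent-lower (parent-adj⁻¹ a))) (Adj⇒≢ G a ∘ sym)
      where a = CycleEdge⇒Adj (C i) e

    -- If the parent edge of v ∈ c is off c then so is the whole path of parents,
    -- since it could re-enter c only at v itself.
    nonroot⇒parent-edge : ∀ {i v} → v ∈ᶜ C i → v ≢ root i → CycleEdge (C i) v (parent v)
    nonroot⇒parent-edge {i} {v} v∈ v≢root with CycleEdge? (C i) v (parent v)
    ... | yes e = e
    ... | no ¬e = contradiction (attachment-unique (C i) v∈ (root∈ i) (join v~r (root-joined i))) v≢root
      where
      climb : ∀ l w → lev w ≤ l → lev w < lev v → Joined (Off (C i)) v w → Joined (Off (C i)) v r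
      climb l w w≤l w<v v~w with w Fin.≟ r
      ... | yes refl = v~w
      climb zero    w w≤l w<v v~w | no w≢r = contradiction (≤-trans (parent-lower w≢r) w≤l) n≮0
      climb (suc l) w w≤l w<v v~w | no w≢r with CycleEdge? (C i) w (parent w)
      ... | yes e = contradiction (cong lev (attachment-unique (C i) (CycleEdge⇒∈ˡ (C i) e) v∈ (join-sym (Off-sym (C i)) v~w))) (<⇒≢ w<v)
      ... | no ¬e′ = climb l (parent w) (≤-pred (≤-trans (parent-lower w≢r) w≤l)) (<-trans (parent-lower w≢r) w<v)
                       (join v~w (edge-join (parent-adj w≢r , ¬e′)))
      v~r : Joined (Off (C i)) v r
      v~r with v Fin.≟ r
      ... | yes refl = _ , []
      ... | no v≢r   = climb (lev v) (parent v) (<⇒≤ (parent-lower v≢r)) (parent-lower v≢r) (edge-join (parent-adj v≢r , ¬e))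

    parent-edges : ∀ i → len (C i) ≡ sum (λ v → 𝟙 (CycleEdge? (C i) v (parent v))) + 1
    parent-edges i = begin
      len (C i)                                                                    ≡⟨ count-members (C i) ⟨
      sum (λ v → 𝟙 (v ∈ᶜ? C i))                                                    ≡⟨ sum-cong-≗ split ⟩
      sum (λ v → 𝟙 (CycleEdge? (C i) v (parent v)) + 𝟙 (root i Fin.≟ v))           ≡⟨ ∑-distrib-+ (λ v → 𝟙 (CycleEdge? (C i) v (parent v))) (λ v → 𝟙 (root i Fin.≟ v)) ⟩
      sum (λ v → 𝟙 (CycleEdge? (C i) v (parent v))) + sum (λ v → 𝟙 (root i Fin.≟ v)) ≡⟨ cong (sum (λ v → 𝟙 (CycleEdge? (C i) v (parent v))) +_) (sum≡1 (root i Fin.≟_) (root i) refl (λ _ e → e)) ⟩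
      sum (λ v → 𝟙 (CycleEdge? (C i) v (parent v))) + 1                            ∎
      where
      open ≡-Reasoning
      split : ∀ v → 𝟙 (v ∈ᶜ? C i) ≡ 𝟙 (CycleEdge? (C i) v (parent v)) + 𝟙 (root i Fin.≟ v)
      split v with root i Fin.≟ v
      ... | yes refl = trans (𝟙-yes (v ∈ᶜ? C i) (root∈ i))
                         (cong (_+ 1) (sym (𝟙-no (CycleEdge? (C i) v (parent v)) λ e → parent-edge⇒nonroot e refl)))
      ... | no ≢v = trans (𝟙-cong (v ∈ᶜ? C i) (CycleEdge? (C i) v (parent v))
                      (λ v∈ → nonroot⇒parent-edge v∈ (≢v ∘ sym)) (CycleEdge⇒∈ˡ (C i))) (sym (+-identityʳ _))

    -- A double count of parent edges: there are `n - 1` of them, one for each vertex other than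
    -- `r`, and each cycle carries `len (C i) - 1`.
    size+1≡n+k : size + 1 ≡ n + k
    size+1≡n+k = begin
      size + 1                                                                ≡⟨ cong (_+ 1) (sum-cong-≗ parent-edges) ⟩
      sum (λ i → tree i + 1) + 1                                              ≡⟨ cong (_+ 1) (∑-distrib-+ tree (λ _ → 1)) ⟩
      sum tree + sum {k} (λ _ → 1) + 1                                        ≡⟨ cong₂ (λ a b → a + b + 1) (∑-comm (λ i v → 𝟙 (CycleEdge? (C i) v (parent v)))) (trans (sum-const k 1) (*-identityʳ k)) ⟩
      sum (λ v → sum (λ i → 𝟙 (CycleEdge? (C i) v (parent v)))) + k + 1       ≡⟨ cong (λ a → a + k + 1) (sum-cong-≗ λ v → trans (sym (adj-sum v (parent v))) (nonroot v)) ⟩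
      sum (λ v → 𝟙 (¬? (v Fin.≟ r))) + k + 1                                  ≡⟨ trans (+-assoc _ k 1) (trans (cong (sum (λ v → 𝟙 (¬? (v Fin.≟ r))) +_) (+-comm k 1)) (sym (+-assoc _ 1 k))) ⟩
      sum (λ v → 𝟙 (¬? (v Fin.≟ r))) + 1 + k                                  ≡⟨ cong (λ a → sum (λ v → 𝟙 (¬? (v Fin.≟ r))) + a + k) (sum≡1 (Fin._≟ r) r refl (λ _ → sym)) ⟨
      sum (λ v → 𝟙 (¬? (v Fin.≟ r))) + sum (λ v → 𝟙 (v Fin.≟ r)) + k          ≡⟨ cong (_+ k) (∑-distrib-+ (λ v → 𝟙 (¬? (v Fin.≟ r))) (λ v → 𝟙 (v Fin.≟ r))) ⟨
      sum (λ v → 𝟙 (¬? (v Fin.≟ r)) + 𝟙 (v Fin.≟ r)) + k                      ≡⟨ cong (_+ k) (sum-cong-≗ λ v → trans (+-comm (𝟙 (¬? (v Fin.≟ r))) _) (𝟙-excluded-middle (v Fin.≟ r))) ⟩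
      sum {n} (λ _ → 1) + k                                                   ≡⟨ cong (_+ k) (trans (sum-const n 1) (*-identityʳ n)) ⟩
      n + k                                                                   ∎
      where
      open ≡-Reasoning
      tree : Fin k → ℕ
      tree i = sum (λ v → 𝟙 (CycleEdge? (C i) v (parent v)))
      nonroot : ∀ v → 𝟙 (T? (adj G v (parent v))) ≡ 𝟙 (¬? (v Fin.≟ r))
      nonroot v = 𝟙-cong (T? (adj G v (parent v))) (¬? (v Fin.≟ r)) parent-adj⁻¹ parent-adj

    Down? : ∀ v w → Dec (Adj G v w × lev v < lev w)
    Down? v w = T? (adj G v w) ×-dec (lev v <? lev w)

    Up? : ∀ v w → Dec (Adj G v w × lev w ≤ lev v)
    Up? v w = T? (adj G v w) ×-dec (lev w ≤? lev v)

    down : Fin n → ℕ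
    down v = sum (λ w → 𝟙 (Down? v w))

    -- The edges from v that do not descend all lie on the cycle of its parent edge:
    -- v is not the root of their cycles, and it is a non-root of only one.
    up≤2 : ∀ v → sum (λ w → 𝟙 (Up? v w)) ≤ 2
    up≤2 v with v Fin.≟ r
    ... | yes refl = subst (_≤ 2) (sym (sum-zero _ λ w → 𝟙-no (Up? v w) no-up)) z≤n
      where
      no-up : ∀ {w} → ¬ (Adj G v w × lev w ≤ lev v)
      no-up {w} (a , w≤v) = n≮0 (≤-trans (parent-lower (Adj⇒≢ G a ∘ sym)) (≤-trans w≤v (lev-minimal [])))
    ... | no v≢r with edge-cycle (parent-adj v≢r)
    ...   | i , e = ≤-trans (sum-mono λ w → 𝟙-mono (Up? v w) (CycleEdge? (C i) v w) same-cycle)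
        (≤-trans (≤-reflexive (cycle-degree (C i) v)) (*-monoʳ-≤ 2 (𝟙≤1 (v ∈ᶜ? C i))))
      where
      same-cycle : ∀ {w} → Adj G v w × lev w ≤ lev v → CycleEdge (C i) v w
      same-cycle {w} (a , w≤v) with edge-cycle a
      ... | j , e′ = subst (λ t → CycleEdge (C t) v w) (edge-cycle-unique nonroot-edge e) e′
        where
        nonroot-edge : CycleEdge (C j) v (parent v)
        nonroot-edge = nonroot⇒parent-edge (CycleEdge⇒∈ˡ (C j) e′)
          λ v≡root → root-above v≡root (CycleEdge⇒∈ʳ (C j) e′) w≤v (Adj⇒≢ G a ∘ sym)

    degree≡down+up : ∀ v → degree G v ≡ down v + sum (λ w → 𝟙 (Up? v w))
    degree≡down+up v = trans (degree-sum v) (trans (sum-cong-≗ split)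
      (∑-distrib-+ (λ w → 𝟙 (Down? v w)) (λ w → 𝟙 (Up? v w))))
      where
      split : ∀ w → 𝟙 (T? (adj G v w)) ≡ 𝟙 (Down? v w) + 𝟙 (Up? v w)
      split w with lev v <? lev w
      ... | yes v<w = trans (𝟙-cong _ (Down? v w) (λ a → a , v<w) proj₁)
             (trans (sym (+-identityʳ _)) (cong₂ _+_ (𝟙-cong (Down? v w) (T? (adj G v w) ×-dec yes v<w) (λ z → z) (λ z → z)) (sym (𝟙-no (Up? v w) λ (_ , w≤v) → <⇒≱ v<w w≤v))))
      ... | no v≮w  = trans (𝟙-cong _ (Up? v w) (λ a → a , ≮⇒≥ v≮w) proj₁)
             (cong (_+ 𝟙 (Up? v w)) (sym (𝟙-no (T? (adj G v w) ×-dec no v≮w) λ (_ , v<w) → v≮w v<w)))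

    -- At most two edges at `v` do not descend, so at least `deg v - 2` do.
    excess≤ : ∀ v → degree G v ∸ 4 ≤ down v ∸ 2
    excess≤ v = ≤-trans (∸-monoˡ-≤ 4 (≤-trans (≤-reflexive (degree≡down+up v)) (+-monoʳ-≤ (down v) (up≤2 v))))
      (≤-reflexive (trans (cong (_∸ 4) (+-comm (down v) 2)) ([m+n]∸[m+o]≡n∸o 2 (down v) 2)))

    -- An edge descends in at most one of its two directions, whereas the degrees count both.
    sum-down≤size : sum down ≤ size
    sum-down≤size = *-cancelˡ-≤ 2 (begin
      2 * sum down                                                         ≡⟨ cong (sum down +_) (+-identityʳ (sum down)) ⟩
      sum down + sum down                                                  ≡⟨ cong (sum down +_) (∑-comm (λ v w → 𝟙 (Down? v w))) ⟩
      sum down + sum (λ v → sum (λ w → 𝟙 (Down? w v)))                     ≡⟨ ∑-distrib-+ down (λ v → sum (λ w → 𝟙 (Down? w v))) ⟨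
      sum (λ v → down v + sum (λ w → 𝟙 (Down? w v)))                       ≡⟨ sum-cong-≗ (λ v → ∑-distrib-+ (λ w → 𝟙 (Down? v w)) (λ w → 𝟙 (Down? w v))) ⟨
      sum (λ v → sum (λ w → 𝟙 (Down? v w) + 𝟙 (Down? w v)))                ≤⟨ sum-mono (λ v → sum-mono (either v)) ⟩
      sum (λ v → sum (λ w → 𝟙 (T? (adj G v w))))                           ≡⟨ sum-cong-≗ degree-sum ⟨
      sum (degree G)                                                       ≡⟨ handshake ⟩
      2 * size                                                             ∎)
      where
      open ≤-Reasoning
      either : ∀ v w → 𝟙 (Down? v w) + 𝟙 (Down? w v) ≤ 𝟙 (T? (adj G v w))
      either v w with Down? v w
      ... | yes (a , v<w) = ≤-reflexive (trans (cong suc (𝟙-no (Down? w v) λ (_ , w<v) → <-asym v<w w<v)) (sym (𝟙-yes (T? (adj G v w)) a)))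
      ... | no _ = 𝟙-mono (Down? w v) (T? (adj G v w)) (Adj-sym G ∘ proj₁)

    -- The path of parents from `u` drops by one level at a time, so one of its edges joins the
    -- levels `suc ℓ` and `ℓ`.
    crossing : ∀ {ℓ} l u → lev u ≤ l → ℓ < lev u → ∃₂ λ a b → Adj G a b × lev a ≡ ℓ × lev b ≡ suc ℓ
    crossing zero    u u≤l ℓ<u = contradiction (≤-trans ℓ<u u≤l) n≮0
    crossing {ℓ} (suc l) u u≤l ℓ<u = climb
      where
      u≢r : u ≢ r
      u≢r refl = n≮0 (≤-trans ℓ<u (lev-minimal []))
      climb : ∃₂ λ a b → Adj G a b × lev a ≡ ℓ × lev b ≡ suc ℓ
      climb with lev (parent u) ≟ ℓ
      ... | yes eq = parent u , u , Adj-sym G (parent-adj u≢r) , eq , trans (parent-lev u≢r) (cong suc eq)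
      ... | no ≢ℓ = crossing l (parent u) (≤-pred (≤-trans (parent-lower u≢r) u≤l))
                      (≤∧≢⇒< (≤-pred (≤-trans ℓ<u (≤-reflexive (parent-lev u≢r)))) (≢ℓ ∘ sym))

    -- The cap at 2 leaves `down v ∸ 2` of the descending edges at `v` unspent, and these pay for
    -- the excess in `2*lev+excess≤size`. A vertex lies on one level only, so the sum over all `ℓ`
    -- spends `down v ⊓ 2` at most once.
    cut : ℕ → Fin n → ℕ
    cut ℓ v = 𝟙 (lev v ≟ ℓ) * (down v ⊓ 2)

    cut-on-level : ∀ {ℓ v} → lev v ≡ ℓ → cut ℓ v ≡ down v ⊓ 2
    cut-on-level {ℓ} {v} eq = trans (cong (_* (down v ⊓ 2)) (𝟙-yes (lev v ≟ ℓ) eq)) (*-identityˡ (down v ⊓ 2))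

    cut-vertices : ∀ {ℓ v} → lev v ≡ ℓ → 1 ≤ down v → 1 ≤ cut ℓ v
    cut-vertices eq 1≤ = ≤-trans (⊓-glb 1≤ (s≤s z≤n)) (≤-reflexive (sym (cut-on-level eq)))

    down-edge : ∀ {v w} → Adj G v w → lev v < lev w → 1 ≤ down v
    down-edge {v} {w} a v<w = ≤-trans (≤-reflexive (sym (𝟙-yes (Down? v w) (a , v<w)))) (term≤sum (λ w → 𝟙 (Down? v w)) w)

    -- A single edge between two consecutive levels would be a bridge.
    2≤cut : ∀ {ℓ} u → ℓ < lev u → 2 ≤ sum (cut ℓ)
    2≤cut {ℓ} u ℓ<u with crossing (lev u) u ≤-refl ℓ<u
    ... | a , b , ab , a≡ℓ , b≡1+ℓ with 2 ≤? down a
    ...   | yes 2≤ = ≤-trans (≤-reflexive (sym (trans (cut-on-level a≡ℓ) (m≥n⇒m⊓n≡n 2≤)))) (term≤sum (cut ℓ) a)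
    ...   | no ≰2 with Fin.any? (λ v → ¬? (v Fin.≟ a) ×-dec ((lev v ≟ ℓ) ×-dec (1 ≤? down v)))
    ...     | yes (v , v≢a , v≡ℓ , 1≤v) = ≤-trans
                (+-mono-≤ (cut-vertices v≡ℓ 1≤v) (cut-vertices a≡ℓ (down-edge ab (≤-reflexive (trans (cong suc a≡ℓ) (sym b≡1+ℓ))))))
                (two-terms≤sum (cut ℓ) v≢a)
    ...     | no ¬∃ = contradiction (ab , a , b , tt , tt , λ (_ , p) → stuck p (≤-reflexive a≡ℓ) (≤-reflexive (sym b≡1+ℓ))) (nontrivial a b)
      where
      a<b : lev a < lev b
      a<b = ≤-reflexive (trans (cong suc a≡ℓ) (sym b≡1+ℓ))
      only-a : ∀ {x} → lev x ≡ ℓ → 1 ≤ down x → x ≡ a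
      only-a {x} x≡ℓ 1≤x with x Fin.≟ a
      ... | yes x≡a = x≡a
      ... | no x≢a  = contradiction (x , x≢a , x≡ℓ , 1≤x) ¬∃
      only-b : ∀ {y} → Adj G a y → lev a < lev y → y ≡ b
      only-b {y} ay a<y with y Fin.≟ b
      ... | yes y≡b = y≡b
      ... | no y≢b  = contradiction (≤-trans (≤-reflexive (sym (cong₂ _+_ (𝟙-yes (Down? a y) (ay , a<y)) (𝟙-yes (Down? a b) (ab , a<b)))))
                        (two-terms≤sum (λ w → 𝟙 (Down? a w)) y≢b)) ≰2
      -- Leaving the levels up to `ℓ` takes an edge from level `ℓ` to the next one, and `only-a` and
      -- `only-b` identify it as the forbidden edge.
      stuck : ∀ {x y m} → Walk (λ x y → Adj G x y × ¬ SamePair a b x y) x y m → lev x ≤ ℓ → ¬ ℓ < lev y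
      stuck [] x≤ℓ ℓ<x = <⇒≱ ℓ<x x≤ℓ
      stuck (_∷_ {x} {x′} (xx′ , ¬ab) p) x≤ℓ ℓ<y with lev x′ ≤? ℓ
      ... | yes x′≤ℓ = stuck p x′≤ℓ ℓ<y
      ... | no x′≰ℓ = ¬ab (inj₁ (x≡a , only-b (subst (λ t → Adj G t x′) x≡a xx′) (subst (λ t → lev t < lev x′) x≡a x<x′)))
        where
        ℓ<x′ = ≰⇒> x′≰ℓ
        x≡ℓ : lev x ≡ ℓ
        x≡ℓ = ≤-antisym x≤ℓ (≤-pred (≤-trans ℓ<x′ (lev-step (Adj-sym G xx′))))
        x<x′ : lev x < lev x′
        x<x′ = ≤-trans (s≤s x≤ℓ) ℓ<x′
        x≡a : x ≡ a
        x≡a = only-a x≡ℓ (down-edge xx′ x<x′)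

    2*lev≤ : ∀ u → 2 * lev u ≤ sum (λ v → down v ⊓ 2)
    2*lev≤ u = begin
      2 * lev u                                                                  ≡⟨ trans (*-comm 2 (lev u)) (sym (sum-const (lev u) 2)) ⟩
      sum {lev u} (λ _ → 2)                                                      ≤⟨ sum-mono (λ ℓ → 2≤cut u (Fin.toℕ<n ℓ)) ⟩
      sum {lev u} (λ ℓ → sum (cut (toℕ ℓ)))                                      ≡⟨ ∑-comm (λ (ℓ : Fin (lev u)) v → cut (toℕ ℓ) v) ⟩
      sum (λ v → sum {lev u} (λ ℓ → cut (toℕ ℓ) v))                              ≤⟨ sum-mono one-level ⟩
      sum (λ v → down v ⊓ 2)                                                     ∎
      where
      open ≤-Reasoning
      one-level : ∀ v → sum {lev u} (λ ℓ → cut (toℕ ℓ) v) ≤ down v ⊓ 2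
      one-level v = begin
        sum {lev u} (λ ℓ → 𝟙 (lev v ≟ toℕ ℓ) * (down v ⊓ 2))  ≡⟨ sum-cong-≗ (λ (ℓ : Fin (lev u)) → *-comm (𝟙 (lev v ≟ toℕ ℓ)) (down v ⊓ 2)) ⟩
        sum {lev u} (λ ℓ → (down v ⊓ 2) * 𝟙 (lev v ≟ toℕ ℓ))  ≡⟨ *-distribˡ-sum (down v ⊓ 2) (λ (ℓ : Fin (lev u)) → 𝟙 (lev v ≟ toℕ ℓ)) ⟨
        (down v ⊓ 2) * sum {lev u} (λ ℓ → 𝟙 (lev v ≟ toℕ ℓ))  ≤⟨ *-monoʳ-≤ (down v ⊓ 2) (sum≤1 (λ (ℓ : Fin (lev u)) → lev v ≟ toℕ ℓ) λ _ _ p q → Fin.toℕ-injective (trans (sym p) q)) ⟩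
        (down v ⊓ 2) * 1                                      ≡⟨ *-identityʳ (down v ⊓ 2) ⟩
        down v ⊓ 2                                            ∎

    2*lev+excess≤size : ∀ u → 2 * lev u + sum (λ v → degree G v ∸ 4) ≤ size
    2*lev+excess≤size u = begin
      2 * lev u + sum (λ v → degree G v ∸ 4)                  ≤⟨ +-mono-≤ (2*lev≤ u) (sum-mono excess≤) ⟩
      sum (λ v → down v ⊓ 2) + sum (λ v → down v ∸ 2)         ≡⟨ ∑-distrib-+ (λ v → down v ⊓ 2) (λ v → down v ∸ 2) ⟨
      sum (λ v → down v ⊓ 2 + (down v ∸ 2))                   ≡⟨ sum-cong-≗ (λ v → trans (cong (_+ (down v ∸ 2)) (⊓-comm (down v) 2)) (m⊓n+n∸m≡n 2 (down v))) ⟩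
      sum down                                                ≤⟨ sum-down≤size ⟩
      size                                                    ∎
      where open ≤-Reasoning

-- Arcs of a cycle, and the cycles of a cactus as blocks.

module CycleBlocks where

  open import Data.Bool using (T; true)
  open import Data.Fin as Fin using (Fin; suc; toℕ; fromℕ<)
  import Data.Fin.Properties as Fin
  import Data.Fin.Subset as Subset
  open import Data.Nat
  open import Data.Nat.Properties
  open import Data.Product using (_×_; _,_; ∃; proj₁; proj₂)
  open import Data.Sum using (_⊎_; inj₁; inj₂)
  open import Data.Unit using (tt)
  open import Data.Vec using (tabulate)
  import Data.Vec.Properties as Vec
  open import Function using (_∘_; mk⇔)
  open import Level using (0ℓ)
  open import Relation.Binary using (Rel; Symmetric; tri<; tri≈; tri>)
  open import Relation.Binary.PropositionalEquality
  open import Relation.Nullary using (¬_; Dec; yes; no; does; contradiction)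
  open import Relation.Nullary.Decidable using (does-⇔)
  open import Defs hiding (_≈_; _≤_; _+_; _*_; _-_; -_)
  open FiniteSums
  open Walks
  open CactusGraphs

  does⇒ : {P : Set} (P? : Dec P) → T (does P?) → P
  does⇒ (yes p) _ = p

  ⇒does : {P : Set} (P? : Dec P) → P → T (does P?)
  ⇒does (yes _) _ = tt
  ⇒does (no ¬p) p = ¬p p

  ∈-tabulate⁺ : ∀ {n} {P : Fin n → Set} (P? : ∀ v → Dec (P v)) {v} → P v → v Subset.∈ tabulate (does ∘ P?)
  ∈-tabulate⁺ P? {v} p = Vec.lookup⇒[]= v _ (trans (Vec.lookup∘tabulate _ v) (does-true (P? v) p))
    where
    does-true : {P : Set} (P? : Dec P) → P → does P? ≡ true
    does-true (yes _) _ = refl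
    does-true (no ¬p) p = contradiction p ¬p

  ∈-tabulate⁻ : ∀ {n} {P : Fin n → Set} (P? : ∀ v → Dec (P v)) {v} → v Subset.∈ tabulate (does ∘ P?) → P v
  ∈-tabulate⁻ P? {v} v∈ = does⇒ (P? v) (subst T (trans (sym (Vec.[]=⇒lookup v∈)) (Vec.lookup∘tabulate _ v)) tt)

  module _ {n} {G : Graph n} (c : Cycle G) where

    private
      last : Fin (len c)
      last = fromℕ< (≤-reflexive (suc-pred (len c) {{>-nonZero (<-trans z<s (3≤len c))}}))

      first : Fin (len c)
      first = fromℕ< (<-trans z<s (3≤len c))

      suc-last : suc (toℕ last) ≡ len c
      suc-last = trans (cong suc (Fin.toℕ-fromℕ< _)) (suc-pred (len c) {{>-nonZero (<-trans z<s (3≤len c))}})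

      toℕ-first : toℕ first ≡ 0
      toℕ-first = Fin.toℕ-fromℕ< _

      ≤last : ∀ i → toℕ i ≤ toℕ last
      ≤last i = ≤-pred (≤-trans (Fin.toℕ<n i) (≤-reflexive (sym suc-last)))

    Between Outside : Fin (len c) → Fin (len c) → Fin (len c) → Set
    Between i j t = toℕ i ≤ toℕ t × toℕ t ≤ toℕ j
    Outside i j t = toℕ t ≤ toℕ i ⊎ toℕ j ≤ toℕ t

    inner-arc : ∀ {F : Rel (Fin n) 0ℓ} i j → toℕ i ≤ toℕ j →
      (∀ t t′ → Next t t′ → Between i j t → Between i j t′ → F (at c t) (at c t′)) →
      Walk F (at c i) (at c j) (toℕ j ∸ toℕ i)
    inner-arc i j i≤j F-step = segment (at c) (toℕ j ∸ toℕ i) i j (sym (m∸n+n≡m i≤j)) λ t t′ tt′ i≤t t′≤j →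
      let t≤t′ = ≤-trans (n≤1+n _) (≤-reflexive tt′) in
      F-step t t′ (inj₁ tt′) (i≤t , ≤-trans t≤t′ t′≤j) (≤-trans i≤t t≤t′ , t′≤j)

    -- From `i` down to position 0, across the closing edge to the last position, and down to `j`;
    -- the `suc` in the length is the closing edge.
    outer-arc : ∀ {F : Rel (Fin n) 0ℓ} → Symmetric F → ∀ i j →
      (∀ t t′ → Next t t′ → Outside i j t → Outside i j t′ → F (at c t) (at c t′)) →
      Walk F (at c i) (at c j) (toℕ i + suc (toℕ last ∸ toℕ j))
    outer-arc {F} F-sym i j F-step =
      reverse F-sym (subst (λ l → Walk F (at c first) (at c i) (toℕ i ∸ l)) toℕ-first
        (inner-arc first i (subst (_≤ toℕ i) (sym toℕ-first) z≤n)
          λ t t′ tt′ (_ , t≤i) (_ , t′≤i) → F-step t t′ tt′ (inj₁ t≤i) (inj₁ t′≤i)))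
      ++ (F-sym (F-step last first (inj₂ (suc-last , toℕ-first)) (inj₂ (≤last j)) (inj₁ (subst (_≤ toℕ i) (sym toℕ-first) z≤n)))
         ∷ reverse F-sym (inner-arc j last (≤last j)
             λ t t′ tt′ (j≤t , _) (j≤t′ , _) → F-step t t′ tt′ (inj₂ j≤t) (inj₂ j≤t′)))

    outer-arc-length : ∀ (i j : Fin (len c)) → toℕ i ≤ toℕ j → toℕ i + suc (toℕ last ∸ toℕ j) ≡ len c ∸ (toℕ j ∸ toℕ i)
    outer-arc-length i j i≤j = begin
      toℕ i + suc (toℕ last ∸ toℕ j)                                          ≡⟨ m+n∸n≡m _ (toℕ j ∸ toℕ i) ⟨
      toℕ i + suc (toℕ last ∸ toℕ j) + (toℕ j ∸ toℕ i) ∸ (toℕ j ∸ toℕ i)      ≡⟨ cong (_∸ (toℕ j ∸ toℕ i)) total ⟩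
      len c ∸ (toℕ j ∸ toℕ i)                                                 ∎
      where
      open ≡-Reasoning
      total : toℕ i + suc (toℕ last ∸ toℕ j) + (toℕ j ∸ toℕ i) ≡ len c
      total = begin
        toℕ i + suc (toℕ last ∸ toℕ j) + (toℕ j ∸ toℕ i)   ≡⟨ cong (_+ (toℕ j ∸ toℕ i)) (+-comm (toℕ i) _) ⟩
        suc (toℕ last ∸ toℕ j) + toℕ i + (toℕ j ∸ toℕ i)   ≡⟨ +-assoc (suc (toℕ last ∸ toℕ j)) (toℕ i) _ ⟩
        suc (toℕ last ∸ toℕ j) + (toℕ i + (toℕ j ∸ toℕ i)) ≡⟨ cong (suc (toℕ last ∸ toℕ j) +_) (m+[n∸m]≡n i≤j) ⟩
        suc (toℕ last ∸ toℕ j + toℕ j)                     ≡⟨ cong suc (m∸n+n≡m (≤last j)) ⟩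
        suc (toℕ last)                                     ≡⟨ suc-last ⟩
        len c                                              ∎

    module _ {F : Rel (Fin n) 0ℓ} (F-sym : Symmetric F) (r : Fin (len c))
      (F-step : ∀ t t′ → Next t t′ → t ≢ r → t′ ≢ r → F (at c t) (at c t′)) where

      private
        ordered : ∀ i j → i ≢ r → j ≢ r → toℕ i ≤ toℕ j → Joined F (at c i) (at c j)
        ordered i j i≢r j≢r i≤j with <-cmp (toℕ r) (toℕ i) | <-cmp (toℕ r) (toℕ j)
        ... | tri≈ _ r≡i _ | _ = contradiction (Fin.toℕ-injective (sym r≡i)) i≢r
        ... | _ | tri≈ _ r≡j _ = contradiction (Fin.toℕ-injective (sym r≡j)) j≢r
        ... | tri< r<i _ _ | _ = _ , inner-arc i j i≤j λ t t′ tt′ (i≤t , _) (i≤t′ , _) →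
          F-step t t′ tt′ (λ { refl → <⇒≱ r<i i≤t }) (λ { refl → <⇒≱ r<i i≤t′ })
        ... | _ | tri> _ _ j<r = _ , inner-arc i j i≤j λ t t′ tt′ (_ , t≤j) (_ , t′≤j) →
          F-step t t′ tt′ (λ { refl → <⇒≱ j<r t≤j }) (λ { refl → <⇒≱ j<r t′≤j })
        ... | tri> _ _ i<r | tri< r<j _ _ = _ , outer-arc F-sym i j λ t t′ tt′ out out′ →
          F-step t t′ tt′ (≢r out) (≢r out′)
          where
          ≢r : ∀ {t} → Outside i j t → t ≢ r
          ≢r (inj₁ t≤i) refl = <⇒≱ i<r t≤i
          ≢r (inj₂ j≤t) refl = <⇒≱ r<j j≤t

      -- Of the two arcs between `i` and `j` one misses `r`: the inner arc unless `r` lies strictly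
      -- between them, and then the outer one.
      arc-avoiding : ∀ i j → i ≢ r → j ≢ r → Joined F (at c i) (at c j)
      arc-avoiding i j i≢r j≢r with ≤-total (toℕ i) (toℕ j)
      ... | inj₁ i≤j = ordered i j i≢r j≢r i≤j
      ... | inj₂ j≤i = join-sym F-sym (ordered j i j≢r i≢r j≤i)

    cycleSubgraph : Subgraph G
    cycleSubgraph = record
      { verts     = tabulate (λ v → does (v ∈ᶜ? c))
      ; edge      = λ u v → does (CycleEdge? c u v)
      ; edge-sym  = λ u v → does-⇔ (mk⇔ (CycleEdge-sym c) (CycleEdge-sym c)) (CycleEdge? c u v) (CycleEdge? c v u)
      ; edge⇒vert = λ u v e → ∈-tabulate⁺ (_∈ᶜ? c) (CycleEdge⇒∈ˡ c (does⇒ (CycleEdge? c u v) e))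
      ; edge⇒adj  = λ u v e → CycleEdge⇒Adj c (does⇒ (CycleEdge? c u v) e)
      }

    vert⁺ : ∀ {v} → v ∈ᶜ c → Vert cycleSubgraph v
    vert⁺ = ∈-tabulate⁺ (_∈ᶜ? c)

    vert⁻ : ∀ {v} → Vert cycleSubgraph v → v ∈ᶜ c
    vert⁻ = ∈-tabulate⁻ (_∈ᶜ? c)

    edge⁺ : ∀ {u v} → CycleEdge c u v → Edge cycleSubgraph u v
    edge⁺ {u} {v} = ⇒does (CycleEdge? c u v)

    edge⁻ : ∀ {u v} → Edge cycleSubgraph u v → CycleEdge c u v
    edge⁻ {u} {v} = does⇒ (CycleEdge? c u v)

    cycle-inseparable : IsInseparable cycleSubgraph
    cycle-inseparable = (((_ , vert⁺ (first , refl)) , λ u v u∈ v∈ → connect (vert⁻ u∈) (vert⁻ v∈))) , no-articulation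
      where
      edge-symmetric : Symmetric (Edge cycleSubgraph)
      edge-symmetric {u} {v} = subst T (edge-sym cycleSubgraph u v)
      ordered : ∀ i j → toℕ i ≤ toℕ j → Joined (Edge cycleSubgraph) (at c i) (at c j)
      ordered i j i≤j = _ , inner-arc i j i≤j λ t t′ tt′ _ _ → edge⁺ (next-edge c tt′)
      connect : ∀ {u v} → u ∈ᶜ c → v ∈ᶜ c → Joined (Edge cycleSubgraph) u v
      connect (i , refl) (j , refl) with ≤-total (toℕ i) (toℕ j)
      ... | inj₁ i≤j = ordered i j i≤j
      ... | inj₂ j≤i = join-sym edge-symmetric (ordered j i j≤i)
      no-articulation : ∀ v → ¬ IsArticulation (Vert cycleSubgraph) (Edge cycleSubgraph) v
      no-articulation v (v∈ , u , w , (u∈ , u≢v) , (w∈ , w≢v) , ¬walk) with vert⁻ v∈ | vert⁻ u∈ | vert⁻ w∈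
      ... | r , refl | i , refl | j , refl = ¬walk (arc-avoiding
        (λ (e , x≢ , y≢) → edge-symmetric e , y≢ , x≢) r
        (λ t t′ tt′ t≢r t′≢r → edge⁺ (next-edge c tt′) , t≢r ∘ injective c , t′≢r ∘ injective c)
        i j (u≢v ∘ cong (at c)) (w≢v ∘ cong (at c)))

  module Blocks {n} {G : Graph n} (cactus : IsCactus G) where

    open CactusCycles cactus

    -- A vertex of K outside c would be separated from c by its attachment point.
    inseparable-⊑ : (c : Cycle G) (K : Subgraph G) → IsInseparable K → ∀ {u v} → u ≢ v →
      Vert K u → Vert K v → u ∈ᶜ c → v ∈ᶜ c → K ⊑ cycleSubgraph c
    inseparable-⊑ c K (K-connected , no-articulation) {u} {v} u≢v u∈K v∈K u∈c v∈c =
      (λ w w∈K → vert⁺ c (inside w∈K)) , edges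
      where
      attach : ∀ {x m} → Vert K x → Walk (Edge K) x u m → ∃ λ t → Vert K t × t ∈ᶜ c × Joined (Off c) x t
      attach x∈K [] = u , u∈K , u∈c , _ , []
      attach x∈K (_∷_ {x} {x′} e p) with CycleEdge? c x x′
      ... | yes xx′ = x , x∈K , CycleEdge⇒∈ˡ c xx′ , _ , []
      ... | no ¬xx′ with attach (edge⇒vert K x′ x (subst T (edge-sym K x x′) e)) p
      ...   | t , t∈K , t∈c , x′~t = t , t∈K , t∈c , join (edge-join (edge⇒adj K x x′ e , ¬xx′)) x′~t
      -- The separating vertex `t` may itself be `u` or `v`; of two distinct vertices at least one
      -- is left to be separated from `w`.
      other : ∀ t → ∃ λ z → z ≢ t × Vert K z × z ∈ᶜ c
      other t with u Fin.≟ t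
      ... | yes refl = v , u≢v ∘ sym , v∈K , v∈c
      ... | no u≢t   = u , u≢t , u∈K , u∈c
      inside : ∀ {w} → Vert K w → w ∈ᶜ c
      inside {w} w∈K with w ∈ᶜ? c
      ... | yes w∈c = w∈c
      ... | no w∉c with attach w∈K (proj₂ (proj₂ K-connected w u w∈K u∈K))
      ...   | t , t∈K , t∈c , w~t with other t
      ...     | z , z≢t , z∈K , z∈c = contradiction
        (t∈K , w , z , (w∈K , λ { refl → w∉c t∈c }) , (z∈K , z≢t) , λ (_ , p) →
          z≢t (attachment-unique c z∈c t∈c (attachment-blocks c t∈c w~t
            (map-walk (λ (e , x≢t , y≢t) → edge⇒adj K _ _ e , x≢t , y≢t) p))))
        (no-articulation t)
      -- An edge of `K` that is not on `c` would be a chord: its distinct ends on `c` would be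
      -- joined off `c`.
      edges : ∀ x y → Edge K x y → Edge (cycleSubgraph c) x y
      edges x y e with CycleEdge? c x y
      ... | yes xy = tt
      ... | no ¬xy = Adj⇒≢ G a (attachment-unique c
                       (inside (edge⇒vert K x y e)) (inside (edge⇒vert K y x (subst T (edge-sym K x y) e))) (edge-join (a , ¬xy)))
        where a = edge⇒adj K x y e

    cycle-block : (c : Cycle G) → IsBlock (cycleSubgraph c)
    cycle-block c = cycle-inseparable c , λ K K-insep c⊑K →
      inseparable-⊑ c K K-insep (Adj⇒≢ G (step c i j ij)) (proj₁ c⊑K _ (vert⁺ c (i , refl))) (proj₁ c⊑K _ (vert⁺ c (j , refl)))
        (i , refl) (j , refl)
      where
      i = fromℕ< (<-trans z<s (3≤len c))
      j = proj₁ (next i)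
      ij = proj₂ (next i)

-- Distance along a cycle, and the projection of walks onto cycles.

module CyclicDistance where

  open import Data.Bool using (T?)
  open import Data.Fin as Fin using (Fin; zero; suc; toℕ; fromℕ<)
  import Data.Fin.Properties as Fin
  open import Data.Nat
  open import Data.Nat.Divisibility using (_∣_; divides)
  open import Data.Nat.Properties
  open import Data.Product using (_×_; _,_; ∃; ∃₂; proj₁; proj₂)
  open import Data.Sum using (_⊎_; inj₁; inj₂)
  open import Relation.Binary.PropositionalEquality
  open import Relation.Nullary using (Dec; yes; no)
  open import Defs hiding (_≈_; _≤_; _+_; _*_; _-_; -_)
  open FiniteSums
  open Walks
  open CactusGraphs
  open CycleBlocks

  -- The shorter of the two arcs, on a cycle of length `s`, between positions whose indices differ
  -- by `D`.
  cyclic : ℕ → ℕ → ℕ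
  cyclic s D = D ⊓ (s ∸ D)

  private
    cyclic-lipschitz : ∀ s {D E} → D ≤ suc E → E ≤ suc D → cyclic s D ≤ suc (cyclic s E)
    cyclic-lipschitz s {D} {E} D≤ E≤ = ⊓-mono-≤ D≤ (begin
      s ∸ D              ≤⟨ suc[pred[n]]≥n (s ∸ D) ⟩
      suc (pred (s ∸ D)) ≡⟨ cong suc (pred[m∸n]≡m∸[1+n] s D) ⟩
      suc (s ∸ suc D)    ≤⟨ s≤s (∸-monoʳ-≤ s E≤) ⟩
      suc (s ∸ E)        ∎)
      where
      open ≤-Reasoning
      suc[pred[n]]≥n : ∀ n → n ≤ suc (pred n)
      suc[pred[n]]≥n zero    = z≤n
      suc[pred[n]]≥n (suc n) = ≤-refl

    ∣1+m-n∣≤ : ∀ m n → ∣ suc m - n ∣ ≤ suc ∣ m - n ∣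
    ∣1+m-n∣≤ m n = ≤-trans (∣-∣-triangle (suc m) m n) (≤-reflexive (cong (_+ ∣ m - n ∣) (trans (∣-∣-comm (suc m) m) (trans (cong (∣ m -_∣) (+-comm 1 m)) (∣m-m+n∣≡n m 1)))))

    ∣m-n∣≤ : ∀ m n → ∣ m - n ∣ ≤ suc ∣ suc m - n ∣
    ∣m-n∣≤ m n = ≤-trans (∣-∣-triangle m (suc m) n) (≤-reflexive (cong (_+ ∣ suc m - n ∣) (trans (cong (∣ m -_∣) (+-comm 1 m)) (∣m-m+n∣≡n m 1))))

    wrap-≤ : ∀ m n → m ⊓ suc n ≤ suc (n ⊓ suc m)
    wrap-≤ m n = ⊓-glb (m⊓n≤n m (suc n)) (≤-trans (m⊓n≤m m (suc n)) (m≤n+m m 2))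

  cyclic-step : ∀ {s} (b : Fin s) {i j : Fin s} → Next i j →
    cyclic s ∣ toℕ i - toℕ b ∣ ≤ suc (cyclic s ∣ toℕ j - toℕ b ∣) × cyclic s ∣ toℕ j - toℕ b ∣ ≤ suc (cyclic s ∣ toℕ i - toℕ b ∣)
  cyclic-step {s} b {i} {j} (inj₁ eq) rewrite sym eq =
    cyclic-lipschitz s (∣m-n∣≤ (toℕ i) (toℕ b)) (∣1+m-n∣≤ (toℕ i) (toℕ b)) ,
    cyclic-lipschitz s (∣1+m-n∣≤ (toℕ i) (toℕ b)) (∣m-n∣≤ (toℕ i) (toℕ b))
  -- Across the closing edge the index difference jumps, but each arc to `b` changes by one only:
  -- the lengths are `D` and `suc (toℕ b)` at `i`, and `suc D` and `toℕ b` at `j`.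
  cyclic-step {s} b {i} {j} (inj₂ (eq , eq′)) =
    subst₂ (λ x y → x ≤ suc y) (sym at-i) (sym at-j) (wrap-≤ D (toℕ b)) ,
    subst₂ (λ x y → y ≤ suc x) (sym at-i) (sym at-j) (wrap-≤ (toℕ b) D)
    where
    b≤i : toℕ b ≤ toℕ i
    b≤i = ≤-pred (≤-trans (Fin.toℕ<n b) (≤-reflexive (sym eq)))
    D = toℕ i ∸ toℕ b
    at-i : cyclic s ∣ toℕ i - toℕ b ∣ ≡ D ⊓ suc (toℕ b)
    at-i = trans (cong₂ cyclic (sym eq) (m≤n⇒∣n-m∣≡n∸m b≤i))
      (cong (D ⊓_) (trans (+-∸-assoc 1 (m∸n≤m (toℕ i) (toℕ b))) (cong suc (m∸[m∸n]≡n b≤i))))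
    at-j : cyclic s ∣ toℕ j - toℕ b ∣ ≡ toℕ b ⊓ suc D
    at-j = trans (cong₂ cyclic (sym eq) (cong (∣_- toℕ b ∣) eq′)) (cong (toℕ b ⊓_) (+-∸-assoc 1 b≤i))

  -- With `s` twice `h`, one of `b + h` and `b - h` is a position, and either has index difference
  -- `h` from `b`.
  antipode : ∀ {s} → 2 ∣ s → (b : Fin s) → ∃ λ a → s ≤ 2 * cyclic s ∣ toℕ a - toℕ b ∣
  antipode {s} (divides h eq) b = toFin (toℕ b + h <? s)
    where
    s≡h+h : s ≡ h + h
    s≡h+h = trans eq (trans (*-comm h 2) (cong (h +_) (+-identityʳ h)))
    far : ∀ (a : Fin s) → ∣ toℕ a - toℕ b ∣ ≡ h → s ≤ 2 * cyclic s ∣ toℕ a - toℕ b ∣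
    far a dist = ≤-reflexive (begin
      s                                  ≡⟨ trans eq (*-comm h 2) ⟩
      2 * h                              ≡⟨ cong (2 *_) (⊓-idem h) ⟨
      2 * (h ⊓ h)                        ≡⟨ cong (λ x → 2 * (h ⊓ x)) (trans (cong (_∸ h) s≡h+h) (m+n∸n≡m h h)) ⟨
      2 * cyclic s h                     ≡⟨ cong (λ x → 2 * cyclic s x) dist ⟨
      2 * cyclic s ∣ toℕ a - toℕ b ∣     ∎)
      where open ≡-Reasoning
    toFin : Dec (toℕ b + h < s) → ∃ λ a → s ≤ 2 * cyclic s ∣ toℕ a - toℕ b ∣
    toFin (yes lt) = a , far a (trans (cong (∣_- toℕ b ∣) (Fin.toℕ-fromℕ< lt)) (trans (∣-∣-comm (toℕ b + h) (toℕ b)) (∣m-m+n∣≡n (toℕ b) h)))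
      where a = fromℕ< lt
    toFin (no ≮s) = a , far a (trans (cong (∣_- toℕ b ∣) (Fin.toℕ-fromℕ< lt))
        (trans (m≤n⇒∣m-n∣≡n∸m (m∸n≤m (toℕ b) h)) (m∸[m∸n]≡n h≤b)))
      where
      h≤b : h ≤ toℕ b
      h≤b = +-cancelʳ-≤ h h (toℕ b) (≤-trans (≤-reflexive (sym s≡h+h)) (≮⇒≥ ≮s))
      lt : toℕ b ∸ h < s
      lt = ≤-<-trans (m∸n≤m (toℕ b) h) (Fin.toℕ<n b)
      a = fromℕ< lt

  module _ {n} {G : Graph n} (c : Cycle G) where

    private
      ordered-distance : ∀ {l a b} → (∀ l′ → Walk (Adj G) (at c a) (at c b) l′ → l ≤ l′) →
        toℕ a ≤ toℕ b → l ≤ cyclic (len c) (toℕ b ∸ toℕ a)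
      ordered-distance {a = a} {b} shortest a≤b = ⊓-glb
        (shortest _ (inner-arc c a b a≤b λ t t′ tt′ _ _ → step c t t′ tt′))
        (≤-trans (shortest _ (outer-arc c (Adj-sym G) a b λ t t′ tt′ _ _ → step c t t′ tt′))
          (≤-reflexive (outer-arc-length c a b a≤b)))

    -- Both arcs are walks. It serves to bound the cyclic distance from below: longitudinal symmetry
    -- places two articulation points of `c` at distance `len c / 2` in `G`, so their positions must
    -- be antipodal.
    distance≤cyclic : ∀ a b {l} → IsDistance G (at c a) (at c b) l → l ≤ cyclic (len c) ∣ toℕ a - toℕ b ∣
    distance≤cyclic a b {l} (_ , shortest) with ≤-total (toℕ a) (toℕ b)
    ... | inj₁ a≤b = subst (λ x → l ≤ cyclic (len c) x) (sym (m≤n⇒∣m-n∣≡n∸m a≤b)) (ordered-distance shortest a≤b)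
    ... | inj₂ b≤a = subst (λ x → l ≤ cyclic (len c) x) (sym (m≤n⇒∣n-m∣≡n∸m b≤a))
                       (ordered-distance (λ l′ p → shortest l′ (reverse (Adj-sym G) p)) b≤a)

  module CycleSteps {n k} {G : Graph n} (cactus : IsCactus G) (nontrivial : IsNontrivial G)
    (counted : HasCycleCount G k) where

    open CountedCycles cactus nontrivial counted

    steps : Fin k → ∀ {u v m} → Walk (Adj G) u v m → ℕ
    steps i []                    = 0
    steps i (_∷_ {u} {v} e p) = 𝟙 (CycleEdge? (C i) u v) + steps i p

    sum-steps : ∀ {u v m} (p : Walk (Adj G) u v m) → sum (λ i → steps i p) ≡ m
    sum-steps []                    = sum-zero {k} _ (λ _ → refl)
    sum-steps (_∷_ {u} {v} e p) = trans (∑-distrib-+ (λ i → 𝟙 (CycleEdge? (C i) u v)) (λ i → steps i p))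
      (cong₂ _+_ (trans (sym (adj-sum u v)) (𝟙-yes (T? (adj G u v)) e)) (sum-steps p))

    -- The position `a` is the projection of the current vertex. A step off `C i` leaves it in
    -- place; a step along `C i` moves it by one position, which changes its cyclic distance to `b`
    -- by at most one.
    steps≥cyclic : ∀ i {x y m} (p : Walk (Adj G) x y m) {a b} →
      Joined (Off (C i)) x (at (C i) a) → Joined (Off (C i)) y (at (C i) b) →
      cyclic (len (C i)) ∣ toℕ a - toℕ b ∣ ≤ steps i p
    steps≥cyclic i [] {a} {b} x~a x~b = ≤-trans (m⊓n≤m _ _) (≤-reflexive (m≡n⇒∣m-n∣≡0 (cong toℕ a≡b)))
      where
      a≡b : a ≡ b
      a≡b = injective (C i) (attachment-unique (C i) (a , refl) (b , refl) (join (join-sym (Off-sym (C i)) x~a) x~b))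
    steps≥cyclic i (_∷_ {x} {x′} e p) {a} {b} x~a y~b with CycleEdge? (C i) x x′
    ... | no ¬e = steps≥cyclic i p (join (edge-join (Off-sym (C i) (e , ¬e))) x~a) y~b
    ... | yes (i′ , j′ , near , refl , refl) = ≤-trans
        (subst (λ t → cyclic (len (C i)) ∣ toℕ t - toℕ b ∣ ≤ _) i′≡a (lipschitz near))
        (s≤s (steps≥cyclic i p (_ , []) y~b))
      where
      i′≡a : i′ ≡ a
      i′≡a = injective (C i) (attachment-unique (C i) (i′ , refl) (a , refl) x~a)
      lipschitz : Next i′ j′ ⊎ Next j′ i′ →
        cyclic (len (C i)) ∣ toℕ i′ - toℕ b ∣ ≤ suc (cyclic (len (C i)) ∣ toℕ j′ - toℕ b ∣)
      lipschitz (inj₁ ij) = proj₁ (cyclic-step b ij)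
      lipschitz (inj₂ ji) = proj₂ (cyclic-step b ji)

    Opposite : Fin k → Fin n → Fin n → Set
    Opposite i x y = ∃₂ λ a b → Joined (Off (C i)) x (at (C i) a) × Joined (Off (C i)) y (at (C i) b)
                              × len (C i) ≤ 2 * cyclic (len (C i)) ∣ toℕ a - toℕ b ∣

    Opposite-sym : ∀ {i x y} → Opposite i x y → Opposite i y x
    Opposite-sym {i} (a , b , p , q , far) = b , a , q , p ,
      subst (λ d → len (C i) ≤ 2 * cyclic (len (C i)) d) (∣-∣-comm (toℕ a) (toℕ b)) far

    size≤2*walk : ∀ {x y m} → (∀ i → Opposite i x y) → Walk (Adj G) x y m → size ≤ 2 * m
    size≤2*walk {m = m} opposite p = begin
      sum (λ i → len (C i))       ≤⟨ sum-mono far ⟩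
      sum (λ i → 2 * steps i p)   ≡⟨ *-distribˡ-sum 2 (λ i → steps i p) ⟨
      2 * sum (λ i → steps i p)   ≡⟨ cong (2 *_) (sum-steps p) ⟩
      2 * m                       ∎
      where
      open ≤-Reasoning
      far : ∀ i → len (C i) ≤ 2 * steps i p
      far i with opposite i
      ... | a , b , x~a , y~b , far = ≤-trans far (*-monoʳ-≤ 2 (steps≥cyclic i p x~a y~b))

-- The equality case: degrees and diameter when the BC-tree is a path.

module BlockPath where

  open import Data.Bool using (T)
  open import Data.Fin as Fin using (Fin; zero; suc; toℕ; fromℕ<)
  import Data.Fin.Properties as Fin
  open import Data.Nat
  open import Data.Nat.DivMod using (m*n/n≡m)
  open import Data.Nat.Divisibility using (divides)
  open import Data.Nat.Properties
  open import Data.Product using (_×_; _,_; ∃; ∃₂; proj₁; proj₂)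
  open import Data.Sum using (_⊎_; inj₁; inj₂)
  open import Data.Unit using (tt)
  open import Function using (_∘_; _⇔_; Equivalence; mk⇔)
  open import Relation.Binary.PropositionalEquality
  open import Relation.Nullary using (¬_; Dec; yes; no; contradiction)
  open import Relation.Nullary.Decidable using (_×-dec_; ¬?)
  open import Defs hiding (_≈_; _≤_; _+_; _*_; _-_; -_)
  open FiniteSums
  open Walks
  open CactusGraphs
  open CycleBlocks

  open CyclicDistance

  module Chain {n k} {G : Graph n} (cactus : IsCactus G) (nontrivial : IsNontrivial G)
    (counted : HasCycleCount G k) (path : BCTreeIsPath G) (symmetric : IsLongitudinallySymmetric G) where

    open CountedCycles cactus nontrivial counted
    open CycleSteps cactus nontrivial counted
    open Blocks cactus

    last-position : ℕ
    last-position = proj₁ path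

    x : Fin (suc last-position) → BCNode G
    x = proj₁ (proj₂ path)

    x-injective : ∀ {p q} → x p ≈ᴮ x q → p ≡ q
    x-injective = proj₁ (proj₂ (proj₂ path))

    position : ∀ (X : BCNode G) → ∃ λ p → x p ≈ᴮ X
    position = proj₁ (proj₂ (proj₂ (proj₂ path)))

    x-adjacent : ∀ p q → BCAdj (x p) (x q) ⇔ (suc (toℕ p) ≡ toℕ q ⊎ suc (toℕ q) ≡ toℕ p)
    x-adjacent = proj₂ (proj₂ (proj₂ (proj₂ path)))

    node : Fin k → BCNode G
    node i = block (cycleSubgraph (C i)) (cycle-block (C i))

    pos : Fin k → Fin (suc last-position)
    pos i = proj₁ (position (node i))

    pos-node : ∀ i → x (pos i) ≈ᴮ node i
    pos-node i = proj₂ (position (node i))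

    ⊑-trans : {H K L : Subgraph G} → H ⊑ K → K ⊑ L → H ⊑ L
    ⊑-trans (a , b) (c , d) = (λ v → c v ∘ a v) , (λ u v → d u v ∘ b u v)

    ≈-node-trans : ∀ (X Y : BCNode G) {i} → X ≈ᴮ node i → Y ≈ᴮ node i → X ≈ᴮ Y
    ≈-node-trans (block H _) (block K _) {i} (H⊑ , ⊑H) (K⊑ , ⊑K) =
      ⊑-trans {H} {cycleSubgraph (C i)} {K} H⊑ ⊑K , ⊑-trans {K} {cycleSubgraph (C i)} {H} K⊑ ⊑H

    ≈-artic-trans : ∀ (X Y : BCNode G) {v : Fin n} {a : ArticulationPoint G v} → X ≈ᴮ artic v a → Y ≈ᴮ artic v a → X ≈ᴮ Y
    ≈-artic-trans (artic _ _) (artic _ _) p q = trans p (sym q)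

    nodes-distinct : ∀ (X : BCNode G) {i j} → X ≈ᴮ node i → X ≈ᴮ node j → i ≡ j
    nodes-distinct (block H _) {i} {j} (H⊑i , i⊑H) (H⊑j , j⊑H) = C-injective λ u v → mk⇔
      (λ e → edge⁻ (C j) (proj₂ H⊑j u v (proj₂ i⊑H u v (edge⁺ (C i) e))))
      (λ e → edge⁻ (C i) (proj₂ H⊑i u v (proj₂ j⊑H u v (edge⁺ (C j) e))))

    pos-injective : ∀ {i j} → pos i ≡ pos j → i ≡ j
    pos-injective {i} {j} eq = nodes-distinct (x (pos i)) (pos-node i) (subst (λ p → x p ≈ᴮ node j) (sym eq) (pos-node j))

    -- A decidable condition that implies `ArticulationPoint` and picks out the vertices of degree
    -- above 2.
    Shared : Fin n → Set
    Shared v = ∃₂ λ i j → i ≢ j × v ∈ᶜ C i × v ∈ᶜ C j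

    Shared? : ∀ v → Dec (Shared v)
    Shared? v = Fin.any? λ i → Fin.any? λ j → ¬? (i Fin.≟ j) ×-dec ((v ∈ᶜ? C i) ×-dec (v ∈ᶜ? C j))

    neighbour : (c : Cycle G) → ∀ {v} → v ∈ᶜ c → ∃ λ w → CycleEdge c v w
    neighbour c (p , refl) = _ , next-edge c (proj₂ (next p))

    -- Take neighbours `u` and `w` of `v` along `C i` and `C j`. The edge `vw` is off `C i`, so `w`
    -- is attached to `C i` at `v`, and every walk from `w` to `u` passes through `v`.
    shared⇒articulation : ∀ {v} → Shared v → ArticulationPoint G v
    shared⇒articulation {v} (i , j , i≢j , v∈i , v∈j) with neighbour (C i) v∈i | neighbour (C j) v∈j
    ... | u , vu | w , vw = tt , w , u , (tt , Adj⇒≢ G (CycleEdge⇒Adj (C j) vw) ∘ sym) , (tt , u≢v) , λ (_ , p) →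
        u≢v (attachment-unique (C i) (CycleEdge⇒∈ʳ (C i) vu) v∈i (attachment-blocks (C i) v∈i w~v p))
      where
      u≢v = Adj⇒≢ G (CycleEdge⇒Adj (C i) vu) ∘ sym
      w~v : Joined (Off (C i)) w v
      w~v = edge-join (Off-sym (C i) (CycleEdge⇒Adj (C j) vw , λ e → i≢j (edge-cycle-unique e vw)))

    node-artic-adjacent : ∀ (X Y : BCNode G) {i} {v : Fin n} {a : ArticulationPoint G v} → X ≈ᴮ node i → Y ≈ᴮ artic v a → v ∈ᶜ C i → BCAdj X Y
    node-artic-adjacent (block K _) (artic _ _) {i} (_ , ⊑K) refl v∈ = proj₁ ⊑K _ (vert⁺ (C i) v∈)

    -- The cycles through `v` are blocks adjacent to `v` in the BC-tree, and a path has at most one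
    -- node just before and one just after a given node.
    cyclesAt≤2 : ∀ {v} → ArticulationPoint G v → cyclesAt v ≤ 2
    cyclesAt≤2 {v} a = begin
      sum (λ i → 𝟙 (v ∈ᶜ? C i))                            ≤⟨ sum-mono beside ⟩
      sum (λ i → 𝟙 (before? i) + 𝟙 (after? i))             ≡⟨ ∑-distrib-+ (λ i → 𝟙 (before? i)) (λ i → 𝟙 (after? i)) ⟩
      sum (λ i → 𝟙 (before? i)) + sum (λ i → 𝟙 (after? i)) ≤⟨ +-mono-≤
          (sum≤1 before? λ i j p q → pos-injective (Fin.toℕ-injective (suc-injective (trans p (sym q)))))
          (sum≤1 after? λ i j p q → pos-injective (Fin.toℕ-injective (trans (sym p) q))) ⟩
      2                                                    ∎
      where
      open ≤-Reasoning
      q = proj₁ (position (artic v a))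
      before? : ∀ i → Dec (suc (toℕ (pos i)) ≡ toℕ q)
      before? i = suc (toℕ (pos i)) ≟ toℕ q
      after? : ∀ i → Dec (suc (toℕ q) ≡ toℕ (pos i))
      after? i = suc (toℕ q) ≟ toℕ (pos i)
      beside : ∀ i → 𝟙 (v ∈ᶜ? C i) ≤ 𝟙 (before? i) + 𝟙 (after? i)
      beside i with v ∈ᶜ? C i
      ... | no _ = z≤n
      ... | yes v∈ with Equivalence.to (x-adjacent (pos i) q)
                          (node-artic-adjacent (x (pos i)) (x q) (pos-node i) (proj₂ (position (artic v a))) v∈)
      ...   | inj₁ p = ≤-trans (≤-reflexive (sym (𝟙-yes (before? i) p))) (m≤m+n _ _)
      ...   | inj₂ p = ≤-trans (≤-reflexive (sym (𝟙-yes (after? i) p))) (m≤n+m _ _)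

    shared⇒cyclesAt≡2 : ∀ {v} → Shared v → cyclesAt v ≡ 2
    shared⇒cyclesAt≡2 {v} s@(i , j , i≢j , v∈i , v∈j) = ≤-antisym (cyclesAt≤2 (shared⇒articulation s))
      (≤-trans (≤-reflexive (sym (cong₂ _+_ (𝟙-yes (v ∈ᶜ? C i) v∈i) (𝟙-yes (v ∈ᶜ? C j) v∈j))))
        (two-terms≤sum (λ i → 𝟙 (v ∈ᶜ? C i)) i≢j))

    unshared⇒cyclesAt≤1 : ∀ {v} → ¬ Shared v → cyclesAt v ≤ 1
    unshared⇒cyclesAt≤1 {v} ¬s = sum≤1 (λ i → v ∈ᶜ? C i) same
      where
      same : ∀ i j → v ∈ᶜ C i → v ∈ᶜ C j → i ≡ j
      same i j v∈i v∈j with i Fin.≟ j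
      ... | yes i≡j = i≡j
      ... | no i≢j  = contradiction (i , j , i≢j , v∈i , v∈j) ¬s

    half-length : (c : Cycle G) → len c ≡ 2 * (len c / 2)
    half-length c with len c | proj₁ (symmetric c)
    ... | _ | divides h refl = trans (*-comm h 2) (cong (2 *_) (sym (m*n/n≡m h 2)))

    -- Two adjacent articulation points lie on a common cycle at distance half its length, which
    -- would then be at most 2.
    shared-nonadjacent : ∀ {u v} → Adj G u v → Shared u → ¬ Shared v
    shared-nonadjacent {u} {v} uv su sv with edge-cycle uv
    ... | i , e = <⇒≱ (3≤len (C i)) (≤-trans (≤-reflexive (half-length (C i))) (*-monoʳ-≤ 2
        (proj₂ (proj₂ (symmetric (C i)) u v (shared⇒articulation su) (shared⇒articulation sv)
          (CycleEdge⇒∈ˡ (C i) e) (CycleEdge⇒∈ʳ (C i) e) (Adj⇒≢ G uv)) 1 (uv ∷ []))))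

    At : BCNode G → Fin n → Set
    At (block H _) v = Vert H v
    At (artic a _) v = v ≡ a

    at-node : ∀ (X : BCNode G) {i v} → X ≈ᴮ node i → v ∈ᶜ C i → At X v
    at-node (block H _) {i} (_ , ⊑H) v∈ = proj₁ ⊑H _ (vert⁺ (C i) v∈)

    at-artic : ∀ (X : BCNode G) {v : Fin n} {a : ArticulationPoint G v} → X ≈ᴮ artic v a → At X v
    at-artic (artic _ _) eq = sym eq

    inhabited : ∀ (X : BCNode G) → ∃ (At X)
    inhabited (block H ((H-connected , _) , _)) = proj₁ H-connected
    inhabited (artic a _) = a , refl

    -- A block with an edge of `C i` lies inside `C i` by `inseparable-⊑` and equals it by
    -- maximality. Every other block is therefore connected without the edges of `C i`.
    node-joined : ∀ {i} X → ¬ X ≈ᴮ node i → ∀ {u v} → At X u → At X v → Joined (Off (C i)) u v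
    node-joined (artic _ _) _ refl refl = _ , []
    node-joined {i} (block H (H-insep , H-max)) H≉ {u} {v} u∈ v∈ = map-join off (proj₂ (proj₁ H-insep) u v u∈ v∈)
      where
      off : ∀ {x y} → Edge H x y → Off (C i) x y
      off {x} {y} e = edge⇒adj H x y e , λ xy → H≉
        let H⊑ = inseparable-⊑ (C i) H H-insep (Adj⇒≢ G (edge⇒adj H x y e)) (edge⇒vert H x y e)
                   (edge⇒vert H y x (subst T (edge-sym H x y) e)) (CycleEdge⇒∈ˡ (C i) xy) (CycleEdge⇒∈ʳ (C i) xy)
        in H⊑ , H-max (cycleSubgraph (C i)) (cycle-inseparable (C i)) H⊑

    position-joined : ∀ {i q} → q ≢ pos i → ∀ {u v} → At (x q) u → At (x q) v → Joined (Off (C i)) u v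
    position-joined {i} {q} q≢ = node-joined (x q) λ eq → q≢ (x-injective (≈-node-trans (x q) (x (pos i)) eq (pos-node i)))

    common : ∀ (X Y : BCNode G) → BCAdj X Y → ∃ λ v → At X v × At Y v
    common (block H _) (artic v _) v∈ = v , v∈ , refl
    common (artic v _) (block H _) v∈ = v , refl , v∈

    -- Consecutive nodes have a common vertex, so a stretch of the path that leaves out the node of
    -- `C i` hangs together off `C i` and projects to a single vertex of it.
    stretch-joined : ∀ {i} l q q′ → toℕ q′ ≡ l + toℕ q → (∀ t → toℕ q ≤ toℕ t → toℕ t ≤ toℕ q′ → t ≢ pos i) →
      ∀ {u v} → At (x q) u → At (x q′) v → Joined (Off (C i)) u v
    stretch-joined zero q q′ eq t≢ {u} {v} u∈ v∈ = position-joined (t≢ q ≤-refl (≤-reflexive (sym eq))) u∈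
      (subst (λ t → At (x t) v) (Fin.toℕ-injective eq) v∈)
    stretch-joined {i} (suc l) q q′ eq t≢ {u} {v} u∈ v∈ = continue
      (common (x q) (x q⁺) (Equivalence.from (x-adjacent q q⁺) (inj₁ (sym q⁺-eq))))
      where
      q<q′ : toℕ q < toℕ q′
      q<q′ = subst (toℕ q <_) (sym eq) (s≤s (m≤n+m (toℕ q) l))
      q⁺ = fromℕ< (≤-<-trans q<q′ (Fin.toℕ<n q′))
      q⁺-eq : toℕ q⁺ ≡ suc (toℕ q)
      q⁺-eq = Fin.toℕ-fromℕ< (≤-<-trans q<q′ (Fin.toℕ<n q′))
      continue : (∃ λ w → At (x q) w × At (x q⁺) w) → Joined (Off (C i)) u v
      continue (w , w∈ , w∈⁺) = join (position-joined (t≢ q ≤-refl (<⇒≤ q<q′)) u∈ w∈)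
        (stretch-joined l q⁺ q′ (trans eq (trans (sym (+-suc l (toℕ q))) (cong (l +_) (sym q⁺-eq))))
          (λ t q⁺≤t → t≢ t (≤-trans (n≤1+n _) (subst (_≤ toℕ t) q⁺-eq q⁺≤t))) w∈⁺ v∈)

    -- From z, go to the far side of the cycle at position q if there is one.
    endpoint : ∀ q z → ∃ λ y → At (x q) y × (∀ i → pos i ≡ q → Opposite i y z)
    endpoint q z with Fin.any? (λ i → pos i Fin.≟ q)
    ... | no ¬∃ = let (y , y∈) = inhabited (x q) in y , y∈ , λ i eq → contradiction (i , eq) ¬∃
    ... | yes (i , refl) with attachment (C i) z
    ...   | _ , (b , refl) , z~b = let (a , far) = antipode (proj₁ (symmetric (C i))) b in
        at (C i) a , at-node (x (pos i)) (pos-node i) (a , refl) , λ j eq →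
          subst (λ j → Opposite j (at (C i) a) z) (pos-injective (sym eq)) (a , b , (_ , []) , z~b , far)

    adjacent-articulation : ∀ (X Y : BCNode G) {i} → BCAdj X Y → Y ≈ᴮ node i → ∃₂ λ v a → v ∈ᶜ C i × X ≈ᴮ artic v a
    adjacent-articulation (artic v a) (block K _) {i} v∈ (K⊑ , _) = v , a , vert⁻ (C i) (proj₁ K⊑ v v∈) , refl

    final : Fin (suc last-position)
    final = Fin.fromℕ last-position

    -- The vertex `y₀` is chosen against an arbitrary vertex of the first node, and `x₀` then
    -- against `y₀`. If a cycle occupies the first node, also when that is the only one, this makes
    -- the two opposite on it. If the last node is a different one, all vertices of the first node
    -- have the same projection onto its cycle, so `y₀` is opposite to `x₀` as well.
    y₀ x₀ : Fin n
    y₀ = proj₁ (endpoint final (proj₁ (inhabited (x zero))))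
    x₀ = proj₁ (endpoint zero y₀)

    opposite-ends : ∀ i → Opposite i x₀ y₀
    opposite-ends i with pos i Fin.≟ zero | pos i Fin.≟ final
    ... | yes eq | _ = proj₂ (proj₂ (endpoint zero y₀)) i eq
    ... | no ≢0 | yes eq with proj₂ (proj₂ (endpoint final (proj₁ (inhabited (x zero))))) i eq
    ...   | b , a , y₀~b , z~a , far = Opposite-sym {i}
        (b , a , y₀~b , join (position-joined (≢0 ∘ sym) (proj₁ (proj₂ (endpoint zero y₀))) (proj₂ (inhabited (x zero)))) z~a , far)
    -- A cycle inside the path sits between two distinct articulation points. The stretches on its
    -- two sides attach `x₀` to one and `y₀` to the other, and by symmetry these are antipodal.
    opposite-ends i | no ≢0 | no ≢final = between
        (adjacent-articulation (x q⁻) (x p) (Equivalence.from (x-adjacent q⁻ p) (inj₁ q⁻-eq)) (pos-node i))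
        (adjacent-articulation (x q⁺) (x p) (Equivalence.from (x-adjacent q⁺ p) (inj₂ (sym q⁺-eq))) (pos-node i))
      where
      p = pos i
      0<p : 0 < toℕ p
      0<p = n≢0⇒n>0 (≢0 ∘ Fin.toℕ-injective)
      p<final : toℕ p < last-position
      p<final = ≤∧≢⇒< (≤-pred (Fin.toℕ<n p)) λ e → ≢final (Fin.toℕ-injective (trans e (sym (Fin.toℕ-fromℕ last-position))))
      q⁻ q⁺ : Fin (suc last-position)
      q⁻ = fromℕ< (≤-<-trans (pred[n]≤n {toℕ p}) (Fin.toℕ<n p))
      q⁺ = fromℕ< (s≤s p<final)
      q⁻-eq : suc (toℕ q⁻) ≡ toℕ p
      q⁻-eq = trans (cong suc (Fin.toℕ-fromℕ< _)) (suc-pred (toℕ p) {{>-nonZero 0<p}})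
      q⁺-eq : toℕ q⁺ ≡ suc (toℕ p)
      q⁺-eq = Fin.toℕ-fromℕ< (s≤s p<final)
      between : (∃₂ λ v a → v ∈ᶜ C i × x q⁻ ≈ᴮ artic v a) → (∃₂ λ v a → v ∈ᶜ C i × x q⁺ ≈ᴮ artic v a) → Opposite i x₀ y₀
      between (_ , v-artic , (a , refl) , q⁻≈v) (_ , w-artic , (b , refl) , q⁺≈w) =
        a , b
        , stretch-joined (toℕ q⁻) zero q⁻ (sym (+-identityʳ (toℕ q⁻)))
            (λ { t _ t≤q⁻ refl → <⇒≱ (≤-reflexive q⁻-eq) t≤q⁻ })
            (proj₁ (proj₂ (endpoint zero y₀))) (at-artic (x q⁻) q⁻≈v)
        , join-sym (Off-sym (C i)) (stretch-joined (toℕ final ∸ toℕ q⁺) q⁺ final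
            (sym (m∸n+n≡m (≤-trans (≤-reflexive q⁺-eq) (≤-trans p<final (≤-reflexive (sym (Fin.toℕ-fromℕ last-position)))))))
            (λ { t q⁺≤t _ refl → <⇒≱ (≤-reflexive (sym q⁺-eq)) q⁺≤t })
            (at-artic (x q⁺) q⁺≈w) (proj₁ (proj₂ (endpoint final (proj₁ (inhabited (x zero)))))))
        , ≤-trans (≤-reflexive (half-length (C i))) (*-monoʳ-≤ 2 (distance≤cyclic (C i) a b
            (proj₂ (symmetric (C i)) _ _ v-artic w-artic (a , refl) (b , refl) v≢w)))
        where
        v≢w : at (C i) a ≢ at (C i) b
        v≢w eq = <⇒≢ (<-trans (≤-reflexive q⁻-eq) (≤-reflexive (sym q⁺-eq)))
          (cong toℕ (x-injective (≈-artic-trans (x q⁻) (x q⁺) {a = w-artic}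
            (≈-artic-cast (x q⁻) eq q⁻≈v) q⁺≈w)))
          where
          ≈-artic-cast : ∀ (X : BCNode G) {v w : Fin n} {a : ArticulationPoint G v} {b : ArticulationPoint G w} → v ≡ w → X ≈ᴮ artic v a → X ≈ᴮ artic w b
          ≈-artic-cast (artic _ _) eq p = trans p eq

    size≤2*diameter : ∀ {d} → IsDiameter G d → size ≤ 2 * d
    size≤2*diameter (_ , maximal) with distance G (connected x₀ y₀)
    ... | m , shortest = ≤-trans (size≤2*walk opposite-ends (proj₁ shortest)) (*-monoʳ-≤ 2 (maximal x₀ y₀ m shortest))

-- The ordered ring of Cauchy reals.

module RealRing where

  open import Algebra.Bundles using (CommutativeRing)
  open import Algebra.Solver.Ring.AlmostCommutativeRing using (fromCommutativeRing; _-Raw-AlmostCommutative⟶_)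
  open import Data.Integer as ℤ using (+_)
  open import Data.Nat as ℕ using (ℕ)
  import Data.Nat.Properties as ℕ
  open import Data.Product using (∃-syntax; _,_)
  open import Data.Rational as ℚ using (ℚ; 0ℚ; ½)
  import Data.Rational.Properties as ℚ
  import Data.Rational.Solver as ℚ-Solver
  open import Data.Sum using (inj₁; inj₂)
  open import Level using (0ℓ)
  open import Relation.Binary.PropositionalEquality
  open import Defs

  Eventually : (ℕ → Set) → Set
  Eventually P = ∃[ N ] (∀ n → N ℕ.≤ n → P n)

  private
    variable
      P Q S : ℕ → Set

    always : (∀ n → P n) → Eventually P
    always f = 0 , λ n _ → f n

    both : Eventually P → Eventually Q → (∀ n → P n → Q n → S n) → Eventually S
    both (M , p) (N , q) f = M ℕ.⊔ N , λ n ≤n →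
      f n (p n (ℕ.m⊔n≤o⇒m≤o M N ≤n)) (q n (ℕ.m⊔n≤o⇒n≤o M N ≤n))

    ∣p-q∣≤⇒≤ : ∀ {p q ε} → ℚ.∣ p ℚ.- q ∣ ℚ.≤ ε → p ℚ.≤ q ℚ.+ ε
    ∣p-q∣≤⇒≤ {p} {q} {ε} h = begin
      p                        ≡⟨ solve 2 (λ p q → p := q :+ (p :- q)) refl p q ⟩
      q ℚ.+ (p ℚ.- q)          ≤⟨ ℚ.+-monoʳ-≤ q (ℚ.≤-trans (p≤∣p∣ (p ℚ.- q)) h) ⟩
      q ℚ.+ ε                  ∎
      where
      open ℚ.≤-Reasoning
      open ℚ-Solver.+-*-Solver

    ≤⇒-≤ : ∀ {p q ε} → p ℚ.≤ q ℚ.+ ε → p ℚ.- q ℚ.≤ ε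
    ≤⇒-≤ {p} {q} {ε} h = begin
      p ℚ.- q            ≤⟨ ℚ.+-monoˡ-≤ (ℚ.- q) h ⟩
      q ℚ.+ ε ℚ.- q      ≡⟨ solve 2 (λ q ε → q :+ ε :- q := ε) refl q ε ⟩
      ε                  ∎
      where
      open ℚ.≤-Reasoning
      open ℚ-Solver.+-*-Solver

    -[p-q]≡q-p : ∀ p q → ℚ.- (p ℚ.- q) ≡ q ℚ.- p
    -[p-q]≡q-p = solve 2 (λ p q → :- (p :- q) := q :- p) refl
      where open ℚ-Solver.+-*-Solver

    +-interchange : ∀ a b c d → (a ℚ.+ b) ℚ.+ (c ℚ.+ d) ≡ (a ℚ.+ c) ℚ.+ (b ℚ.+ d)
    +-interchange = solve 4 (λ a b c d → (a :+ b) :+ (c :+ d) := (a :+ c) :+ (b :+ d)) refl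
      where open ℚ-Solver.+-*-Solver

  ≤⇒∣p-q∣≤ : ∀ {p q ε} → p ℚ.≤ q ℚ.+ ε → q ℚ.≤ p ℚ.+ ε → ℚ.∣ p ℚ.- q ∣ ℚ.≤ ε
  ≤⇒∣p-q∣≤ {p} {q} {ε} h h′ = ∣p∣≤ (≤⇒-≤ h) (subst (ℚ._≤ ε) (sym (-[p-q]≡q-p p q)) (≤⇒-≤ h′))

  abstract
    ≈⇒≤ : ∀ {x y} → x ≈ y → x ≤ y
    ≈⇒≤ x≈y ε ε>0 = let (N , h) = x≈y ε ε>0 in N , λ n N≤n → ∣p-q∣≤⇒≤ (h n N≤n)

    ≤-antisym : ∀ {x y} → x ≤ y → y ≤ x → x ≈ y
    ≤-antisym x≤y y≤x ε ε>0 = both (x≤y ε ε>0) (y≤x ε ε>0) λ _ → ≤⇒∣p-q∣≤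

    pointwise : ∀ {x y} → (∀ n → seq x n ≡ seq y n) → x ≈ y
    pointwise {x} {y} eq ε ε>0 = always λ n →
      subst (λ z → ℚ.∣ z ∣ ℚ.≤ ε) (sym (trans (cong (ℚ._- seq y n) (eq n)) (ℚ.+-inverseʳ (seq y n)))) (ℚ.<⇒≤ ε>0)

    ≤-pointwise : ∀ {x y} → (∀ n → seq x n ℚ.≤ seq y n) → x ≤ y
    ≤-pointwise {x} {y} le ε ε>0 = always λ n →
      ℚ.≤-trans (le n) (subst (ℚ._≤ seq y n ℚ.+ ε) (ℚ.+-identityʳ (seq y n)) (ℚ.+-monoʳ-≤ (seq y n) (ℚ.<⇒≤ ε>0)))

    ≈-refl : ∀ {x} → x ≈ x
    ≈-refl {x} = pointwise {x} {x} λ _ → refl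

    ≈-sym : ∀ {x y} → x ≈ y → y ≈ x
    ≈-sym {x} {y} x≈y ε ε>0 = let (N , h) = x≈y ε ε>0 in
      N , λ n N≤n → subst (ℚ._≤ ε) (∣p-q∣≡∣q-p∣ (seq x n) (seq y n)) (h n N≤n)

    ≤-trans : ∀ {x y z} → x ≤ y → y ≤ z → x ≤ z
    ≤-trans {x} {y} {z} x≤y y≤z ε ε>0 = both (x≤y _ (half-pos ε>0)) (y≤z _ (half-pos ε>0)) λ n p q → begin
      seq x n                                ≤⟨ p ⟩
      seq y n ℚ.+ ½ ℚ.* ε                    ≤⟨ ℚ.+-monoˡ-≤ (½ ℚ.* ε) q ⟩
      seq z n ℚ.+ ½ ℚ.* ε ℚ.+ ½ ℚ.* ε        ≡⟨ trans (ℚ.+-assoc (seq z n) _ _) (cong (seq z n ℚ.+_) (halves ε)) ⟩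
      seq z n ℚ.+ ε                          ∎
      where open ℚ.≤-Reasoning

    ≈-trans : ∀ {x y z} → x ≈ y → y ≈ z → x ≈ z
    ≈-trans {x} {y} {z} p q = ≤-antisym {x} {z}
      (≤-trans {x} {y} {z} (≈⇒≤ {x} {y} p) (≈⇒≤ {y} {z} q))
      (≤-trans {z} {y} {x} (≈⇒≤ {z} {y} (≈-sym {y} {z} q)) (≈⇒≤ {y} {x} (≈-sym {x} {y} p)))

    +-mono-≤ : ∀ {w x y z} → w ≤ x → y ≤ z → w + y ≤ x + z
    +-mono-≤ {w} {x} {y} {z} w≤x y≤z ε ε>0 = both (w≤x _ (half-pos ε>0)) (y≤z _ (half-pos ε>0)) λ n p q → begin
      seq w n ℚ.+ seq y n                                        ≤⟨ ℚ.+-mono-≤ p q ⟩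
      (seq x n ℚ.+ ½ ℚ.* ε) ℚ.+ (seq z n ℚ.+ ½ ℚ.* ε)            ≡⟨ +-interchange (seq x n) _ (seq z n) _ ⟩
      (seq x n ℚ.+ seq z n) ℚ.+ (½ ℚ.* ε ℚ.+ ½ ℚ.* ε)            ≡⟨ cong (seq x n ℚ.+ seq z n ℚ.+_) (halves ε) ⟩
      seq x n ℚ.+ seq z n ℚ.+ ε                                  ∎
      where open ℚ.≤-Reasoning

    +-cong : ∀ {w x y z} → w ≈ x → y ≈ z → w + y ≈ x + z
    +-cong {w} {x} {y} {z} p q = ≤-antisym {w + y} {x + z}
      (+-mono-≤ {w} {x} {y} {z} (≈⇒≤ {w} {x} p) (≈⇒≤ {y} {z} q))
      (+-mono-≤ {x} {w} {z} {y} (≈⇒≤ {x} {w} (≈-sym {w} {x} p)) (≈⇒≤ {z} {y} (≈-sym {y} {z} q)))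

    -‿cong : ∀ {x y} → x ≈ y → - x ≈ - y
    -‿cong {x} {y} p ε ε>0 = let (N , h) = p ε ε>0 in N , λ n N≤n →
      subst (ℚ._≤ ε) (trans (∣p-q∣≡∣q-p∣ (seq x n) (seq y n)) (cong ℚ.∣_∣ (lem (seq x n) (seq y n)))) (h n N≤n)
      where
      open ℚ-Solver.+-*-Solver
      lem : ∀ a b → b ℚ.- a ≡ ℚ.- a ℚ.- (ℚ.- b)
      lem = solve 2 (λ a b → b :- a := :- a :- (:- b)) refl

  private
    scaled : ℚ → ℚ → ℚ
    scaled ε B = ε ℚ.* inv B

    scaled-pos : ∀ {ε B} → 0ℚ ℚ.< ε → 0ℚ ℚ.< B → 0ℚ ℚ.< scaled ε B
    scaled-pos ε>0 B>0 = *-pos ε>0 (inv-pos B>0)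

    scaled-cancel : ∀ {ε B} → 0ℚ ℚ.< B → B ℚ.* scaled ε B ≡ ε
    scaled-cancel {ε} {B} B>0 = trans (solve 3 (λ b e i → b :* (e :* i) := e :* (b :* i)) refl B ε (inv B))
      (trans (cong (ε ℚ.*_) (inv-inverseʳ B>0)) (ℚ.*-identityʳ ε))
      where open ℚ-Solver.+-*-Solver

    ∣*∣≤ : ∀ {p q ε B} → 0ℚ ℚ.< B → ℚ.∣ p ∣ ℚ.≤ B → ℚ.∣ q ∣ ℚ.≤ scaled ε B → ℚ.∣ p ℚ.* q ∣ ℚ.≤ ε
    ∣*∣≤ {p} {q} {ε} {B} B>0 p≤ q≤ = begin
      ℚ.∣ p ℚ.* q ∣             ≡⟨ ℚ.∣p*q∣≡∣p∣*∣q∣ p q ⟩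
      ℚ.∣ p ∣ ℚ.* ℚ.∣ q ∣       ≤⟨ *-mono-≤ (ℚ.0≤∣p∣ q) (ℚ.<⇒≤ B>0) p≤ q≤ ⟩
      B ℚ.* scaled ε B          ≡⟨ scaled-cancel B>0 ⟩
      ε                         ∎
      where open ℚ.≤-Reasoning

  abstract
    -- A bounded sequence times a null sequence is null.
    *-congʳ : ∀ {x y z} → y ≈ z → x * y ≈ x * z
    *-congʳ {x} {y} {z} y≈z ε ε>0 = let (B , N , B>0 , x≤B) = bounded x in
      both (N , x≤B) (y≈z _ (scaled-pos ε>0 B>0)) λ n p q →
        subst (λ t → ℚ.∣ t ∣ ℚ.≤ ε) (lem (seq x n) (seq y n) (seq z n)) (∣*∣≤ B>0 p q)
      where
      open ℚ-Solver.+-*-Solver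
      lem : ∀ a b c → a ℚ.* (b ℚ.- c) ≡ a ℚ.* b ℚ.- a ℚ.* c
      lem = solve 3 (λ a b c → a :* (b :- c) := a :* b :- a :* c) refl

    *-comm : ∀ x y → x * y ≈ y * x
    *-comm x y = pointwise {x * y} {y * x} λ n → ℚ.*-comm (seq x n) (seq y n)

    *-cong : ∀ {w x y z} → w ≈ x → y ≈ z → w * y ≈ x * z
    *-cong {w} {x} {y} {z} p q = ≈-trans {w * y} {w * z} {x * z} (*-congʳ {w} {y} {z} q)
      (≈-trans {w * z} {z * w} {x * z} (*-comm w z) (≈-trans {z * w} {z * x} {x * z} (*-congʳ {z} {w} {x} p) (*-comm z x)))

    -- The hypothesis `0ℝ ≤ x` says only that the terms are eventually at least `-δ`, for each
    -- positive `δ`, so the terms of the product may have either sign. Here `δ` is `ε` divided by a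
    -- bound for the other factor.
    *-nonneg : ∀ {x y} → 0ℝ ≤ x → 0ℝ ≤ y → 0ℝ ≤ x * y
    *-nonneg {x} {y} x≥0 y≥0 ε ε>0 =
      let (A , K , A>0 , x≤A) = bounded x
          (B , L , B>0 , y≤B) = bounded y
      in both (both (K , x≤A) (L , y≤B) λ _ → _,_)
              (both (x≥0 _ (scaled-pos ε>0 B>0)) (y≥0 _ (scaled-pos ε>0 A>0)) λ _ → _,_)
              λ n (x≤ , y≤) (x≥ , y≥) → product (seq x n) (seq y n) A>0 B>0 x≤ y≤ x≥ y≥
      where
      -- Only a factor that is negative, hence small, can make the product negative.
      small : ∀ {p δ} → p ℚ.≤ 0ℚ → 0ℚ ℚ.≤ p ℚ.+ δ → ℚ.∣ p ∣ ℚ.≤ δ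
      small {p} {δ} p≤0 h = ∣p∣≤
        (ℚ.≤-trans p≤0 (ℚ.≤-trans h (subst (p ℚ.+ δ ℚ.≤_) (ℚ.+-identityˡ δ) (ℚ.+-monoˡ-≤ δ p≤0))))
        (subst₂ ℚ._≤_ (ℚ.+-identityʳ (ℚ.- p)) (lem p δ) (ℚ.+-monoʳ-≤ (ℚ.- p) h))
        where
        open ℚ-Solver.+-*-Solver
        lem : ∀ p δ → ℚ.- p ℚ.+ (p ℚ.+ δ) ≡ δ
        lem = solve 2 (λ p δ → :- p :+ (p :+ δ) := δ) refl
      from-∣∣ : ∀ {p} → ℚ.∣ p ∣ ℚ.≤ ε → 0ℚ ℚ.≤ p ℚ.+ ε
      from-∣∣ {p} h = begin
        0ℚ              ≡⟨ ℚ.+-inverseʳ p ⟨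
        p ℚ.- p         ≤⟨ ℚ.+-monoʳ-≤ p (ℚ.≤-trans (p≤∣p∣ (ℚ.- p)) (subst (ℚ._≤ ε) (sym (ℚ.∣-p∣≡∣p∣ p)) h)) ⟩
        p ℚ.+ ε         ∎
        where open ℚ.≤-Reasoning
      product : ∀ p q {A B} → 0ℚ ℚ.< A → 0ℚ ℚ.< B → ℚ.∣ p ∣ ℚ.≤ A → ℚ.∣ q ∣ ℚ.≤ B →
        0ℚ ℚ.≤ p ℚ.+ scaled ε B → 0ℚ ℚ.≤ q ℚ.+ scaled ε A → 0ℚ ℚ.≤ p ℚ.* q ℚ.+ ε
      product p q A>0 B>0 p≤A q≤B p≥ q≥ with ℚ.≤-total 0ℚ p | ℚ.≤-total 0ℚ q
      ... | inj₁ 0≤p | inj₁ 0≤q = ℚ.≤-trans (ℚ.<⇒≤ ε>0)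
            (subst (ℚ._≤ p ℚ.* q ℚ.+ ε) (ℚ.+-identityˡ ε) (ℚ.+-monoˡ-≤ ε
              (subst (ℚ._≤ p ℚ.* q) (ℚ.*-zeroʳ p) (ℚ.*-monoˡ-≤-nonNeg p {{ℚ.nonNegative 0≤p}} 0≤q))))
      ... | inj₂ p≤0 | _        = from-∣∣ (subst (λ t → ℚ.∣ t ∣ ℚ.≤ ε) (ℚ.*-comm q p) (∣*∣≤ B>0 q≤B (small p≤0 p≥)))
      ... | inj₁ _   | inj₂ q≤0 = from-∣∣ (∣*∣≤ A>0 p≤A (small q≤0 q≥))

    fromℚ-mono : ∀ {p q} → p ℚ.≤ q → fromℚ p ≤ fromℚ q
    fromℚ-mono {p} {q} p≤q = ≤-pointwise {fromℚ p} {fromℚ q} λ _ → p≤q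

  ℝ-commutativeRing : CommutativeRing 0ℓ 0ℓ
  ℝ-commutativeRing = record
    { Carrier = ℝ ; _≈_ = _≈_ ; _+_ = _+_ ; _*_ = _*_ ; -_ = -_ ; 0# = 0ℝ ; 1# = 1ℝ
    ; isCommutativeRing = record
      { isRing = record
        { +-isAbelianGroup = record
          { isGroup = record
            { isMonoid = record
              { isSemigroup = record
                { isMagma = record
                  { isEquivalence = record
                    { refl  = λ {x} → ≈-refl {x}
                    ; sym   = λ {x} {y} → ≈-sym {x} {y}
                    ; trans = λ {x} {y} {z} → ≈-trans {x} {y} {z}
                    }
                  ; ∙-cong = λ {w} {x} {y} {z} → +-cong {w} {x} {y} {z}
                  }
                ; assoc = λ x y z → pointwise {x + y + z} {x + (y + z)} λ n → ℚ.+-assoc (seq x n) (seq y n) (seq z n)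
                }
              ; identity = (λ x → pointwise {0ℝ + x} {x} λ n → ℚ.+-identityˡ (seq x n))
                         , (λ x → pointwise {x + 0ℝ} {x} λ n → ℚ.+-identityʳ (seq x n))
              }
            ; inverse = (λ x → pointwise { - x + x} {0ℝ} λ n → ℚ.+-inverseˡ (seq x n))
                      , (λ x → pointwise {x + - x} {0ℝ} λ n → ℚ.+-inverseʳ (seq x n))
            ; ⁻¹-cong = λ {x} {y} → -‿cong {x} {y}
            }
          ; comm = λ x y → pointwise {x + y} {y + x} λ n → ℚ.+-comm (seq x n) (seq y n)
          }
        ; *-cong = λ {w} {x} {y} {z} → *-cong {w} {x} {y} {z}
        ; *-assoc = λ x y z → pointwise {x * y * z} {x * (y * z)} λ n → ℚ.*-assoc (seq x n) (seq y n) (seq z n)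
        ; *-identity = (λ x → pointwise {1ℝ * x} {x} λ n → ℚ.*-identityˡ (seq x n))
                     , (λ x → pointwise {x * 1ℝ} {x} λ n → ℚ.*-identityʳ (seq x n))
        ; distrib = (λ x y z → pointwise {x * (y + z)} {x * y + x * z} λ n → ℚ.*-distribˡ-+ (seq x n) (seq y n) (seq z n))
                  , (λ x y z → pointwise {(y + z) * x} {y * x + z * x} λ n → ℚ.*-distribʳ-+ (seq x n) (seq y n) (seq z n))
        }
      ; *-comm = *-comm
      }
    }

  -- Provides the ring solver with rational coefficients, whose equality is decidable.
  fromℚ-homomorphism : ℚ.+-*-rawRing -Raw-AlmostCommutative⟶ fromCommutativeRing ℝ-commutativeRing
  fromℚ-homomorphism = record
    { ⟦_⟧    = fromℚ
    ; +-homo = λ p q → pointwise {fromℚ (p ℚ.+ q)} {fromℚ p + fromℚ q} λ _ → refl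
    ; *-homo = λ p q → pointwise {fromℚ (p ℚ.* q)} {fromℚ p * fromℚ q} λ _ → refl
    ; -‿homo = λ p → pointwise {fromℚ (ℚ.- p)} { - fromℚ p} λ _ → refl
    ; 0-homo = ≈-refl {0ℝ}
    ; 1-homo = ≈-refl {1ℝ}
    }

-- The estimate of the Randić index in an ordered algebra over the rationals.

module OrderedRings where

  open import Algebra.Bundles using (CommutativeRing)
  open import Algebra.Solver.Ring.AlmostCommutativeRing using (fromCommutativeRing; _-Raw-AlmostCommutative⟶_)
  import Algebra.Properties.Semiring.Sum
  import Algebra.Solver.Ring
  open import Data.Bool using (Bool; true; false; T; T?; if_then_else_; _∧_)
  open import Data.Fin using (Fin; zero; suc; toℕ)
  import Data.Fin.Properties as Fin
  open import Data.Integer using (+_)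
  open import Data.Maybe as Maybe using (Maybe)
  open import Data.Nat as ℕ using (ℕ; zero; suc)
  import Data.Nat.Properties as ℕ
  open import Data.Product using (_,_; ∃)
  open import Data.Rational as ℚ using (ℚ; 0ℚ; 1ℚ; ½)
  import Data.Rational.Properties as ℚ
  open import Data.Sum using (_⊎_; inj₁; inj₂)
  open import Data.Unit using (tt)
  open import Function using (_∘_)
  open import Level using (0ℓ)
  open import Relation.Binary using (tri<; tri≈; tri>)
  open import Relation.Binary.PropositionalEquality as ≡ using (_≡_; refl; cong)
  open import Relation.Nullary using (contradiction)
  open import Relation.Nullary.Decidable using (dec⇒maybe)
  module ℕ-Sum = FiniteSums
  open FiniteSums using (𝟙)

  -- Stated over an abstract ring so that terms are never unfolded to Cauchy sequences.
  record OrderedℚAlgebra : Set₁ where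
    field
      commutativeRing : CommutativeRing 0ℓ 0ℓ
    open CommutativeRing commutativeRing hiding (zero) renaming (refl to ≈-refl) public
    field
      fromℚ-hom : ℚ.+-*-rawRing -Raw-AlmostCommutative⟶ fromCommutativeRing commutativeRing
    open _-Raw-AlmostCommutative⟶_ fromℚ-hom using (0-homo; 1-homo) renaming (⟦_⟧ to ι) public
    infix 4 _≼_
    field
      _≼_         : Carrier → Carrier → Set
      ≼-reflexive : ∀ {x y} → x ≈ y → x ≼ y
      ≼-trans     : ∀ {x y z} → x ≼ y → y ≼ z → x ≼ z
      +-mono-≼    : ∀ {w x y z} → w ≼ x → y ≼ z → w + y ≼ x + z
      *-nonneg    : ∀ {x y} → 0# ≼ x → 0# ≼ y → 0# ≼ x * y
      ι-mono      : ∀ {p q} → p ℚ.≤ q → ι p ≼ ι q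

    ν : ℕ → Carrier
    ν n = ι (+ n ℚ./ 1)

    field
      ν-+ : ∀ a b → ν (a ℕ.+ b) ≈ ν a + ν b
      ν-nonneg : ∀ a → 0# ≼ ν a

  module OrderedAlgebra (A : OrderedℚAlgebra) where

    open OrderedℚAlgebra A
    open Algebra.Properties.Semiring.Sum semiring public
    open import Relation.Binary.Reasoning.Setoid setoid

    ι-≟ : ∀ p q → Maybe (ι p ≈ ι q)
    ι-≟ p q = Maybe.map (reflexive ∘ cong ι) (dec⇒maybe (p ℚ.≟ q))

    open Algebra.Solver.Ring ℚ.+-*-rawRing (fromCommutativeRing commutativeRing) fromℚ-hom ι-≟
      using (solve; _:=_; _:+_; _:-_; _:*_; :-_; con)

    two quarter three-halves seven-quarters : ℚ
    two            = + 2 ℚ./ 1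
    quarter        = + 1 ℚ./ 4
    three-halves   = + 3 ℚ./ 2
    seven-quarters = + 7 ℚ./ 4

    one : Carrier
    one = ι 1ℚ

    +-nonneg : ∀ {x y} → 0# ≼ x → 0# ≼ y → 0# ≼ x + y
    +-nonneg x≥0 y≥0 = ≼-trans (≼-reflexive (sym (+-identityˡ 0#))) (+-mono-≼ x≥0 y≥0)

    ≼⇒0≼- : ∀ {x y} → x ≼ y → 0# ≼ y - x
    ≼⇒0≼- {x} x≼y = ≼-trans (≼-reflexive (sym (-‿inverseʳ x))) (+-mono-≼ x≼y (≼-reflexive ≈-refl))

    -- A bound and its equality case come from one identity for the difference of the two sides;
    -- this turns it into the bound and `difference-zero` into the equality.
    difference-nonneg : ∀ {x y z} → y - x ≈ z → 0# ≼ z → x ≼ y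
    difference-nonneg {x} {y} {z} y-x≈z z≥0 = ≼-trans (≼-reflexive (sym (+-identityˡ x)))
      (≼-trans (+-mono-≼ (≼-trans z≥0 (≼-reflexive (sym y-x≈z))) (≼-reflexive ≈-refl))
        (≼-reflexive (solve 2 (λ x y → y :- x :+ x := y) ≈-refl x y)))

    difference-zero : ∀ {x y z} → y - x ≈ z → z ≈ 0# → y ≈ x
    difference-zero {x} {y} {z} y-x≈z z≈0 = begin
      y          ≈⟨ solve 2 (λ x y → y := y :- x :+ x) ≈-refl x y ⟩
      y - x + x  ≈⟨ +-congʳ (trans y-x≈z z≈0) ⟩
      0# + x     ≈⟨ +-identityˡ x ⟩
      x          ∎

    sum-nonneg : ∀ {n} (f : Fin n → Carrier) → (∀ i → 0# ≼ f i) → 0# ≼ sum f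
    sum-nonneg {zero}  f f≥0 = ≼-reflexive ≈-refl
    sum-nonneg {suc n} f f≥0 = +-nonneg (f≥0 zero) (sum-nonneg (f ∘ suc) (f≥0 ∘ suc))

    sum-zero : ∀ {n} (f : Fin n → Carrier) → (∀ i → f i ≈ 0#) → sum f ≈ 0#
    sum-zero {n} f f≈0 = trans (sum-cong-≋ f≈0) (sum-replicate-zero n)

    sum-constant : ∀ n c → sum {n} (λ _ → c) ≈ ν n * c
    sum-constant zero    c = sym (trans (*-congʳ 0-homo) (zeroˡ c))
    sum-constant (suc n) c = begin
      c + sum {n} (λ _ → c)  ≈⟨ +-congˡ (sum-constant n c) ⟩
      c + ν n * c            ≈⟨ solve 2 (λ c m → c :+ m :* c := (con 1ℚ :+ m) :* c) ≈-refl c (ν n) ⟩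
      (ν 1 + ν n) * c        ≈⟨ *-congʳ (ν-+ 1 n) ⟨
      ν (suc n) * c          ∎

    ν-sum : ∀ {n} (f : Fin n → ℕ) → ν (ℕ-Sum.sum f) ≈ sum (ν ∘ f)
    ν-sum {zero}  f = 0-homo
    ν-sum {suc n} f = trans (ν-+ (f zero) (ℕ-Sum.sum (f ∘ suc))) (+-congˡ (ν-sum (f ∘ suc)))

    sum-if : ∀ {n} (b : Fin n → Bool) c → sum (λ i → if b i then c else 0#) ≈ ν (ℕ-Sum.sum (λ i → 𝟙 (T? (b i)))) * c
    sum-if {zero}  b c = sym (trans (*-congʳ 0-homo) (zeroˡ c))
    sum-if {suc n} b c = trans (+-cong (head (b zero)) (sum-if (b ∘ suc) c))
      (trans (sym (distribʳ c _ _)) (*-congʳ (sym (ν-+ (𝟙 (T? (b zero))) _))))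
      where
      head : ∀ b → (if b then c else 0#) ≈ ν (𝟙 (T? b)) * c
      head true  = sym (trans (*-congʳ 1-homo) (*-identityˡ c))
      head false = sym (trans (*-congʳ 0-homo) (zeroˡ c))

    if-cong : ∀ b {x y} → (T b → x ≈ y) → (if b then x else 0#) ≈ (if b then y else 0#)
    if-cong true  x≈y = x≈y tt
    if-cong false x≈y = ≈-refl

    if-+ : ∀ b x y → (if b then x + y else 0#) ≈ (if b then x else 0#) + (if b then y else 0#)
    if-+ true  x y = ≈-refl
    if-+ false x y = sym (+-identityˡ 0#)

    sum₂-+ : ∀ {m n} (f g : Fin m → Fin n → Carrier) →
      sum (λ u → sum (λ v → f u v + g u v)) ≈ sum (λ u → sum (f u)) + sum (λ u → sum (g u))
    sum₂-+ f g = trans (sum-cong-≋ λ u → ∑-distrib-+ (f u) (g u)) (∑-distrib-+ (λ u → sum (f u)) (λ u → sum (g u)))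

    product-square : ∀ {r s t a b c} → r * r ≈ c → s * s ≈ a → t * t ≈ b → c ≈ a * b → r * r ≈ (s * t) * (s * t)
    product-square {r} {s} {t} {a} {b} {c} r² s² t² c≈ab = begin
      r * r              ≈⟨ trans r² c≈ab ⟩
      a * b              ≈⟨ *-cong s² t² ⟨
      (s * s) * (t * t)  ≈⟨ solve 2 (λ s t → (s :* s) :* (t :* t) := (s :* t) :* (s :* t)) ≈-refl s t ⟩
      (s * t) * (s * t)  ∎

    inverse-product : ∀ {r s t i j k} → r ≈ s * t → r * k ≈ one → s * i ≈ one → t * j ≈ one → k ≈ i * j
    inverse-product {r} {s} {t} {i} {j} {k} r≈st rk si tj = begin
      k                         ≈⟨ solve 1 (λ k → k := (con 1ℚ :* con 1ℚ) :* k) ≈-refl k ⟩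
      (one * one) * k           ≈⟨ *-congʳ (*-cong si tj) ⟨
      ((s * i) * (t * j)) * k   ≈⟨ solve 5 (λ s t i j k → ((s :* i) :* (t :* j)) :* k := ((s :* t) :* k) :* (i :* j)) ≈-refl s t i j k ⟩
      ((s * t) * k) * (i * j)   ≈⟨ *-congʳ (trans (*-congʳ (sym r≈st)) rk) ⟩
      one * (i * j)             ≈⟨ solve 1 (λ x → con 1ℚ :* x := x) ≈-refl (i * j) ⟩
      i * j                     ∎

    module RootTwo {q : Carrier} (q² : q * q ≈ ι two) where

      half-product : ∀ {w i j} → w ≈ i * j → w ≈ ι ½ * ((q * i) * (q * j))
      half-product {w} {i} {j} w≈ij = begin
        w                              ≈⟨ w≈ij ⟩
        i * j                          ≈⟨ solve 2 (λ i j → i :* j := con ½ :* (con two :* (i :* j))) ≈-refl i j ⟩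
        ι ½ * (ι two * (i * j))        ≈⟨ *-congˡ (*-congʳ q²) ⟨
        ι ½ * ((q * q) * (i * j))      ≈⟨ solve 3 (λ q i j → con ½ :* ((q :* q) :* (i :* j)) := con ½ :* ((q :* i) :* (q :* j))) ≈-refl q i j ⟩
        ι ½ * ((q * i) * (q * j))      ∎

      -- With `s` the root of `d` and `i` its inverse, this is the quantity √(2d) that the chord
      -- bounds from below.
      scaled-inverse : ∀ {s i d} → s * s ≈ d → s * i ≈ one → d * (q * i) ≈ q * s
      scaled-inverse {s} {i} {d} ss si = begin
        d * (q * i)         ≈⟨ *-congʳ ss ⟨
        (s * s) * (q * i)   ≈⟨ solve 3 (λ s q i → (s :* s) :* (q :* i) := (q :* s) :* (s :* i)) ≈-refl s q i ⟩
        (q * s) * (s * i)   ≈⟨ *-congˡ si ⟩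
        (q * s) * one       ≈⟨ solve 1 (λ x → x :* con 1ℚ := x) ≈-refl (q * s) ⟩
        q * s               ∎

      1-ratio : ∀ {s i} → s * i ≈ one → one - q * i ≈ (s - q) * i
      1-ratio {s} {i} si = begin
        one - q * i        ≈⟨ +-congʳ si ⟨
        s * i - q * i      ≈⟨ solve 3 (λ s q i → s :* i :- q :* i := (s :- q) :* i) ≈-refl s q i ⟩
        (s - q) * i        ∎

      1-ratio-nonneg : ∀ {s i} → q ≼ s → 0# ≼ i → s * i ≈ one → 0# ≼ one - q * i
      1-ratio-nonneg q≼s i≥0 si = ≼-trans (*-nonneg (≼⇒0≼- q≼s) i≥0) (≼-reflexive (sym (1-ratio si)))

      1-ratio-zero : ∀ {i} → q * i ≈ one → one - q * i ≈ 0#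
      1-ratio-zero {i} qi = trans (1-ratio qi) (trans (*-congʳ (-‿inverseʳ q)) (zeroˡ i))

      -- The chord of √(2 d) through d = 2 and d = 4, continued by a constant.
      chord defect : ℕ → Carrier → Carrier
      chord d s = (ι (+ 4 ℚ./ 1) - ι two * q) + ν d * (q - one) - ν (d ℕ.∸ 4) * (q - one)
      defect d s = q * s - chord d s

      chord+defect : ∀ d s → q * s ≈ chord d s + defect d s
      chord+defect d s = solve 2 (λ a b → a := b :+ (a :- b)) ≈-refl (q * s) (chord d s)

      defect-2 : defect 2 q ≈ 0#
      defect-2 = begin
        q * q - chord 2 q   ≈⟨ +-congʳ q² ⟩
        ι two - chord 2 q   ≈⟨ solve 1 (λ q → con two :- ((con (+ 4 ℚ./ 1) :- con two :* q) :+ con two :* (q :- con 1ℚ) :- con 0ℚ :* (q :- con 1ℚ)) := con 0ℚ) ≈-refl q ⟩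
        ι 0ℚ                ≈⟨ 0-homo ⟩
        0#                  ∎

      -- From degree 4 on the growth of the chord is cancelled by the term in `d ∸ 4`, and the chord
      -- stays at `2 q`.
      defect-4+ : ∀ t s → defect (4 ℕ.+ t) s ≈ q * (s - ι two)
      defect-4+ t s = begin
        q * s - chord (4 ℕ.+ t) s  ≈⟨ +-congˡ (-‿cong (+-congʳ (+-congˡ (*-congʳ (ν-+ 4 t))))) ⟩
        _                          ≈⟨ solve 3 (λ q s t → q :* s :- ((con (+ 4 ℚ./ 1) :- con two :* q) :+ (con (+ 4 ℚ./ 1) :+ t) :* (q :- con 1ℚ) :- t :* (q :- con 1ℚ))
                                         := q :* (s :- con two)) ≈-refl q s (ν t) ⟩
        q * (s - ι two)            ∎

      defect-4+-nonneg : ∀ t {s} → 0# ≼ q → ι two ≼ s → 0# ≼ defect (4 ℕ.+ t) s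
      defect-4+-nonneg t {s} q≥0 2≼s = ≼-trans (*-nonneg q≥0 (≼⇒0≼- 2≼s)) (≼-reflexive (sym (defect-4+ t s)))

      defect-4 : ∀ {s} → s ≈ ι two → defect 4 s ≈ 0#
      defect-4 {s} s≈2 = trans (defect-4+ 0 s) (trans (*-congˡ (trans (+-congʳ s≈2) (-‿inverseʳ (ι two)))) (zeroʳ q))

    module EdgeSums {n} (adj : Fin n → Fin n → Bool) (adj-sym : ∀ u v → adj u v ≡ adj v u)
      (adj-irrefl : ∀ v → adj v v ≡ false) where

      -- The first sum has the shape of `randić` literally, so that over the reals it is the Randić
      -- index by computation. The second visits each edge in both directions and can be summed
      -- vertex by vertex.
      over-edges over-pairs : (Fin n → Fin n → Carrier) → Carrier
      over-edges w = sum λ u → sum λ v → if adj u v ∧ (toℕ u ℕ.<ᵇ toℕ v) then w u v else 0#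
      over-pairs w = sum λ u → sum λ v → if adj u v then w u v else 0#

      degree : Fin n → ℕ
      degree u = ℕ-Sum.sum (λ v → 𝟙 (T? (adj u v)))

      -- Of the two orders of an edge exactly one passes the orientation test, and the diagonal has
      -- no edges.
      pairs≈2*edges : ∀ w → (∀ u v → w u v ≈ w v u) → over-pairs w ≈ over-edges w + over-edges w
      pairs≈2*edges w w-sym = begin
        over-pairs w                                          ≈⟨ sum-cong-≋ (λ u → sum-cong-≋ (λ v → sym (orient u v))) ⟩
        sum (λ u → sum (λ v → f u v + f v u))                 ≈⟨ sum₂-+ f (λ u v → f v u) ⟩
        over-edges w + sum (λ u → sum (λ v → f v u))          ≈⟨ +-congˡ (∑-comm f) ⟨
        over-edges w + over-edges w                           ∎
        where
        f : Fin n → Fin n → Carrier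
        f u v = if adj u v ∧ (toℕ u ℕ.<ᵇ toℕ v) then w u v else 0#
        <ᵇ-true : ∀ {a b} → a ℕ.< b → (a ℕ.<ᵇ b) ≡ true
        <ᵇ-true {a} {b} a<b with a ℕ.<ᵇ b | ℕ.<⇒<ᵇ a<b
        ... | true | _ = refl
        <ᵇ-false : ∀ {a b} → b ℕ.< a → (a ℕ.<ᵇ b) ≡ false
        <ᵇ-false {a} {b} b<a with a ℕ.<ᵇ b | ℕ.<ᵇ⇒< a b
        ... | true  | a<b = contradiction b<a (ℕ.<-asym (a<b tt))
        ... | false | _   = refl
        orient : ∀ u v → f u v + f v u ≈ (if adj u v then w u v else 0#)
        orient u v with ℕ.<-cmp (toℕ u) (toℕ v)
        ... | tri< u<v _ _ rewrite ≡.sym (adj-sym u v) | <ᵇ-true u<v | <ᵇ-false u<v with adj u v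
        ...   | true  = +-identityʳ _
        ...   | false = +-identityʳ _
        orient u v | tri> _ _ v<u rewrite ≡.sym (adj-sym u v) | <ᵇ-true v<u | <ᵇ-false v<u with adj u v
        ...   | true  = trans (+-identityˡ _) (w-sym v u)
        ...   | false = +-identityʳ _
        orient u v | tri≈ _ u≡v _ with Fin.toℕ-injective u≡v
        ... | refl rewrite adj-irrefl u = +-identityʳ _

      over-pairs-first : ∀ (h : Fin n → Carrier) → over-pairs (λ u v → h u) ≈ sum (λ u → ν (degree u) * h u)
      over-pairs-first h = sum-cong-≋ λ u → sum-if (adj u) (h u)

      over-pairs-second : ∀ (h : Fin n → Carrier) → over-pairs (λ u v → h v) ≈ sum (λ u → ν (degree u) * h u)
      over-pairs-second h = trans (∑-comm (λ u v → if adj u v then h v else 0#))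
        (trans (sum-cong-≋ λ v → sum-cong-≋ λ u → reflexive (cong (if_then h v else 0#) (adj-sym u v))) (over-pairs-first h))

      -- Randić weights, with q = √2 and x v = √2 / √(deg v): expand
      -- (1 - x u) (1 - x v) to replace the product x u * x v by a sum.
      module RandićSum (q : Carrier) (w : Fin n → Fin n → Carrier) (x f : Fin n → Carrier)
        (w-sym : ∀ u v → w u v ≈ w v u)
        (w≈xx/2 : ∀ u v → T (adj u v) → w u v ≈ ι ½ * (x u * x v))
        (vertex : ∀ v → ν (degree v) * x v ≈
          (ι (+ 4 ℚ./ 1) - ι two * q) + ν (degree v) * (q - one) - ν (degree v ℕ.∸ 4) * (q - one) + f v) where

        -- The two losses of the estimate: `E` from dropping the products of the gaps `1 - x`, with
        -- each edge taken in both directions as in `R + R`, and `F` from replacing the root by its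
        -- chord.
        R E F : Carrier
        R = over-edges w
        E = over-pairs (λ u v → ι ½ * ((one - x u) * (one - x v)))
        F = sum f

        total excess : ℕ
        total = ℕ-Sum.sum degree
        excess = ℕ-Sum.sum (λ v → degree v ℕ.∸ 4)

        private
          -- Since `½ x y = (½ x - ¼) + (½ y - ¼) + ½ (1 - x) (1 - y)`, `h` is the share of an edge
          -- at one end. Over all ordered pairs a vertex collects it `2 deg v` times, that is
          -- `deg v * x v - ½ deg v`; hence `q - three-halves` in `g`, the chord slope `q - one`
          -- less `½`.
          h g : Fin n → Carrier
          h v = ι ½ * x v - ι quarter
          g v = (ι (+ 4 ℚ./ 1) - ι two * q) + (ν (degree v) * (q - ι three-halves) + (ν (degree v ℕ.∸ 4) * (one - q) + f v))

          edge : ∀ u v → T (adj u v) → w u v ≈ h u + h v + ι ½ * ((one - x u) * (one - x v))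
          edge u v a = trans (w≈xx/2 u v a) (solve 2 (λ x y → con ½ :* (x :* y) :=
            (con ½ :* x :- con quarter) :+ (con ½ :* y :- con quarter) :+ con ½ :* ((con 1ℚ :- x) :* (con 1ℚ :- y))) ≈-refl (x u) (x v))

          twice-h : ∀ v → ν (degree v) * h v + ν (degree v) * h v ≈ g v
          twice-h v = begin
            ν (degree v) * h v + ν (degree v) * h v        ≈⟨ solve 2 (λ d x → d :* (con ½ :* x :- con quarter) :+ d :* (con ½ :* x :- con quarter) := d :* x :- con ½ :* d) ≈-refl (ν (degree v)) (x v) ⟩
            ν (degree v) * x v - ι ½ * ν (degree v)        ≈⟨ +-congʳ (vertex v) ⟩
            _ - ι ½ * ν (degree v)                         ≈⟨ solve 4 (λ d t q f → (con (+ 4 ℚ./ 1) :- con two :* q) :+ d :* (q :- con 1ℚ) :- t :* (q :- con 1ℚ) :+ f :- con ½ :* d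
                                                               := (con (+ 4 ℚ./ 1) :- con two :* q) :+ (d :* (q :- con three-halves) :+ (t :* (con 1ℚ :- q) :+ f))) ≈-refl
                                                               (ν (degree v)) (ν (degree v ℕ.∸ 4)) q (f v) ⟩
            g v                                            ∎

        twice-randić : R + R ≈ ν n * (ι (+ 4 ℚ./ 1) - ι two * q) + (ν total * (q - ι three-halves) + (ν excess * (one - q) + F)) + E
        twice-randić = begin
          R + R                                                                  ≈⟨ pairs≈2*edges w w-sym ⟨
          over-pairs w                                                           ≈⟨ sum-cong-≋ (λ u → sum-cong-≋ (λ v → if-cong (adj u v) (edge u v))) ⟩
          over-pairs (λ u v → h u + h v + e u v)                                 ≈⟨ split (λ u v → h u + h v) e ⟩
          over-pairs (λ u v → h u + h v) + E                                     ≈⟨ +-congʳ (split (λ u v → h u) (λ u v → h v)) ⟩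
          over-pairs (λ u v → h u) + over-pairs (λ u v → h v) + E                ≈⟨ +-congʳ (+-cong (over-pairs-first h) (over-pairs-second h)) ⟩
          sum (λ u → ν (degree u) * h u) + sum (λ u → ν (degree u) * h u) + E    ≈⟨ +-congʳ (∑-distrib-+ (λ u → ν (degree u) * h u) (λ u → ν (degree u) * h u)) ⟨
          sum (λ u → ν (degree u) * h u + ν (degree u) * h u) + E                ≈⟨ +-congʳ (sum-cong-≋ twice-h) ⟩
          sum g + E                                                              ≈⟨ +-congʳ sum-g ⟩
          _ + E                                                                  ∎
          where
          e : Fin n → Fin n → Carrier
          e u v = ι ½ * ((one - x u) * (one - x v))
          split : ∀ a b → over-pairs (λ u v → a u v + b u v) ≈ over-pairs a + over-pairs b
          split a b = trans (sum-cong-≋ λ u → sum-cong-≋ λ v → if-+ (adj u v) (a u v) (b u v))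
            (sum₂-+ (λ u v → if adj u v then a u v else 0#) (λ u v → if adj u v then b u v else 0#))
          scaled : ∀ (m : Fin n → ℕ) c → sum (λ v → ν (m v) * c) ≈ ν (ℕ-Sum.sum m) * c
          scaled m c = trans (sym (*-distribʳ-sum c (ν ∘ m))) (*-congʳ (sym (ν-sum m)))
          sum-g : sum g ≈ ν n * (ι (+ 4 ℚ./ 1) - ι two * q) + (ν total * (q - ι three-halves) + (ν excess * (one - q) + F))
          sum-g = begin
            sum g   ≈⟨ ∑-distrib-+ {n} _ _ ⟩
            _       ≈⟨ +-cong (sum-constant n _) (trans (∑-distrib-+ {n} _ _) (+-cong (scaled degree _) (trans (∑-distrib-+ {n} _ f) (+-congʳ (scaled _ _))))) ⟩
            _       ∎

    -- Here `κ` stands for k - 1 and `T` for the total excess of degrees over 4; `σ` is what the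
    -- inequality 2d + T ≤ m leaves over, so that it enters as the equation `balance` and only
    -- linear algebra remains.
    module Conclusion (q R E F : Carrier) (n κ d T σ : ℕ)
      (twice : R + R ≈ ν n * (ι (+ 4 ℚ./ 1) - ι two * q) + (ν (2 ℕ.* (n ℕ.+ κ)) * (q - ι three-halves) + (ν T * (one - q) + F)) + E)
      (balance : n ℕ.+ κ ≡ 2 ℕ.* d ℕ.+ T ℕ.+ σ) where

      private
        ν-2* : ∀ a → ν (2 ℕ.* a) ≈ ν a + ν a
        ν-2* a = trans (ν-+ a (a ℕ.+ 0)) (+-congˡ (reflexive (cong ν (ℕ.+-identityʳ a))))

        n≈ : ν n ≈ ν d + ν d + ν T + ν σ - ν κ
        n≈ = begin
          ν n                                ≈⟨ solve 2 (λ n k → n := n :+ k :- k) ≈-refl (ν n) (ν κ) ⟩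
          ν n + ν κ - ν κ                    ≈⟨ +-congʳ (ν-+ n κ) ⟨
          ν (n ℕ.+ κ) - ν κ                  ≈⟨ +-congʳ (reflexive (cong ν balance)) ⟩
          ν (2 ℕ.* d ℕ.+ T ℕ.+ σ) - ν κ      ≈⟨ +-congʳ (trans (ν-+ (2 ℕ.* d ℕ.+ T) σ) (+-congʳ (trans (ν-+ (2 ℕ.* d) T) (+-congʳ (ν-2* d))))) ⟩
          ν d + ν d + ν T + ν σ - ν κ        ∎

        total≈ : ν (2 ℕ.* (n ℕ.+ κ)) ≈ (ν n + ν κ) + (ν n + ν κ)
        total≈ = trans (ν-2* (n ℕ.+ κ)) (+-cong (ν-+ n κ) (ν-+ n κ))

        D K T′ S : Carrier
        D = ν d
        K = ν κ
        T′ = ν T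
        S = ν σ

        -- The coefficient of `n` in `twice` is `(4 - 2 q) + 2 (q - 3/2)`, which is 1 without any
        -- `q`. Replacing `n` by means of `balance` then produces exactly one `D` in `R`.
        R≈ : R ≈ D + ι ½ * (K * (ι two * q - ι (+ 4 ℚ./ 1)) + S + T′ * (ι two - q) + (E + F))
        R≈ = begin
          R               ≈⟨ solve 1 (λ r → r := con ½ :* (r :+ r)) ≈-refl R ⟩
          ι ½ * (R + R)   ≈⟨ *-congˡ (trans twice (+-congʳ (+-congˡ (+-congʳ (*-congʳ total≈))))) ⟩
          ι ½ * _         ≈⟨ *-congˡ (+-congʳ (+-cong (*-congʳ n≈) (+-congʳ (*-congʳ (+-cong (+-congʳ n≈) (+-congʳ n≈)))))) ⟩
          ι ½ * _         ≈⟨ solve 7 (λ d k t s q e f →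
              let n = d :+ d :+ t :+ s :- k in
              con ½ :* (n :* (con (+ 4 ℚ./ 1) :- con two :* q) :+ (((n :+ k) :+ (n :+ k)) :* (q :- con three-halves) :+ (t :* (con 1ℚ :- q) :+ f)) :+ e)
              := d :+ con ½ :* (k :* (con two :* q :- con (+ 4 ℚ./ 1)) :+ s :+ t :* (con two :- q) :+ (e :+ f)))
              ≈-refl D K T′ S q E F ⟩
          D + ι ½ * (K * (ι two * q - ι (+ 4 ℚ./ 1)) + S + T′ * (ι two - q) + (E + F)) ∎

      -- The differences between the two sides of the bounds. The coefficient `three-halves - q` in
      -- the second is the sharper demand on √2 and calls for √2 ≤ 3/2.
      slack₁ slack₂ : Carrier
      slack₁ = ι ½ * (ν σ + ν T * (ι two - q) + (E + F))
      slack₂ = ι ½ * (ι ½ * ν σ + ν T * (ι three-halves - q) + (E + F))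

      gap₁ : (R - ν d) - (- (((ν (suc κ)) - one) * (ι two - q))) ≈ slack₁
      gap₁ = begin
        (R - D) - (- ((ν (suc κ) - one) * (ι two - q)))   ≈⟨ +-cong (+-congʳ R≈) (-‿cong (-‿cong (*-congʳ (+-congʳ (ν-+ 1 κ))))) ⟩
        _                                                ≈⟨ solve 7 (λ d k t s q e f →
            ((d :+ con ½ :* (k :* (con two :* q :- con (+ 4 ℚ./ 1)) :+ s :+ t :* (con two :- q) :+ (e :+ f))) :- d)
              :- (:- ((con 1ℚ :+ k :- con 1ℚ) :* (con two :- q)))
            := con ½ :* (s :+ t :* (con two :- q) :+ (e :+ f))) ≈-refl D K T′ S q E F ⟩
        slack₁                                           ∎

      gap₂ : (R - ν d * ι ½) - (ν n * ι quarter - ((ν (suc κ)) - one) * (ι seven-quarters - q)) ≈ slack₂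
      gap₂ = begin
        (R - D * ι ½) - (ν n * ι quarter - (ν (suc κ) - one) * (ι seven-quarters - q))
          ≈⟨ +-cong (+-congʳ R≈) (-‿cong (+-cong (*-congʳ n≈) (-‿cong (*-congʳ (+-congʳ (ν-+ 1 κ)))))) ⟩
        _ ≈⟨ solve 7 (λ d k t s q e f →
            ((d :+ con ½ :* (k :* (con two :* q :- con (+ 4 ℚ./ 1)) :+ s :+ t :* (con two :- q) :+ (e :+ f))) :- d :* con ½)
              :- ((d :+ d :+ t :+ s :- k) :* con quarter :- (con 1ℚ :+ k :- con 1ℚ) :* (con seven-quarters :- q))
            := con ½ :* (con ½ :* s :+ t :* (con three-halves :- q) :+ (e :+ f))) ≈-refl D K T′ S q E F ⟩
        slack₂ ∎

    record SquareRoots : Set₁ where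
      field
        root inv-root    : ℕ → Carrier
        root-square      : ∀ m → root m * root m ≈ ν m
        root-nonneg      : ∀ m → 0# ≼ root m
        root-mono        : ∀ {a b} → a ℕ.≤ b → root a ≼ root b
        root-2           : root 2 ≼ ι three-halves
        root-4           : root 4 ≈ ι two
        root-inverse     : ∀ m → root (suc m) * inv-root (suc m) ≈ one
        inv-root-nonneg  : ∀ m → 0# ≼ inv-root (suc m)
        inv-root-product : ∀ a b → inv-root (suc a ℕ.* suc b) ≈ inv-root (suc a) * inv-root (suc b)

    module RandićBound (roots : SquareRoots) {n} (adj : Fin n → Fin n → Bool) (adj-sym : ∀ u v → adj u v ≡ adj v u)
      (adj-irrefl : ∀ v → adj v v ≡ false) (deg : Fin n → ℕ) (deg≡ : ∀ v → deg v ≡ ℕ-Sum.sum (λ w → 𝟙 (T? (adj v w))))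
      (deg-2-or-4+ : ∀ v → deg v ≡ 2 ⊎ ∃ λ t → deg v ≡ 4 ℕ.+ t) where

      open SquareRoots roots
      open EdgeSums adj adj-sym adj-irrefl

      q : Carrier
      q = root 2

      open RootTwo {q} (root-square 2)

      weight : Fin n → Fin n → Carrier
      weight u v = inv-root (deg u ℕ.* deg v)

      ratio : Fin n → Carrier
      ratio v = q * inv-root (deg v)

      loss : Fin n → Carrier
      loss v = defect (deg v) (root (deg v))

      private
        2≤deg : ∀ v → 2 ℕ.≤ deg v
        2≤deg v with deg-2-or-4+ v
        ... | inj₁ eq       = ℕ.≤-reflexive (≡.sym eq)
        ... | inj₂ (t , eq) = ≡.subst (2 ℕ.≤_) (≡.sym eq) (ℕ.s≤s (ℕ.s≤s ℕ.z≤n))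

        inverse : ∀ {a} → 2 ℕ.≤ a → root a * inv-root a ≈ one
        inverse {suc a} _ = root-inverse a

        inv-nonneg : ∀ {a} → 2 ℕ.≤ a → 0# ≼ inv-root a
        inv-nonneg {suc a} _ = inv-root-nonneg a

        inv-product : ∀ {a b} → 2 ℕ.≤ a → 2 ℕ.≤ b → inv-root (a ℕ.* b) ≈ inv-root a * inv-root b
        inv-product {suc a} {suc b} _ _ = inv-root-product a b

        vertex : ∀ v → ν (degree v) * ratio v ≈ chord (degree v) (root (deg v)) + loss v
        vertex v = ≡.subst (λ d → ν d * ratio v ≈ chord d (root (deg v)) + loss v) (deg≡ v)
          (trans (scaled-inverse (root-square (deg v)) (inverse (2≤deg v))) (chord+defect (deg v) (root (deg v))))

      open RandićSum q weight ratio loss (λ u v → reflexive (cong inv-root (ℕ.*-comm (deg u) (deg v))))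
        (λ u v _ → half-product (inv-product (2≤deg u) (2≤deg v))) vertex public

      private
        gap-nonneg : ∀ v → 0# ≼ one - ratio v
        gap-nonneg v = 1-ratio-nonneg (root-mono (2≤deg v)) (inv-nonneg (2≤deg v)) (inverse (2≤deg v))

        gap-zero : ∀ {v} → deg v ≡ 2 → one - ratio v ≈ 0#
        gap-zero eq = 1-ratio-zero (trans (*-congˡ (reflexive (cong inv-root eq))) (root-inverse 1))

        loss-nonneg : ∀ v → 0# ≼ loss v
        loss-nonneg v with deg v | deg-2-or-4+ v
        ... | _ | inj₁ refl       = ≼-reflexive (sym defect-2)
        ... | _ | inj₂ (t , refl) = defect-4+-nonneg t (root-nonneg 2)
          (≼-trans (≼-reflexive (sym root-4)) (root-mono (ℕ.m≤m+n 4 t)))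

        loss-zero : ∀ v → deg v ≡ 2 ⊎ deg v ≡ 4 → loss v ≈ 0#
        loss-zero v d with deg v | d
        ... | _ | inj₁ refl = defect-2
        ... | _ | inj₂ refl = defect-4 root-4

        ½-nonneg : 0# ≼ ι ½
        ½-nonneg = ≼-trans (≼-reflexive (sym 0-homo)) (ι-mono (ℚ.nonNegative⁻¹ ½))

        if-nonneg : ∀ b {x} → 0# ≼ x → 0# ≼ (if b then x else 0#)
        if-nonneg true  x≥0 = x≥0
        if-nonneg false x≥0 = ≼-reflexive ≈-refl

        E-nonneg : 0# ≼ E
        E-nonneg = sum-nonneg _ λ u → sum-nonneg _ λ v →
          if-nonneg (adj u v) (*-nonneg ½-nonneg (*-nonneg (gap-nonneg u) (gap-nonneg v)))

        F-nonneg : 0# ≼ F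
        F-nonneg = sum-nonneg loss loss-nonneg

      module _ (κ d σ : ℕ) (deg-total : ℕ-Sum.sum deg ≡ 2 ℕ.* (n ℕ.+ κ))
        (balance : n ℕ.+ κ ≡ 2 ℕ.* d ℕ.+ ℕ-Sum.sum (λ v → deg v ℕ.∸ 4) ℕ.+ σ)
        {d/2 n/4 : Carrier} (d/2≈ : d/2 ≈ ν d * ι ½) (n/4≈ : n/4 ≈ ν n * ι quarter) where

        private
          T′ : ℕ
          T′ = ℕ-Sum.sum (λ v → deg v ℕ.∸ 4)

          twice : R + R ≈ ν n * (ι (+ 4 ℚ./ 1) - ι two * q) + (ν (2 ℕ.* (n ℕ.+ κ)) * (q - ι three-halves) + (ν T′ * (one - q) + F)) + E
          twice = ≡.subst₂ (λ a b → R + R ≈ ν n * (ι (+ 4 ℚ./ 1) - ι two * q) + (ν a * (q - ι three-halves) + (ν b * (one - q) + F)) + E)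
            (≡.trans (ℕ-Sum.sum-cong-≗ λ v → ≡.sym (deg≡ v)) deg-total)
            (ℕ-Sum.sum-cong-≗ λ v → cong (ℕ._∸ 4) (≡.sym (deg≡ v))) twice-randić

          open Conclusion q R E F n κ d T′ σ twice balance

          gap₂′ : (R - d/2) - (n/4 - (ν (suc κ) - one) * (ι seven-quarters - q)) ≈ slack₂
          gap₂′ = trans (+-cong (+-congˡ (-‿cong d/2≈)) (-‿cong (+-congʳ n/4≈))) gap₂

        bound₁ : - ((ν (suc κ) - one) * (ι two - q)) ≼ R - ν d
        bound₁ = difference-nonneg gap₁ (*-nonneg ½-nonneg (+-nonneg
          (+-nonneg (ν-nonneg σ) (*-nonneg (ν-nonneg T′) (≼⇒0≼- (≼-trans root-2 (ι-mono three-halves≤two)))))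
          (+-nonneg E-nonneg F-nonneg)))
          where
          three-halves≤two : three-halves ℚ.≤ two
          three-halves≤two = ℚ.≤ᵇ⇒≤ tt

        bound₂ : n/4 - (ν (suc κ) - one) * (ι seven-quarters - q) ≼ R - d/2
        bound₂ = difference-nonneg gap₂′ (*-nonneg ½-nonneg (+-nonneg
          (+-nonneg (*-nonneg ½-nonneg (ν-nonneg σ)) (*-nonneg (ν-nonneg T′) (≼⇒0≼- root-2)))
          (+-nonneg E-nonneg F-nonneg)))

        module _ (σ≡0 : σ ≡ 0) (deg-2-or-4 : ∀ v → deg v ≡ 2 ⊎ deg v ≡ 4)
          (separated : ∀ u v → T (adj u v) → deg u ≡ 2 ⊎ deg v ≡ 2) where

          private
            νσ≈0 : ν σ ≈ 0#
            νσ≈0 = trans (reflexive (cong ν σ≡0)) 0-homo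

            νT≈0 : ν T′ ≈ 0#
            νT≈0 = trans (reflexive (cong ν (ℕ-Sum.sum-zero _ no-excess))) 0-homo
              where
              no-excess : ∀ v → deg v ℕ.∸ 4 ≡ 0
              no-excess v with deg v | deg-2-or-4 v
              ... | _ | inj₁ refl = refl
              ... | _ | inj₂ refl = refl

            E≈0 : E ≈ 0#
            E≈0 = sum-zero _ λ u → sum-zero _ λ v → trans (if-cong (adj u v) (vanish u v)) (if-0 (adj u v))
              where
              if-0 : ∀ b → (if b then 0# else 0#) ≈ 0#
              if-0 true  = ≈-refl
              if-0 false = ≈-refl
              vanish : ∀ u v → T (adj u v) → ι ½ * ((one - ratio u) * (one - ratio v)) ≈ 0#
              vanish u v a with separated u v a
              ... | inj₁ eq = trans (*-congˡ (trans (*-congʳ (gap-zero eq)) (zeroˡ _))) (zeroʳ (ι ½))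
              ... | inj₂ eq = trans (*-congˡ (trans (*-congˡ (gap-zero eq)) (zeroʳ _))) (zeroʳ (ι ½))

            F≈0 : F ≈ 0#
            F≈0 = sum-zero loss λ v → loss-zero v (deg-2-or-4 v)

            zero-slack : ∀ {a b c} → a ≈ 0# → b ≈ 0# → ι ½ * (a + b * c + (E + F)) ≈ 0#
            zero-slack {a} {b} {c} a≈0 b≈0 = trans (*-congˡ (begin
              a + b * c + (E + F)        ≈⟨ +-cong (+-cong a≈0 (trans (*-congʳ b≈0) (zeroˡ c))) (+-cong E≈0 F≈0) ⟩
              0# + 0# + (0# + 0#)        ≈⟨ trans (+-cong (+-identityˡ 0#) (+-identityˡ 0#)) (+-identityˡ 0#) ⟩
              0#                         ∎)) (zeroʳ (ι ½))

          equality₁ : R - ν d ≈ - ((ν (suc κ) - one) * (ι two - q))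
          equality₁ = difference-zero gap₁ (zero-slack νσ≈0 νT≈0)

          equality₂ : R - d/2 ≈ n/4 - (ν (suc κ) - one) * (ι seven-quarters - q)
          equality₂ = difference-zero gap₂′ (zero-slack (trans (*-congˡ νσ≈0) (zeroʳ (ι ½))) νT≈0)

-- Square roots of natural numbers as Cauchy reals.

module RealRoots where

  open import Data.Fin using (zero; suc)
  open import Data.Integer as ℤ using (+_)
  import Data.Integer.Properties as ℤ
  open import Data.Nat as ℕ using (ℕ; zero; suc)
  import Data.Nat.Properties as ℕ
  open import Data.Nat.Tactic.RingSolver using (solve-∀)
  open import Data.Product using (∃-syntax; _,_; proj₁; proj₂)
  open import Data.Rational as ℚ using (ℚ; 0ℚ; 1ℚ)
  import Data.Rational.Properties as ℚ
  import Data.Rational.Solver as ℚ-Solver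
  open import Data.Rational.Unnormalised as ℚᵘ using (mkℚᵘ)
  import Data.Rational.Unnormalised.Properties as ℚᵘ
  open import Relation.Binary.PropositionalEquality
  open import Defs
  open RealRing
  open OrderedRings

  private
    /-cong : ∀ a b i j → a ℕ.* suc j ≡ b ℕ.* suc i → + a ℚ./ suc i ≡ + b ℚ./ suc j
    /-cong a b i j eq = ℚ.≤-antisym (/-mono a b i j (ℕ.≤-reflexive eq)) (/-mono b a j i (ℕ.≤-reflexive (sym eq)))

    /-* : ∀ a b i j → (+ a ℚ./ suc i) ℚ.* (+ b ℚ./ suc j) ≡ + (a ℕ.* b) ℚ./ (suc i ℕ.* suc j)
    /-* a b i j = ℚ.toℚᵘ-injective (begin-equality
      ℚ.toℚᵘ ((+ a ℚ./ suc i) ℚ.* (+ b ℚ./ suc j))               ≃⟨ ℚ.toℚᵘ-homo-* (+ a ℚ./ suc i) (+ b ℚ./ suc j) ⟩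
      ℚ.toℚᵘ (+ a ℚ./ suc i) ℚᵘ.* ℚ.toℚᵘ (+ b ℚ./ suc j)         ≃⟨ ℚᵘ.*-cong (ℚ.toℚᵘ-fromℚᵘ (mkℚᵘ (+ a) i)) (ℚ.toℚᵘ-fromℚᵘ (mkℚᵘ (+ b) j)) ⟩
      mkℚᵘ (+ a) i ℚᵘ.* mkℚᵘ (+ b) j                             ≡⟨ cong (λ z → mkℚᵘ z (j ℕ.+ i ℕ.* suc j)) (ℤ.pos-* a b) ⟨
      mkℚᵘ (+ (a ℕ.* b)) (j ℕ.+ i ℕ.* suc j)                     ≃⟨ ℚ.toℚᵘ-fromℚᵘ (mkℚᵘ (+ (a ℕ.* b)) (j ℕ.+ i ℕ.* suc j)) ⟨
      ℚ.toℚᵘ (+ (a ℕ.* b) ℚ./ (suc i ℕ.* suc j))                 ∎)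
      where open ℚᵘ.≤-Reasoning

    /1-+ : ∀ a b → + (a ℕ.+ b) ℚ./ 1 ≡ (+ a ℚ./ 1) ℚ.+ (+ b ℚ./ 1)
    /1-+ zero    b = sym (ℚ.+-identityˡ (+ b ℚ./ 1))
    /1-+ (suc a) b = begin
      + suc (a ℕ.+ b) ℚ./ 1                             ≡⟨ suc-/ (a ℕ.+ b) 0 ⟩
      (+ (a ℕ.+ b) ℚ./ 1) ℚ.+ 1ℚ                        ≡⟨ cong (ℚ._+ 1ℚ) (/1-+ a b) ⟩
      (+ a ℚ./ 1) ℚ.+ (+ b ℚ./ 1) ℚ.+ 1ℚ                ≡⟨ solve 3 (λ a b c → a :+ b :+ c := a :+ c :+ b) refl (+ a ℚ./ 1) (+ b ℚ./ 1) 1ℚ ⟩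
      (+ a ℚ./ 1) ℚ.+ 1ℚ ℚ.+ (+ b ℚ./ 1)                ≡⟨ cong (ℚ._+ (+ b ℚ./ 1)) (suc-/ a 0) ⟨
      (+ suc a ℚ./ 1) ℚ.+ (+ b ℚ./ 1)                   ∎
      where
      open ≡-Reasoning
      open ℚ-Solver.+-*-Solver

  abstract
    fromℕ-+ : ∀ a b → fromℕ (a ℕ.+ b) ≈ fromℕ a + fromℕ b
    fromℕ-+ a b = pointwise {fromℕ (a ℕ.+ b)} {fromℕ a + fromℕ b} λ _ → /1-+ a b

    fromℕ-* : ∀ a b → fromℕ (a ℕ.* b) ≈ fromℕ a * fromℕ b
    fromℕ-* a b = pointwise {fromℕ (a ℕ.* b)} {fromℕ a * fromℕ b} λ _ → sym (/-* a b 0 0)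

    fromℕ-nonneg : ∀ a → 0ℝ ≤ fromℕ a
    fromℕ-nonneg a = fromℚ-mono (/-mono 0 a 0 0 ℕ.z≤n)

    fromℚ-/ : ∀ a j → fromℚ (+ a ℚ./ suc j) ≈ fromℕ a * fromℚ (+ 1 ℚ./ suc j)
    fromℚ-/ a j = pointwise {fromℚ (+ a ℚ./ suc j)} {fromℕ a * fromℚ (+ 1 ℚ./ suc j)} λ _ →
      trans (/-cong a (a ℕ.* 1) j (j ℕ.+ 0) (cong₂ ℕ._*_ (sym (ℕ.*-identityʳ a)) (cong suc (ℕ.+-identityʳ j)))) (sym (/-* a 1 0 j))

  private
    module _ (m n : ℕ) where
      a = ⌊√ m ℕ.* (suc n ℕ.* suc n) ⌋
      s t : ℚ
      s = √-seq m n
      t = + 1 ℚ./ suc n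

      √-seq-lower : s ℚ.* s ℚ.≤ + m ℚ./ 1
      √-seq-lower = subst (ℚ._≤ + m ℚ./ 1) (sym (/-* a a n n))
        (/-mono (a ℕ.* a) m _ 0 (subst (ℕ._≤ m ℕ.* (suc n ℕ.* suc n)) (sym (ℕ.*-identityʳ (a ℕ.* a))) (⌊√⌋-lower (m ℕ.* (suc n ℕ.* suc n)))))

      √-seq-upper : + m ℚ./ 1 ℚ.≤ (s ℚ.+ t) ℚ.* (s ℚ.+ t)
      √-seq-upper = subst (+ m ℚ./ 1 ℚ.≤_) (trans (sym (/-* (suc a) (suc a) n n)) (cong (λ z → z ℚ.* z) (suc-/ a n)))
        (/-mono m (suc a ℕ.* suc a) 0 _ (subst (m ℕ.* (suc n ℕ.* suc n) ℕ.≤_) (sym (ℕ.*-identityʳ (suc a ℕ.* suc a))) (ℕ.<⇒≤ (⌊√⌋-upper (m ℕ.* (suc n ℕ.* suc n))))))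

      √-seq-nonneg : 0ℚ ℚ.≤ s
      √-seq-nonneg = /-mono 0 a 0 n ℕ.z≤n

      1/-≤1 : t ℚ.≤ 1ℚ
      1/-≤1 = /-mono 1 1 n 0 (ℕ.*-monoʳ-≤ 1 (ℕ.s≤s ℕ.z≤n))

      0≤1/ : 0ℚ ℚ.≤ t
      0≤1/ = /-mono 0 1 0 n ℕ.z≤n

    ⌊√⌋-mono : ∀ {m m′} → m ℕ.≤ m′ → ⌊√ m ⌋ ℕ.≤ ⌊√ m′ ⌋
    ⌊√⌋-mono {m} {m′} m≤m′ = ℕ.s≤s⁻¹ (ℕ.≰⇒> λ r′<r → ℕ.<-irrefl {m} refl (begin-strict
      m                                ≤⟨ m≤m′ ⟩
      m′                               <⟨ ⌊√⌋-upper m′ ⟩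
      suc ⌊√ m′ ⌋ ℕ.* suc ⌊√ m′ ⌋      ≤⟨ ℕ.*-mono-≤ {suc ⌊√ m′ ⌋} {⌊√ m ⌋} r′<r r′<r ⟩
      ⌊√ m ⌋ ℕ.* ⌊√ m ⌋                ≤⟨ ⌊√⌋-lower m ⟩
      m                                ∎))
      where open ℕ.≤-Reasoning

    √-seq-mono : ∀ {m m′} n → m ℕ.≤ m′ → √-seq m n ℚ.≤ √-seq m′ n
    √-seq-mono {m} {m′} n m≤m′ = /-mono (a m n) (a m′ n) n n
      (ℕ.*-monoˡ-≤ (suc n) (⌊√⌋-mono (ℕ.*-monoˡ-≤ (suc n ℕ.* suc n) m≤m′)))

    √-seq≥1 : ∀ m n → 1ℚ ℚ.≤ √-seq (suc m) n
    √-seq≥1 m n = proj₂ (proj₂ (proj₂ (√-positive m))) n ℕ.z≤n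

  -- With `s` the `n`-th approximation and `t` its precision 1/(n + 1), `s² ≤ m ≤ (s + t)²`, so the
  -- error of `s²` is at most `(2 s + t) t`. The first factor is bounded by `D`, and `t` is
  -- eventually at most `ε / D`.
  √-square : ∀ m → √ m * √ m ≈ fromℕ m
  √-square m ε ε>0 = √-square-bound ε ε>0
    where
    module _ (ε : ℚ) (ε>0 : 0ℚ ℚ.< ε) where
      open ℚ.≤-Reasoning
      b = bounded (√ m)
      B = proj₁ b
      N = proj₁ (proj₂ b)
      B>0 : 0ℚ ℚ.< B
      B>0 = proj₁ (proj₂ (proj₂ b))
      D = B ℚ.+ B ℚ.+ 1ℚ
      D>0 : 0ℚ ℚ.< D
      D>0 = ℚ.+-mono-< (ℚ.+-mono-< B>0 B>0) (ℚ.positive⁻¹ 1ℚ)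
      δ = ε ℚ.* inv D
      arch = archimedean δ (*-pos ε>0 (inv-pos D>0))
      expand : ∀ s t → (s ℚ.+ t) ℚ.* (s ℚ.+ t) ≡ s ℚ.* s ℚ.+ (s ℚ.+ s ℚ.+ t) ℚ.* t
      expand = solve 2 (λ s t → (s :+ t) :* (s :+ t) := s :* s :+ (s :+ s :+ t) :* t) refl
        where open ℚ-Solver.+-*-Solver
      regroup : ∀ d e i → d ℚ.* (e ℚ.* i) ≡ e ℚ.* (d ℚ.* i)
      regroup = solve 3 (λ d e i → d :* (e :* i) := e :* (d :* i)) refl
        where open ℚ-Solver.+-*-Solver
      upper : ∀ n → ℚ.∣ s m n ∣ ℚ.≤ B → t m n ℚ.≤ δ → + m ℚ./ 1 ℚ.≤ s m n ℚ.* s m n ℚ.+ ε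
      upper n ∣s∣≤B t≤δ = begin
        + m ℚ./ 1                                                       ≤⟨ √-seq-upper m n ⟩
        (s m n ℚ.+ t m n) ℚ.* (s m n ℚ.+ t m n)                         ≡⟨ expand (s m n) (t m n) ⟩
        s m n ℚ.* s m n ℚ.+ (s m n ℚ.+ s m n ℚ.+ t m n) ℚ.* t m n       ≤⟨ ℚ.+-monoʳ-≤ (s m n ℚ.* s m n)
          (*-mono-≤ (0≤1/ m n) (ℚ.<⇒≤ D>0) (ℚ.+-mono-≤ (ℚ.+-mono-≤ s≤B s≤B) (1/-≤1 m n)) t≤δ) ⟩
        s m n ℚ.* s m n ℚ.+ D ℚ.* δ                                     ≡⟨ cong (s m n ℚ.* s m n ℚ.+_)
          (trans (regroup D ε (inv D)) (trans (cong (ε ℚ.*_) (inv-inverseʳ D>0)) (ℚ.*-identityʳ ε))) ⟩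
        s m n ℚ.* s m n ℚ.+ ε                                           ∎
        where s≤B = ℚ.≤-trans (p≤∣p∣ (s m n)) ∣s∣≤B
      √-square-bound : ∃[ N ] (∀ n → N ℕ.≤ n → ℚ.∣ s m n ℚ.* s m n ℚ.- + m ℚ./ 1 ∣ ℚ.≤ ε)
      √-square-bound = N ℕ.⊔ proj₁ arch , λ n ≤n → ≤⇒∣p-q∣≤
        (ℚ.≤-trans (√-seq-lower m n) (subst (ℚ._≤ + m ℚ./ 1 ℚ.+ ε) (ℚ.+-identityʳ (+ m ℚ./ 1)) (ℚ.+-monoʳ-≤ (+ m ℚ./ 1) (ℚ.<⇒≤ ε>0))))
        (upper n (proj₂ (proj₂ (proj₂ b)) n (ℕ.m⊔n≤o⇒m≤o N _ ≤n)) (proj₂ arch n (ℕ.m⊔n≤o⇒n≤o N _ ≤n)))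

  abstract
    √-nonneg : ∀ m → 0ℝ ≤ √ m
    √-nonneg m = ≤-pointwise {0ℝ} {√ m} (√-seq-nonneg m)

    √-mono : ∀ {m m′} → m ℕ.≤ m′ → √ m ≤ √ m′
    √-mono {m} {m′} m≤m′ = ≤-pointwise {√ m} {√ m′} λ n → √-seq-mono n m≤m′

    -- Where x + y ≥ 1, the difference x - y is dominated by x² - y².
    square-injective : ∀ {x y} → (∀ n → 1ℚ ℚ.≤ seq x n) → (∀ n → 0ℚ ℚ.≤ seq y n) → x * x ≈ y * y → x ≈ y
    square-injective {x} {y} x≥1 y≥0 x²≈y² ε ε>0 = let (N , h) = x²≈y² ε ε>0 in
      N , λ n N≤n → ℚ.≤-trans (dominated (seq x n) (seq y n) (x≥1 n) (y≥0 n)) (h n N≤n)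
      where
      open ℚ.≤-Reasoning
      factor : ∀ p q → (p ℚ.- q) ℚ.* (p ℚ.+ q) ≡ p ℚ.* p ℚ.- q ℚ.* q
      factor = solve 2 (λ p q → (p :- q) :* (p :+ q) := p :* p :- q :* q) refl
        where open ℚ-Solver.+-*-Solver
      dominated : ∀ p q → 1ℚ ℚ.≤ p → 0ℚ ℚ.≤ q → ℚ.∣ p ℚ.- q ∣ ℚ.≤ ℚ.∣ p ℚ.* p ℚ.- q ℚ.* q ∣
      dominated p q p≥1 q≥0 = begin
        ℚ.∣ p ℚ.- q ∣                       ≡⟨ ℚ.*-identityʳ ℚ.∣ p ℚ.- q ∣ ⟨
        ℚ.∣ p ℚ.- q ∣ ℚ.* 1ℚ                ≤⟨ ℚ.*-monoˡ-≤-nonNeg ℚ.∣ p ℚ.- q ∣ {{ℚ.∣-∣-nonNeg (p ℚ.- q)}}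
          (ℚ.≤-trans (subst (1ℚ ℚ.≤_) refl (ℚ.+-mono-≤ p≥1 q≥0)) (p≤∣p∣ (p ℚ.+ q))) ⟩
        ℚ.∣ p ℚ.- q ∣ ℚ.* ℚ.∣ p ℚ.+ q ∣     ≡⟨ ℚ.∣p*q∣≡∣p∣*∣q∣ (p ℚ.- q) (p ℚ.+ q) ⟨
        ℚ.∣ (p ℚ.- q) ℚ.* (p ℚ.+ q) ∣       ≡⟨ cong ℚ.∣_∣ (factor p q) ⟩
        ℚ.∣ p ℚ.* p ℚ.- q ℚ.* q ∣           ∎

    -- All approximations of the root are at least 1, so the reciprocal is exact term by term and
    -- the default value of `inv` at 0 is never met.
    1/√-inverse : ∀ m → √ (suc m) * 1/√ (suc m) ≈ 1ℝ
    1/√-inverse m = pointwise {√ (suc m) * 1/√ (suc m)} {1ℝ} λ n →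
      inv-inverseʳ (ℚ.<-≤-trans (ℚ.positive⁻¹ 1ℚ) (√-seq≥1 m n))

    1/√-nonneg : ∀ m → 0ℝ ≤ 1/√ (suc m)
    1/√-nonneg m = ≤-pointwise {0ℝ} {1/√ (suc m)} λ n →
      ℚ.<⇒≤ (inv-pos (ℚ.<-≤-trans (ℚ.positive⁻¹ 1ℚ) (√-seq≥1 m n)))

  ℝ-algebra : OrderedℚAlgebra
  ℝ-algebra = record
    { commutativeRing = ℝ-commutativeRing
    ; fromℚ-hom       = fromℚ-homomorphism
    ; _≼_             = _≤_
    ; ≼-reflexive     = λ {x} {y} → ≈⇒≤ {x} {y}
    ; ≼-trans         = λ {x} {y} {z} → ≤-trans {x} {y} {z}
    ; +-mono-≼        = λ {w} {x} {y} {z} → +-mono-≤ {w} {x} {y} {z}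
    ; *-nonneg        = λ {x} {y} → *-nonneg {x} {y}
    ; ι-mono          = fromℚ-mono
    ; ν-+             = fromℕ-+
    ; ν-nonneg        = fromℕ-nonneg
    }

  open OrderedAlgebra ℝ-algebra using (product-square; inverse-product)

  abstract
    -- The approximations are rounded down and need not multiply term by term; the two sides are
    -- compared through their squares instead.
    √-* : ∀ a b → √ (suc a ℕ.* suc b) ≈ √ (suc a) * √ (suc b)
    √-* a b = square-injective {√ (suc a ℕ.* suc b)} {√ (suc a) * √ (suc b)} (√-seq≥1 (b ℕ.+ a ℕ.* suc b))
      (λ n → subst (ℚ._≤ √-seq (suc a) n ℚ.* √-seq (suc b) n) (ℚ.*-zeroʳ (√-seq (suc a) n))
        (ℚ.*-monoˡ-≤-nonNeg (√-seq (suc a) n) {{ℚ.nonNegative (√-seq-nonneg (suc a) n)}} (√-seq-nonneg (suc b) n)))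
      (product-square {√ (suc a ℕ.* suc b)} {√ (suc a)} {√ (suc b)} {fromℕ (suc a)} {fromℕ (suc b)} {fromℕ (suc a ℕ.* suc b)}
        (√-square (suc a ℕ.* suc b)) (√-square (suc a)) (√-square (suc b)) (fromℕ-* (suc a) (suc b)))

    1/√-* : ∀ a b → 1/√ (suc a ℕ.* suc b) ≈ 1/√ (suc a) * 1/√ (suc b)
    1/√-* a b = inverse-product {√ (suc a ℕ.* suc b)} {√ (suc a)} {√ (suc b)} {1/√ (suc a)} {1/√ (suc b)} {1/√ (suc a ℕ.* suc b)}
      (√-* a b) (1/√-inverse (b ℕ.+ a ℕ.* suc b)) (1/√-inverse a) (1/√-inverse b)

    √4≈2 : √ 4 ≈ fromℕ 2
    √4≈2 = square-injective {√ 4} {fromℕ 2} (√-seq≥1 3) (λ _ → /-mono 0 2 0 0 ℕ.z≤n)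
      (≈-trans {√ 4 * √ 4} {fromℕ 4} {fromℕ 2 * fromℕ 2} (√-square 4) (fromℕ-* 2 2))

    √2≤3/2 : √ 2 ≤ fromℚ (+ 3 ℚ./ 2)
    √2≤3/2 = ≤-pointwise {√ 2} {fromℚ (+ 3 ℚ./ 2)} λ n →
      /-mono ⌊√ 2 ℕ.* (suc n ℕ.* suc n) ⌋ 3 n 1 (square-≤ ⌊√ 2 ℕ.* (suc n ℕ.* suc n) ⌋ (suc n) (⌊√⌋-lower (2 ℕ.* (suc n ℕ.* suc n))))
      where
      -- The summand `s * s` is the surplus of 9 over 8 in (3/2)² > 2; it supplies the strict
      -- inequality that `square-cancel-<` expects.
      nine : ∀ s → (3 ℕ.* s) ℕ.* (3 ℕ.* s) ≡ s ℕ.* s ℕ.+ 4 ℕ.* (2 ℕ.* (s ℕ.* s))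
      nine = solve-∀
      four : ∀ a → (a ℕ.* 2) ℕ.* (a ℕ.* 2) ≡ 4 ℕ.* (a ℕ.* a)
      four = solve-∀
      square-≤ : ∀ a s .{{_ : ℕ.NonZero s}} → a ℕ.* a ℕ.≤ 2 ℕ.* (s ℕ.* s) → a ℕ.* 2 ℕ.≤ 3 ℕ.* s
      square-≤ a s@(suc _) a²≤2s² = square-cancel-< (subst₂ ℕ._<_ (sym (four a)) (sym (nine s))
        (ℕ.≤-<-trans (ℕ.*-monoʳ-≤ 4 a²≤2s²) (ℕ.m<n+m _ ℕ.z<s)))

-- Combination of the counts with the estimate.

open import Data.Bool using (T)
open import Data.Fin using (Fin; zero)
open import Data.Integer using (+_)
open import Data.Nat as ℕ using (ℕ; zero; suc)
import Data.Nat.Properties as ℕ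
open import Data.Product using (_×_; _,_; proj₁; proj₂)
open import Data.Rational as ℚ using (ℚ)
open import Data.Sum using (_⊎_; inj₁; inj₂)
open import Relation.Binary.PropositionalEquality using (_≡_; sym; trans; cong)
open import Relation.Nullary using (¬_; yes; no; contradiction)
open import Defs
open FiniteSums
open CactusGraphs
open DistanceLevels
open BlockPath
open RealRing
open RealRoots
open OrderedRings

open OrderedAlgebra ℝ-algebra using (SquareRoots; module RandićBound)

ℝ-roots : SquareRoots
ℝ-roots = record
  { root             = √
  ; inv-root         = 1/√
  ; root-square      = √-square
  ; root-nonneg      = √-nonneg
  ; root-mono        = √-mono
  ; root-2           = √2≤3/2
  ; root-4           = √4≈2
  ; root-inverse     = 1/√-inverse
  ; inv-root-nonneg  = 1/√-nonneg
  ; inv-root-product = 1/√-*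
  }

module Bounds {n κ d : ℕ} (G : Graph n) (cactus : IsCactus G) (nontrivial : IsNontrivial G)
  (counted : HasCycleCount G (suc κ)) (diameter : IsDiameter G d) where

  open CountedCycles cactus nontrivial counted

  excess : ℕ
  excess = sum (λ v → degree G v ℕ.∸ 4)

  private
    u v : Fin n
    u = proj₁ (proj₁ diameter)
    v = proj₁ (proj₂ (proj₁ diameter))

    open Levels cactus nontrivial counted v

    d≤lev : d ℕ.≤ lev u
    d≤lev = proj₂ (proj₂ (proj₂ (proj₁ diameter))) (lev u) (lev-walk u)

  2d+excess≤size : 2 ℕ.* d ℕ.+ excess ℕ.≤ size
  2d+excess≤size = ℕ.≤-trans (ℕ.+-monoˡ-≤ excess (ℕ.*-monoʳ-≤ 2 d≤lev)) (2*lev+excess≤size u)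

  size≡n+κ : size ≡ n ℕ.+ κ
  size≡n+κ = ℕ.suc-injective (trans (ℕ.+-comm 1 size) (trans size+1≡n+k (ℕ.+-suc n κ)))

  σ : ℕ
  σ = size ℕ.∸ (2 ℕ.* d ℕ.+ excess)

  balance : n ℕ.+ κ ≡ 2 ℕ.* d ℕ.+ excess ℕ.+ σ
  balance = trans (sym size≡n+κ) (sym (ℕ.m+[n∸m]≡n 2d+excess≤size))

  -- The argument `zero` names a cycle, present because there are `suc κ` of them; it rules out
  -- degree 0.
  module Final = RandićBound ℝ-roots (adj G) (adj-sym G) (adj-irrefl G) (degree G) degree-sum (degree-2-or-4+ zero)

  deg-total : sum (degree G) ≡ 2 ℕ.* (n ℕ.+ κ)
  deg-total = trans handshake (cong (2 ℕ.*_) size≡n+κ)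

  lower₁ : - ((fromℕ (suc κ) - 1ℝ) * (fromℕ 2 - √ 2)) ≤ randić G - fromℕ d
  lower₁ = Final.bound₁ κ d σ deg-total balance {fromℚ (+ d ℚ./ 2)} {fromℚ (+ n ℚ./ 4)} (fromℚ-/ d 1) (fromℚ-/ n 3)

  lower₂ : fromℚ (+ n ℚ./ 4) - (fromℕ (suc κ) - 1ℝ) * (fromℚ (+ 7 ℚ./ 4) - √ 2) ≤ randić G - fromℚ (+ d ℚ./ 2)
  lower₂ = Final.bound₂ κ d σ deg-total balance {fromℚ (+ d ℚ./ 2)} {fromℚ (+ n ℚ./ 4)} (fromℚ-/ d 1) (fromℚ-/ n 3)

  module Equality (path : BCTreeIsPath G) (symmetric : IsLongitudinallySymmetric G) where

    open Chain cactus nontrivial counted path symmetric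

    σ≡0 : σ ≡ 0
    σ≡0 = ℕ.m≤n⇒m∸n≡0 (ℕ.≤-trans (size≤2*diameter diameter) (ℕ.m≤m+n (2 ℕ.* d) excess))

    degree-shared : ∀ {v} → Shared v → degree G v ≡ 4
    degree-shared {v} s = trans (degree≡2*cyclesAt v) (cong (2 ℕ.*_) (shared⇒cyclesAt≡2 s))

    degree-unshared : ∀ {v} → ¬ Shared v → degree G v ≡ 2
    degree-unshared {v} ¬s = trans (degree≡2*cyclesAt v)
      (cong (2 ℕ.*_) (ℕ.≤-antisym (unshared⇒cyclesAt≤1 ¬s) (1≤cyclesAt zero v)))

    degree-2-or-4 : ∀ v → degree G v ≡ 2 ⊎ degree G v ≡ 4
    degree-2-or-4 v with Shared? v
    ... | yes s = inj₂ (degree-shared s)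
    ... | no ¬s = inj₁ (degree-unshared ¬s)

    separated : ∀ u v → T (adj G u v) → degree G u ≡ 2 ⊎ degree G v ≡ 2
    separated u v uv with Shared? u | Shared? v
    ... | yes su | yes sv = contradiction sv (shared-nonadjacent uv su)
    ... | no ¬s | _ = inj₁ (degree-unshared ¬s)
    ... | yes _ | no ¬s = inj₂ (degree-unshared ¬s)

    equal₁ : randić G - fromℕ d ≈ - ((fromℕ (suc κ) - 1ℝ) * (fromℕ 2 - √ 2))
    equal₁ = Final.equality₁ κ d σ deg-total balance {fromℚ (+ d ℚ./ 2)} {fromℚ (+ n ℚ./ 4)} (fromℚ-/ d 1) (fromℚ-/ n 3)
      σ≡0 degree-2-or-4 separated

    equal₂ : randić G - fromℚ (+ d ℚ./ 2) ≈ fromℚ (+ n ℚ./ 4) - (fromℕ (suc κ) - 1ℝ) * (fromℚ (+ 7 ℚ./ 4) - √ 2)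
    equal₂ = Final.equality₂ κ d σ deg-total balance {fromℚ (+ d ℚ./ 2)} {fromℚ (+ n ℚ./ 4)} (fromℚ-/ d 1) (fromℚ-/ n 3)
      σ≡0 degree-2-or-4 separated

theorem5p2 : ∀ {n k d : ℕ} (G : Graph n) →
    IsCactus G → IsNontrivial G →
    HasCycleCount G k → 1 ℕ.≤ k →
    IsDiameter G d →
    let R = randić G in
    (- ((fromℕ k - 1ℝ) * (fromℕ 2 - √ 2)) ≤ R - fromℕ d)
    × (fromℚ (+ n ℚ./ 4) - (fromℕ k - 1ℝ) * (fromℚ (+ 7 ℚ./ 4) - √ 2) ≤ R - fromℚ (+ d ℚ./ 2))
    × (BCTreeIsPath G → IsLongitudinallySymmetric G →
    (R - fromℕ d ≈ - ((fromℕ k - 1ℝ) * (fromℕ 2 - √ 2)))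
    × (R - fromℚ (+ d ℚ./ 2) ≈ fromℚ (+ n ℚ./ 4) - (fromℕ k - 1ℝ) * (fromℚ (+ 7 ℚ./ 4) - √ 2)))
-- The excluded case `k = 0` is the graph with a single vertex, for which both bounds fail.
theorem5p2 {k = suc κ} G cactus nontrivial counted _ diameter =
  lower₁ , lower₂ , λ path symmetric → Equality.equal₁ path symmetric , Equality.equal₂ path symmetric
  where open Bounds G cactus nontrivial counted diameter
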